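{- If $T$ is a 1-point lattice tetrahedron, then $T$ is equivalent to one of $T_{3,3,4}$, $T_{2,2,5}$, $T_{2,4,7}$, $T_{2,6,11}$, $T_{2,7,13}$, $T_{2,9,17}$, $T_{2,13,19}$, $T_{3,7,20}$.
   Context: A lattice tetrahedron is a non-degenerate tetrahedron with vertices in $\mathbb{Z}^3$; it is clean if the only lattice points on its boundary are its vertices. A 1-point lattice tetrahedron is a clean lattice tetrahedron with exactly one lattice point in its interior. For $(a,b,n)\in\mathbb{Z}^3$, $n\ne0$, $T_{a,b,n}$ is the tetrahedron with vertices $(0,0,0),(1,0,0),(0,1,0),(a,b,n)$. Two lattice tetrahedra are equivalent if some map $v\mapsto Mv+u$ with $M\in M_3(\mathbb{Z})$, $\det M=\pm1$, $u\in\mathbb{Z}^3$ maps the vertex set of one onto the vertex set of the other (in any order). -}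

module Defs where

open import Data.Nat as ℕ using (ℕ)
open import Data.Integer as ℤ using (ℤ; +_; -_; _+_; _*_; _-_)
open import Data.Product using (Σ; ∃; ∃-syntax; _×_; _,_)
open import Data.Sum using (_⊎_)
open import Data.Fin using (Fin; zero; suc)
open import Data.Fin.Permutation using (Permutation′; _⟨$⟩ʳ_)
open import Relation.Binary.PropositionalEquality using (_≡_; _≢_)
open import Relation.Nullary using (¬_)

record Point : Set where
  constructor ⟨_,_,_⟩
  field
    x y z : ℤ
open Point public

_⊕_ : Point → Point → Point
⟨ a , b , c ⟩ ⊕ ⟨ d , e , f ⟩ = ⟨ a + d , b + e , c + f ⟩

_⊖_ : Point → Point → Point
⟨ a , b , c ⟩ ⊖ ⟨ d , e , f ⟩ = ⟨ a - d , b - e , c - f ⟩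

_·_ : ℤ → Point → Point
k · ⟨ a , b , c ⟩ = ⟨ k * a , k * b , k * c ⟩

origin : Point
origin = ⟨ + 0 , + 0 , + 0 ⟩

dot : Point → Point → ℤ
dot ⟨ a , b , c ⟩ ⟨ d , e , f ⟩ = a * d + b * e + c * f

det3 : Point → Point → Point → ℤ
det3 ⟨ a , b , c ⟩ ⟨ d , e , f ⟩ ⟨ g , h , i ⟩ =
  a * (e * i - f * h) - b * (d * i - f * g) + c * (d * h - e * g)

record Matrix : Set where
  constructor mat
  field
    row₀ row₁ row₂ : Point
open Matrix public

detM : Matrix → ℤ
detM (mat r₀ r₁ r₂) = det3 r₀ r₁ r₂

apply : Matrix → Point → Point
apply (mat r₀ r₁ r₂) p = ⟨ dot r₀ p , dot r₁ p , dot r₂ p ⟩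

Tetra : Set
Tetra = Fin 4 → Point

NonDegenerate : Tetra → Set
NonDegenerate v = det3 (v (suc zero) ⊖ v zero) (v (suc (suc zero)) ⊖ v zero)
                       (v (suc (suc (suc zero))) ⊖ v zero) ≢ + 0

sum4 : (Fin 4 → ℕ) → ℕ
sum4 μ = μ zero ℕ.+ μ (suc zero) ℕ.+ μ (suc (suc zero)) ℕ.+ μ (suc (suc (suc zero)))

combo4 : (Fin 4 → ℕ) → Tetra → Point
combo4 μ v = ((+ μ zero) · v zero) ⊕ (((+ μ (suc zero)) · v (suc zero)) ⊕
             (((+ μ (suc (suc zero))) · v (suc (suc zero))) ⊕
              ((+ μ (suc (suc (suc zero)))) · v (suc (suc (suc zero))))))

-- p = Σ (μᵢ / N) vᵢ with μᵢ ≥ 0, Σ μᵢ = N > 0 : p is a convex combination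
-- of the vertices with (nonnegative rational) barycentric weights μᵢ / N.
Barycentric : Tetra → Point → ℕ → (Fin 4 → ℕ) → Set
Barycentric v p N μ = (0 ℕ.< N) × (sum4 μ ≡ N) × ((+ N) · p ≡ combo4 μ v)

InTetra : Tetra → Point → Set
InTetra v p = ∃[ N ] ∃[ μ ] Barycentric v p N μ

InInterior : Tetra → Point → Set
InInterior v p = ∃[ N ] ∃[ μ ] (Barycentric v p N μ × (∀ i → 0 ℕ.< μ i))

OnBoundary : Tetra → Point → Set
OnBoundary v p = ∃[ N ] ∃[ μ ] (Barycentric v p N μ × ∃[ i ] (μ i ≡ 0))

IsVertex : Tetra → Point → Set
IsVertex v p = ∃[ i ] (p ≡ v i)

LatticeTetra : Tetra → Set
LatticeTetra = NonDegenerate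

Clean : Tetra → Set
Clean v = LatticeTetra v × (∀ p → OnBoundary v p → IsVertex v p)

OnePoint : Tetra → Set
OnePoint v = Clean v × ∃[ p ] (InInterior v p × (∀ q → InInterior v q → q ≡ p))

T : ℤ → ℤ → ℤ → Tetra
T a b n zero = origin
T a b n (suc zero) = ⟨ + 1 , + 0 , + 0 ⟩
T a b n (suc (suc zero)) = ⟨ + 0 , + 1 , + 0 ⟩
T a b n (suc (suc (suc zero))) = ⟨ a , b , n ⟩

Equivalent : Tetra → Tetra → Set
Equivalent v w =
  Σ Matrix λ M → Σ Point λ u → Σ (Permutation′ 4) λ σ →
    ((detM M ≡ + 1 ⊎ detM M ≡ - (+ 1)) ×
     (∀ i → apply M (v i) ⊕ u ≡ w (σ ⟨$⟩ʳ i)))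

{-# OPTIONS --safe #-}
{- A clean facet spans a primitive sublattice, so the tetrahedron is equivalent to T a b n with
0 ≤ a, b < n.  Modulo the lattice of its vertices, the lattice points then form the cyclic group
generated by c = (a + b - 1, -a, -b, 1) in (ℤ/n)⁴.  Let S k be the sum of the residues of k c in
[0, n), a multiple of n.  The multiples k c with S k = n are the lattice points in the interior, so
exactly one ξ = z c has this property, and S k = 2n unless k c is 0, ξ or -ξ.

For the multiples of ξ this says that the sum of the floors of k ξᵢ / n is k - 2, from k = 2 until
k ξ = -ξ.  Tracking these floors, of which exactly one increases at each step, is a finite search:
it ends before k = 19 and leaves ξ / n = d / m for seven pairs (m, d) up to order.

Write n = m g.  For 0 < r < g the coset r c + ⟨ξ⟩ only contains points with S = 2n, which makes the
digits of r c / g highly constrained, while two values of r cannot share the same digits.  By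
pigeonhole g ≤ 7, and the remaining pairs a, b are enumerated. -}
module Submission where

-- Negation explains the possible values of S. By cleanness no coordinate of a nonzero k c vanishes,
-- so S k and S (- k) add up to 4n, and negation exchanges the levels n and 3n. Hence 3n occurs only
-- at -ξ, and every further nonzero point is forced to 2n.
--
-- The obstacle is that n is not bounded in advance. The search never refers to n: a state holds
-- rational intervals for the ratios ξᵢ / n, and a branch dies once an interval is empty or the four
-- ratios can no longer add up to 1. The outcome is therefore ξ up to the scale g, and ⟨ξ⟩ may be a
-- proper subgroup of the cyclic group. The cosets bound g because a residue splits as ρ + ζ g with
-- ρ < g: moving along a coset of ⟨ξ⟩ alters only the upper digits ζ, while a fixed value of S keeps
-- their sum constant.
--
-- A factor g > 1 does occur, for 20 = 4 · 5 with ξ / n = (1, 1, 1, 1) / 4. The other seven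
-- tetrahedra have n = m.

module FloorSearch where

  open import Defs using (sum4)
  open import Data.Bool using (Bool; true; false; _∧_; if_then_else_) renaming (T to True)
  open import Data.Bool.Properties using (T-∧)
  open import Data.Empty using (⊥; ⊥-elim)
  open import Data.Fin using (Fin; zero; suc)
  open import Data.Fin.Patterns using (0F; 1F; 2F; 3F)
  open import Data.Nat
  open import Data.Nat.Properties
  open import Data.Nat.DivMod
  open import Data.Nat.Divisibility using (divides; m%n≡0⇒n∣m)
  open import Data.Nat.Tactic.RingSolver using (solve-∀)
  open import Data.Product using (∃; _×_; _,_; proj₁; proj₂)
  open import Function.Bundles using (Equivalence)
  open import Relation.Binary.PropositionalEquality
  open import Relation.Binary.Definitions using (tri<; tri≈; tri>)

  -- The floor search on rational intervals.

  sum4-cong : ∀ {f g : Fin 4 → ℕ} → (∀ i → f i ≡ g i) → sum4 f ≡ sum4 g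
  sum4-cong e = cong₂ _+_ (cong₂ _+_ (cong₂ _+_ (e zero) (e 1F)) (e 2F)) (e 3F)

  sum4-+ : ∀ (f g : Fin 4 → ℕ) → sum4 (λ i → f i + g i) ≡ sum4 f + sum4 g
  sum4-+ f g = lemma (f zero) _ _ _ _ _ _ _
    where
    lemma : ∀ a b c d a′ b′ c′ d′ → (a + a′) + (b + b′) + (c + c′) + (d + d′) ≡ (a + b + c + d) + (a′ + b′ + c′ + d′)
    lemma = solve-∀

  sum4-*ˡ : ∀ k (f : Fin 4 → ℕ) → sum4 (λ i → k * f i) ≡ k * sum4 f
  sum4-*ˡ k f = lemma k (f zero) _ _ _
    where
    lemma : ∀ k a b c d → k * a + k * b + k * c + k * d ≡ k * (a + b + c + d)
    lemma = solve-∀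

  sum4-*ʳ : ∀ k (f : Fin 4 → ℕ) → sum4 (λ i → f i * k) ≡ sum4 f * k
  sum4-*ʳ k f = lemma k (f zero) _ _ _
    where
    lemma : ∀ k a b c d → a * k + b * k + c * k + d * k ≡ (a + b + c + d) * k
    lemma = solve-∀

  sum4-mono-< : ∀ {f g : Fin 4 → ℕ} → (∀ i → f i < g i) → sum4 f < sum4 g
  sum4-mono-< l = +-mono-< (+-mono-< (+-mono-< (l zero) (l 1F)) (l 2F)) (l 3F)

  -- Knowledge about one coordinate at the current k: `floor` is the integer part of k ξᵢ / n, and
  -- the ratio ξᵢ / n lies strictly between lnum / lden and unum / uden.
  record Cell : Set where
    constructor cell
    field
      floor lnum lden unum uden : ℕ
  open Cell

  record State : Set where
    constructor ⟪_,_,_,_⟫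
    field
      c₀ c₁ c₂ c₃ : Cell

  at : State → Fin 4 → Cell
  at ⟪ a , b , c , d ⟫ zero = a
  at ⟪ a , b , c , d ⟫ 1F = b
  at ⟪ a , b , c , d ⟫ 2F = c
  at ⟪ a , b , c , d ⟫ 3F = d

  -- A floor f that increases from k to k + 1 shows that (f + 1) / (k + 1) is below the ratio, and
  -- one that does not shows that it is above. The comparison retains the old bound when that is at
  -- least as sharp.
  raise keep : ℕ → Cell → Cell
  raise k (cell f p q u v) =
    if p * suc k <ᵇ suc f * q then cell (suc f) (suc f) (suc k) u v else cell (suc f) p q u v
  keep k (cell f p q u v) =
    if suc f * v <ᵇ u * suc k then cell f p q (suc f) (suc k) else cell f p q u v

  raiseAt : ℕ → Fin 4 → State → State
  raiseAt k zero ⟪ a , b , c , d ⟫ = ⟪ raise k a , keep k b , keep k c , keep k d ⟫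
  raiseAt k 1F ⟪ a , b , c , d ⟫ = ⟪ keep k a , raise k b , keep k c , keep k d ⟫
  raiseAt k 2F ⟪ a , b , c , d ⟫ = ⟪ keep k a , keep k b , raise k c , keep k d ⟫
  raiseAt k 3F ⟪ a , b , c , d ⟫ = ⟪ keep k a , keep k b , keep k c , raise k d ⟫

  keepAll : ℕ → State → State
  keepAll k ⟪ a , b , c , d ⟫ = ⟪ keep k a , keep k b , keep k c , keep k d ⟫

  floor-raise : ∀ k c → floor (raise k c) ≡ suc (floor c)
  floor-raise k (cell g p q u v) with p * suc k <ᵇ suc g * q
  ... | true = refl
  ... | false = refl
  floor-keep : ∀ k c → floor (keep k c) ≡ floor c
  floor-keep k (cell g p q u v) with suc g * v <ᵇ u * suc k
  ... | true = refl
  ... | false = refl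

  floors-raiseAt : ∀ k i s → sum4 (λ j → floor (at (raiseAt k i s) j)) ≡ suc (sum4 (λ j → floor (at s j)))
  floors-raiseAt k 0F ⟪ a , b , c , d ⟫
    rewrite floor-raise k a | floor-keep k b | floor-keep k c | floor-keep k d = refl
  floors-raiseAt k 1F ⟪ a , b , c , d ⟫
    rewrite floor-keep k a | floor-raise k b | floor-keep k c | floor-keep k d = shift₁ (floor a) _ _ _
    where
    shift₁ : ∀ a b c d → a + suc b + c + d ≡ suc (a + b + c + d)
    shift₁ = solve-∀
  floors-raiseAt k 2F ⟪ a , b , c , d ⟫
    rewrite floor-keep k a | floor-keep k b | floor-raise k c | floor-keep k d = shift₂ (floor a) _ _ _
    where
    shift₂ : ∀ a b c d → a + b + suc c + d ≡ suc (a + b + c + d)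
    shift₂ = solve-∀
  floors-raiseAt k 3F ⟪ a , b , c , d ⟫
    rewrite floor-keep k a | floor-keep k b | floor-keep k c | floor-raise k d = shift₃ (floor a) _ _ _
    where
    shift₃ : ∀ a b c d → a + b + c + suc d ≡ suc (a + b + c + d)
    shift₃ = solve-∀

  infixl 6 _⊞_
  _⊞_ : ℕ × ℕ → ℕ × ℕ → ℕ × ℕ
  (p , q) ⊞ (p′ , q′) = p * q′ + p′ * q , q * q′

  lower upper : Cell → ℕ × ℕ
  lower c = lnum c , lden c
  upper c = unum c , uden c

  lowerSum upperSum : State → ℕ × ℕ
  lowerSum ⟪ a , b , c , d ⟫ = lower a ⊞ lower b ⊞ lower c ⊞ lower d
  upperSum ⟪ a , b , c , d ⟫ = upper a ⊞ upper b ⊞ upper c ⊞ upper d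

  nonempty : Cell → Bool
  nonempty (cell _ p q u v) = p * v <ᵇ u * q

  all4 : (Fin 4 → Bool) → Bool
  all4 p = p zero ∧ (p 1F ∧ (p 2F ∧ p 3F))

  -- The ratios add up to 1, so 1 has to lie strictly between the sum of the lower and the sum of
  -- the upper bounds. This couples the four coordinates, which are otherwise tracked separately.
  feasible : State → Bool
  feasible s =
    all4 (λ i → nonempty (at s i)) ∧
    ((proj₁ (lowerSum s) <ᵇ proj₂ (lowerSum s)) ∧ (proj₂ (upperSum s) <ᵇ proj₁ (upperSum s)))

  inside : ℕ → ℕ → Cell → Bool
  inside m d (cell _ p q u v) = (p * m <ᵇ q * d) ∧ (v * d <ᵇ u * m)

  -- If no floor increases, then (k + 1) ξ = -ξ, so (k + 2) ξ vanishes modulo n. Its coordinates are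
  -- then the next multiples of n, and (floor + 1) / (k + 2) are the ratios.
  target : State → Fin 4 → ℕ
  target s i = suc (floor (at s i))

  _⇒ᵇ_ : Bool → Bool → Bool
  b ⇒ᵇ c = if b then c else true

  module _ (good : ℕ → (Fin 4 → ℕ) → Bool) where

    -- The first conjunct is the leaf where no floor increases, the second the four branches where
    -- exactly one does. Running out of fuel counts as failure, so success certifies that no branch
    -- goes deeper.
    search : ℕ → ℕ → State → Bool
    search zero k s = false
    search (suc fuel) k s =
      (all4 (λ i → inside (2 + k) (target s i) (at (keepAll k s) i)) ⇒ᵇ good (2 + k) (target s)) ∧
      all4 (λ i → feasible (raiseAt k i s) ⇒ᵇ search fuel (suc k) (raiseAt k i s))

  ∧-intro : ∀ {a b} → True a → True b → True (a ∧ b)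
  ∧-intro p q = Equivalence.from T-∧ (p , q)

  ∧-elim : ∀ {a b} → True (a ∧ b) → True a × True b
  ∧-elim = Equivalence.to T-∧

  all4-intro : ∀ p → (∀ i → True (p i)) → True (all4 p)
  all4-intro p h = ∧-intro (h zero) (∧-intro (h 1F) (∧-intro (h 2F) (h 3F)))

  all4-elim : ∀ p → True (all4 p) → ∀ i → True (p i)
  all4-elim p h zero = proj₁ (∧-elim h)
  all4-elim p h 1F = proj₁ (∧-elim (proj₂ (∧-elim {p zero} h)))
  all4-elim p h 2F = proj₁ (∧-elim (proj₂ (∧-elim {p 1F} (proj₂ (∧-elim {p zero} h)))))
  all4-elim p h 3F =
    proj₂ (∧-elim {p 2F} (proj₂ (∧-elim {p 1F} (proj₂ (∧-elim {p zero} h)))))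

  ⇒ᵇ-elim : ∀ {a b} → True (a ⇒ᵇ b) → True a → True b
  ⇒ᵇ-elim {true} h _ = h

  module _ (n : ℕ) .{{_ : NonZero n}} where

    record Within (k x : ℕ) (c : Cell) : Set where
      constructor within
      field
        above : floor c * n < k * x
        below : k * x < suc (floor c) * n
        lo    : lnum c * n < lden c * x
        hi    : uden c * x < unum c * n
        -- Without it, hi would be vacuous for a zero denominator.
        den>0 : 0 < uden c
    open Within

    module _ {k x : ℕ} where
      raise-within : ∀ c → Within k x c → suc (floor c) * n < suc k * x → x < n → Within (suc k) x (raise k c)
      raise-within (cell f p q u v) w up x<n with p * suc k <ᵇ suc f * q
      ... | true  = within up (+-mono-< x<n (below w)) up (hi w) (den>0 w)
      ... | false = within up (+-mono-< x<n (below w)) (lo w) (hi w) (den>0 w)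

      keep-within : ∀ c → Within k x c → suc k * x < suc (floor c) * n → Within (suc k) x (keep k c)
      keep-within (cell f p q u v) w dn with suc f * v <ᵇ u * suc k
      ... | true  = within (<-≤-trans (above w) (m≤n+m (k * x) x)) dn (lo w) dn z<s
      ... | false = within (<-≤-trans (above w) (m≤n+m (k * x) x)) dn (lo w) (hi w) (den>0 w)

    private
      swap² : ∀ a b c → a * b * c ≡ a * c * b
      swap² = solve-∀

    positive-denominator : ∀ {a b c} → a < b * c → 0 < b
    positive-denominator {b = suc _} _ = z<s

    <ᵇ-cancel : ∀ a b → a * n < b * n → True (a <ᵇ b)
    <ᵇ-cancel a b l = <⇒<ᵇ (*-cancelʳ-< n a b l)

    nonempty-within : ∀ {k x} c → Within k x c → True (nonempty c)
    nonempty-within {k} {x} (cell f p q u v) w = <ᵇ-cancel (p * v) (u * q) step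
      where
      open ≤-Reasoning
      step : p * v * n < u * q * n
      step = begin-strict
        p * v * n     ≡⟨ swap² p v n ⟩
        p * n * v     ≤⟨ *-monoˡ-≤ v (<⇒≤ (lo w)) ⟩
        q * x * v     ≡⟨ trans (swap² q x v) (*-assoc q v x) ⟩
        q * (v * x)   <⟨ *-monoʳ-< q {{>-nonZero (positive-denominator (lo w))}} (hi w) ⟩
        q * (u * n)   ≡⟨ trans (sym (*-assoc q u n)) (cong (_* n) (*-comm q u)) ⟩
        u * q * n     ∎

    inside-within : ∀ {k x} m d c → Within k x c → m * x ≡ d * n → 0 < m → True (inside m d c)
    inside-within {k} {x} m d (cell f p q u v) w eq 0<m =
      ∧-intro {p * m <ᵇ q * d} {v * d <ᵇ u * m}
        (<ᵇ-cancel (p * m) (q * d) lo-step) (<ᵇ-cancel (v * d) (u * m) hi-step)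
      where
      open ≤-Reasoning
      instance _ = >-nonZero 0<m
      lo-step : p * m * n < q * d * n
      lo-step = begin-strict
        p * m * n    ≡⟨ swap² p m n ⟩
        p * n * m    <⟨ *-monoˡ-< m (lo w) ⟩
        q * x * m    ≡⟨ trans (*-assoc q x m) (cong (q *_) (trans (*-comm x m) eq)) ⟩
        q * (d * n)  ≡⟨ sym (*-assoc q d n) ⟩
        q * d * n    ∎
      hi-step : v * d * n < u * m * n
      hi-step = begin-strict
        v * d * n    ≡⟨ trans (*-assoc v d n) (cong (v *_) (trans (sym eq) (*-comm m x))) ⟩
        v * (x * m)  ≡⟨ sym (*-assoc v x m) ⟩
        v * x * m    <⟨ *-monoˡ-< m (hi w) ⟩
        u * n * m    ≡⟨ swap² u n m ⟩
        u * m * n    ∎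

    Below Above : ℕ × ℕ → ℕ → Set
    Below (p , q) x = p * n < q * x
    Above (p , q) x = q * x < p * n

    private
      expandˡ : ∀ p q p′ q′ n → (p * q′ + p′ * q) * n ≡ q′ * (p * n) + q * (p′ * n)
      expandˡ = solve-∀
      expandʳ : ∀ q q′ x y → q * q′ * (x + y) ≡ q′ * (q * x) + q * (q′ * y)
      expandʳ = solve-∀

    below-⊞ : ∀ {r s x y} → Below r x → Below s y → Below (r ⊞ s) (x + y)
    below-⊞ {p , q} {p′ , q′} {x} {y} l l′ =
      subst₂ _<_ (sym (expandˡ p q p′ q′ n)) (sym (expandʳ q q′ x y))
        (+-mono-< (*-monoʳ-< q′ {{>-nonZero (positive-denominator l′)}} l)
                  (*-monoʳ-< q {{>-nonZero (positive-denominator l)}} l′))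

    above-⊞ : ∀ {r s x y} → 0 < proj₂ r → 0 < proj₂ s → Above r x → Above s y → Above (r ⊞ s) (x + y)
    above-⊞ {p , q} {p′ , q′} {x} {y} 0<q 0<q′ l l′ =
      subst₂ _<_ (sym (expandʳ q q′ x y)) (sym (expandˡ p q p′ q′ n))
        (+-mono-< (*-monoʳ-< q′ {{>-nonZero 0<q′}} l) (*-monoʳ-< q {{>-nonZero 0<q}} l′))

    record Valid (k : ℕ) (x : Fin 4 → ℕ) (s : State) : Set where
      constructor valid
      field
        cells  : ∀ i → Within k (x i) (at s i)
        floors : 2 + sum4 (λ i → floor (at s i)) ≡ k
    open Valid

    private
      *>0 : ∀ {a b} → 0 < a → 0 < b → 0 < a * b
      *>0 = *-mono-<

    feasible-valid : ∀ {k x} s → (∀ i → Within k (x i) (at s i)) → sum4 x ≡ n → True (feasible s)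
    feasible-valid {k} {x} s@(⟪ a , b , c , d ⟫) w total =
      ∧-intro {all4 (λ i → nonempty (at s i))} (all4-intro _ (λ i → nonempty-within (at s i) (w i)))
        (∧-intro {proj₁ (lowerSum s) <ᵇ proj₂ (lowerSum s)}
          (<ᵇ-cancel (proj₁ (lowerSum s)) (proj₂ (lowerSum s))
            (subst (λ t → proj₁ (lowerSum s) * n < proj₂ (lowerSum s) * t) total lows))
          (<ᵇ-cancel (proj₂ (upperSum s)) (proj₁ (upperSum s))
            (subst (λ t → proj₂ (upperSum s) * t < proj₁ (upperSum s) * n) total highs)))
      where
      lows : Below (lowerSum s) (sum4 x)
      lows = below-⊞ {lower a ⊞ lower b ⊞ lower c} {lower d} (below-⊞ {lower a ⊞ lower b} {lower c} (below-⊞ {lower a} {lower b} (lo (w 0F)) (lo (w 1F))) (lo (w 2F))) (lo (w 3F))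
      u₁ : 0 < uden a * uden b
      u₁ = *>0 (den>0 (w 0F)) (den>0 (w 1F))
      highs : Above (upperSum s) (sum4 x)
      highs = above-⊞ {upper a ⊞ upper b ⊞ upper c} {upper d} (*>0 u₁ (den>0 (w 2F))) (den>0 (w 3F))
                (above-⊞ {upper a ⊞ upper b} {upper c} u₁ (den>0 (w 2F))
                  (above-⊞ {upper a} {upper b} (den>0 (w 0F)) (den>0 (w 1F)) (hi (w 0F)) (hi (w 1F))) (hi (w 2F)))
                (hi (w 3F))

    between-multiples : ∀ a {x} → x % n ≡ 0 → a * n < x → x < (2 + a) * n → x ≡ suc a * n
    between-multiples a {x} r l u with m%n≡0⇒n∣m x n r
    ... | divides q refl = cong (_* n) (≤-antisym (≤-pred (*-cancelʳ-< n q (2 + a) u)) (*-cancelʳ-< n a q l))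

    remainder : ∀ a {x} → a * n ≤ x → x < suc a * n → x % n + a * n ≡ x
    remainder a {x} l u = trans (cong (λ y → x % n + y * n) (≤-antisym q≥a q≤a)) (sym (m≡m%n+[m/n]*n x n))
      where
      q≤a : x / n ≤ a
      q≤a = ≤-pred (m<n*o⇒m/o<n u)
      q≥a : a ≤ x / n
      q≥a = subst (_≤ x / n) (m*n/n≡m a n) (/-monoˡ-≤ n l)

    -- The walk along the multiples of ξ.

    module Walk (x : Fin 4 → ℕ) (total : sum4 x ≡ n) (x>0 : ∀ i → 0 < x i) (x<n : ∀ i → x i < n)
      (all-zero : ∀ k i → (k * x i) % n ≡ 0 → ∀ j → (k * x j) % n ≡ 0)
      -- These two express that ξ is the only point of level n and -ξ the only one of level 3n: from
      -- (k + 1) ξ = ξ follows k ξ = 0, and from k ξ = -ξ follows (k + 1) ξ = 0.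
      (one   : ∀ k → sum4 (λ i → (suc k * x i) % n) ≡ n → ∀ i → (k * x i) % n ≡ 0)
      (three : ∀ k → sum4 (λ i → (k * x i) % n) ≡ 3 * n → ∀ i → (suc k * x i) % n ≡ 0)
      where

      sum4-multiple : ∀ k → sum4 (λ i → k * x i) ≡ k * n
      sum4-multiple k = trans (sum4-*ˡ k x) (cong (k *_) total)

      remainders : ∀ k (f : Fin 4 → ℕ) → (∀ i → f i * n ≤ k * x i) → (∀ i → k * x i < suc (f i) * n) →
                   sum4 (λ i → (k * x i) % n) + sum4 f * n ≡ k * n
      remainders k f l u = begin
        sum4 (λ i → (k * x i) % n) + sum4 f * n               ≡⟨ cong (sum4 (λ i → (k * x i) % n) +_) (sym (sum4-*ʳ n f)) ⟩
        sum4 (λ i → (k * x i) % n) + sum4 (λ i → f i * n)     ≡⟨ sym (sum4-+ (λ i → (k * x i) % n) (λ i → f i * n)) ⟩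
        sum4 (λ i → (k * x i) % n + f i * n)                  ≡⟨ sum4-cong (λ i → remainder (f i) (l i) (u i)) ⟩
        sum4 (λ i → k * x i)                                  ≡⟨ sum4-multiple k ⟩
        k * n ∎
        where open ≡-Reasoning

      data Move (k : ℕ) (c : Cell) (y : ℕ) : ℕ → Set where
        stay : suc k * y < suc (floor c) * n → Move k c y 0
        jump : suc (floor c) * n < suc k * y → Move k c y 1

      module _ (k : ℕ) (s : State) (v : Valid (suc k) x s) where
        private
          f : Fin 4 → ℕ
          f i = floor (at s i)
          K : ℕ
          K = suc k

        nonzero : ∀ i → (K * x i) % n ≢ 0
        nonzero i z = <-irrefl refl (begin-strict
            suc (f i) * n   ≡⟨ between-multiples (f i) z (above (cells v i)) (<-trans (below (cells v i)) (*-monoˡ-< n (n<1+n (suc (f i))))) ⟨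
            K * x i         <⟨ below (cells v i) ⟩
            suc (f i) * n   ∎)
          where open ≤-Reasoning

        upper-next : ∀ i → suc K * x i < (2 + f i) * n
        upper-next i = +-mono-< (x<n i) (below (cells v i))

        lower-next : ∀ i → f i * n < suc K * x i
        lower-next i = <-≤-trans (above (cells v i)) (m≤n+m (K * x i) (x i))

        -- One zero coordinate makes all of them zero, and each coordinate of the next multiple
        -- would be exactly (fᵢ + 1) n. These add up to (K + 2) n, which exceeds the true total (K +
        -- 1) n.
        not-multiple : ∀ i → (suc K * x i) % n ≢ 0
        not-multiple i z = 1+n≢n (sym (*-cancelʳ-≡ (suc K) (2 + K) n (begin
            suc K * n                     ≡⟨ sum4-multiple (suc K) ⟨
            sum4 (λ j → suc K * x j)      ≡⟨ sum4-cong (λ j → between-multiples (f j) (all-zero (suc K) i z j) (lower-next j) (upper-next j)) ⟩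
            sum4 (λ j → suc (f j) * n)    ≡⟨ sum4-*ʳ n (λ j → suc (f j)) ⟩
            sum4 (λ j → suc (f j)) * n    ≡⟨ cong (_* n) (trans (sum4-+ (λ _ → 1) f) (cong (2 +_) (floors v))) ⟩
            (2 + K) * n ∎)))
          where open ≡-Reasoning

        move : ∀ i → ∃ λ e → Move K (at s i) (x i) e
        move i with <-cmp (suc K * x i) (suc (f i) * n)
        ... | tri< l _ _ = 0 , stay l
        ... | tri≈ _ e _ = ⊥-elim (not-multiple i (trans (cong (_% n) e) (m*n%n≡0 (suc (f i)) n)))
        ... | tri> _ _ l = 1 , jump l

        -- Residues and floors share the total (K + 1) n. The old floors account for (K - 2) n of
        -- it, which leaves 3n for the residues and the jumps.
        remainders-move : ∀ (e : Fin 4 → ℕ) → (∀ i → Move K (at s i) (x i) (e i)) →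
                          sum4 (λ i → (suc K * x i) % n) + sum4 e * n ≡ 3 * n
        remainders-move e m = +-cancelʳ-≡ (sum4 f * n) _ _ (begin
            S + sum4 e * n + sum4 f * n      ≡⟨ +-assoc S _ _ ⟩
            S + (sum4 e * n + sum4 f * n)    ≡⟨ cong (S +_) (sym (*-distribʳ-+ n (sum4 e) (sum4 f))) ⟩
            S + (sum4 e + sum4 f) * n        ≡⟨ cong (λ t → S + t * n) (sym (sum4-+ e f)) ⟩
            S + sum4 (λ i → e i + f i) * n   ≡⟨ remainders (suc K) (λ i → e i + f i) (λ i → low (m i)) (λ i → high (m i)) ⟩
            suc K * n                        ≡⟨ cong (λ t → suc t * n) (sym (floors v)) ⟩
            (3 + sum4 f) * n                 ≡⟨ *-distribʳ-+ n 3 (sum4 f) ⟩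
            3 * n + sum4 f * n               ∎)
          where
          open ≡-Reasoning
          S = sum4 (λ i → (suc K * x i) % n)
          low : ∀ {i e} → Move K (at s i) (x i) e → (e + f i) * n ≤ suc K * x i
          low {i} (stay _) = <⇒≤ (lower-next i)
          low (jump l) = <⇒≤ l
          high : ∀ {i e} → Move K (at s i) (x i) e → suc K * x i < suc (e + f i) * n
          high (stay l) = l
          high {i} (jump _) = upper-next i

        four : ∀ {P : Fin 4 → Set} → P 0F → P 1F → P 2F → P 3F → ∀ i → P i
        four a b c d 0F = a
        four a b c d 1F = b
        four a b c d 2F = c
        four a b c d 3F = d

        -- Two jumps leave residues of sum n, so the next multiple is ξ and the current one is 0;
        -- three or more leave residues of sum 0, so the next multiple is 0. Neither multiple can
        -- vanish.
        no-double-jump : ∀ {e₀ e₁ e₂ e₃} → Move K (at s 0F) (x 0F) e₀ → Move K (at s 1F) (x 1F) e₁ →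
                         Move K (at s 2F) (x 2F) e₂ → Move K (at s 3F) (x 3F) e₃ → 2 ≤ e₀ + e₁ + e₂ + e₃ → ⊥
        no-double-jump {e₀} {e₁} {e₂} {e₃} m₀ m₁ m₂ m₃ 2≤e = by-cases _ refl 2≤e
          where
          e = four {λ _ → ℕ} e₀ e₁ e₂ e₃
          S = sum4 (λ i → (suc K * x i) % n)
          balance : S + sum4 e * n ≡ 3 * n
          balance = remainders-move e (four m₀ m₁ m₂ m₃)
          by-cases : ∀ E → E ≡ sum4 e → 2 ≤ E → ⊥
          by-cases 0 _ ()
          by-cases 1 _ (s≤s ())
          by-cases 2 E _ = nonzero 0F (one K (+-cancelʳ-≡ (2 * n) S n (subst (λ t → S + t * n ≡ 3 * n) (sym E) balance)) 0F)
          by-cases (suc (suc (suc E′))) E _ = not-multiple 0F (m+n≡0⇒m≡0 _ (m+n≡0⇒m≡0 _ (m+n≡0⇒m≡0 _ S≡0)))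
            where
            S≡0 : S ≡ 0
            S≡0 = n≤0⇒n≡0 (+-cancelʳ-≤ (3 * n) S 0 (≤-trans (+-monoʳ-≤ S (*-monoˡ-≤ n (m≤m+n 3 E′)))
                    (≤-reflexive (subst (λ t → S + t * n ≡ 3 * n) (sym E) balance))))

      module _ (good : ℕ → (Fin 4 → ℕ) → Bool) where

        record Proportion : Set where
          constructor proportion
          field
            m : ℕ
            d : Fin 4 → ℕ
            is-good : True (good m d)
            ratio   : ∀ i → m * x i ≡ d i * n

        walk : ∀ fuel k s → Valid (suc k) x s → True (search good fuel (suc k) s) → Proportion
        walk (suc fuel) k s v h = step (move k s v 0F) (move k s v 1F) (move k s v 2F) (move k s v 3F)
          where
          K = suc k
          M : Fin 4 → ℕ → Set
          M i = Move K (at s i) (x i)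
          f : Fin 4 → ℕ
          f i = floor (at s i)
          leaf = all4 (λ i → inside (2 + K) (target s i) (at (keepAll K s) i)) ⇒ᵇ good (2 + K) (target s)
          branch : Fin 4 → Bool
          branch i = feasible (raiseAt K i s) ⇒ᵇ search good fuel (suc K) (raiseAt K i s)

          stop : (∀ i → M i 0) → Proportion
          stop m = proportion (2 + K) (target s)
                     (⇒ᵇ-elim {all4 inside?} (proj₁ (∧-elim {leaf} h)) (all4-intro inside? inside-ok)) ratio′
            where
            stays : ∀ i → suc K * x i < suc (f i) * n
            stays i with m i
            ... | stay l = l
            S≡3n : sum4 (λ i → (suc K * x i) % n) ≡ 3 * n
            S≡3n = trans (sym (+-identityʳ _)) (remainders-move k s v (λ _ → 0) m)
            ratio′ : ∀ i → (2 + K) * x i ≡ target s i * n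
            ratio′ i = between-multiples (f i) (three (suc K) S≡3n i)
              (<-≤-trans (lower-next k s v i) (m≤n+m (suc K * x i) (x i))) (+-mono-< (x<n i) (stays i))
            inside? : Fin 4 → Bool
            inside? i = inside (2 + K) (target s i) (at (keepAll K s) i)
            kept : ∀ i → Within (suc K) (x i) (keep K (at s i))
            kept i = keep-within (at s i) (cells v i) (stays i)
            inside-ok : ∀ i → True (inside? i)
            inside-ok 0F = inside-within _ _ _ (kept 0F) (ratio′ 0F) z<s
            inside-ok 1F = inside-within _ _ _ (kept 1F) (ratio′ 1F) z<s
            inside-ok 2F = inside-within _ _ _ (kept 2F) (ratio′ 2F) z<s
            inside-ok 3F = inside-within _ _ _ (kept 3F) (ratio′ 3F) z<s

          jumps : ∀ i → M i 1 → Within (suc K) (x i) (raise K (at s i))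
          jumps i (jump l) = raise-within (at s i) (cells v i) l (x<n i)
          stays : ∀ i → M i 0 → Within (suc K) (x i) (keep K (at s i))
          stays i (stay l) = keep-within (at s i) (cells v i) l

          descend : ∀ i → (∀ j → Within (suc K) (x j) (at (raiseAt K i s) j)) → Proportion
          descend i w = walk fuel K (raiseAt K i s) (valid w (trans (cong (2 +_) (floors-raiseAt K i s)) (cong suc (floors v))))
            (⇒ᵇ-elim {feasible (raiseAt K i s)} (all4-elim branch (proj₂ (∧-elim {leaf} h)) i)
              (feasible-valid (raiseAt K i s) w total))

          step : (∃ λ e → M 0F e) → (∃ λ e → M 1F e) → (∃ λ e → M 2F e) → (∃ λ e → M 3F e) → Proportion
          step (_ , a@(stay _)) (_ , b@(stay _)) (_ , c@(stay _)) (_ , d@(stay _)) = stop (four k s v a b c d)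
          step (_ , a@(jump _)) (_ , b@(stay _)) (_ , c@(stay _)) (_ , d@(stay _)) =
            descend 0F (four k s v (jumps 0F a) (stays 1F b) (stays 2F c) (stays 3F d))
          step (_ , a@(stay _)) (_ , b@(jump _)) (_ , c@(stay _)) (_ , d@(stay _)) =
            descend 1F (four k s v (stays 0F a) (jumps 1F b) (stays 2F c) (stays 3F d))
          step (_ , a@(stay _)) (_ , b@(stay _)) (_ , c@(jump _)) (_ , d@(stay _)) =
            descend 2F (four k s v (stays 0F a) (stays 1F b) (jumps 2F c) (stays 3F d))
          step (_ , a@(stay _)) (_ , b@(stay _)) (_ , c@(stay _)) (_ , d@(jump _)) =
            descend 3F (four k s v (stays 0F a) (stays 1F b) (stays 2F c) (jumps 3F d))
          step (_ , a@(jump _)) (_ , b@(jump _)) (_ , c) (_ , d) =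
            ⊥-elim (no-double-jump k s v a b c d (s≤s (s≤s z≤n)))
          step (_ , a@(jump _)) (_ , b@(stay _)) (_ , c@(jump _)) (_ , d) =
            ⊥-elim (no-double-jump k s v a b c d (s≤s (s≤s z≤n)))
          step (_ , a@(jump _)) (_ , b@(stay _)) (_ , c@(stay _)) (_ , d@(jump _)) =
            ⊥-elim (no-double-jump k s v a b c d (s≤s (s≤s z≤n)))
          step (_ , a@(stay _)) (_ , b@(jump _)) (_ , c@(jump _)) (_ , d) =
            ⊥-elim (no-double-jump k s v a b c d (s≤s (s≤s z≤n)))
          step (_ , a@(stay _)) (_ , b@(jump _)) (_ , c@(stay _)) (_ , d@(jump _)) =
            ⊥-elim (no-double-jump k s v a b c d (s≤s (s≤s z≤n)))
          step (_ , a@(stay _)) (_ , b@(stay _)) (_ , c@(jump _)) (_ , d@(jump _)) =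
            ⊥-elim (no-double-jump k s v a b c d (s≤s (s≤s z≤n)))

-- Levels of the multiples of c.

module ResidueClasses where

  open FloorSearch
  open import Defs using (sum4)
  open import Data.Bool using (true) renaming (T to True)
  open import Data.Empty using (⊥; ⊥-elim)
  open import Data.Fin using (Fin; suc)
  open import Data.Fin.Patterns using (0F; 1F; 2F; 3F)
  open import Data.Nat
  open import Data.Nat.Properties
  open import Data.Nat.DivMod
  open import Data.Nat.Divisibility
  open import Data.Nat.Tactic.RingSolver using (solve-∀)
  open import Data.Product using (_×_; _,_; proj₁; proj₂)
  open import Data.Unit using (tt)
  open import Relation.Binary.PropositionalEquality
  open import Relation.Nullary using (yes; no)

  term≤sum4 : ∀ (f : Fin 4 → ℕ) i → f i ≤ sum4 f
  term≤sum4 f 0F = ≤-trans (m≤m+n (f 0F) (f 1F)) (≤-trans (m≤m+n _ (f 2F)) (m≤m+n _ (f 3F)))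
  term≤sum4 f 1F = ≤-trans (m≤n+m (f 1F) (f 0F)) (≤-trans (m≤m+n _ (f 2F)) (m≤m+n _ (f 3F)))
  term≤sum4 f 2F = ≤-trans (m≤n+m (f 2F) _) (m≤m+n _ (f 3F))
  term≤sum4 f 3F = m≤n+m (f 3F) _

  sum4-zero : ∀ (f : Fin 4 → ℕ) → sum4 f ≡ 0 → ∀ i → f i ≡ 0
  sum4-zero f e i = n≤0⇒n≡0 (subst (f i ≤_) e (term≤sum4 f i))

  sum4-except : ∀ {b} (f : Fin 4 → ℕ) → (∀ i → f i ≤ b) → ∀ i → f i ≡ 0 → sum4 f ≤ 3 * b
  sum4-except {b} f l i z = +-cancelʳ-≤ b (sum4 f) (3 * b) (bound i z)
    where
    four-b : ∀ b → b + b + b + b ≡ 3 * b + b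
    four-b = solve-∀
    move₀ : ∀ x y z b → 0 + x + y + z + b ≡ b + x + y + z
    move₀ = solve-∀
    move₁ : ∀ x y z b → x + 0 + y + z + b ≡ x + b + y + z
    move₁ = solve-∀
    move₂ : ∀ x y z b → x + y + 0 + z + b ≡ x + y + b + z
    move₂ = solve-∀
    move₃ : ∀ x y z b → x + y + z + 0 + b ≡ x + y + z + b
    move₃ = solve-∀
    four≤ : ∀ {s w x y z} → s ≡ w + x + y + z → w ≤ b → x ≤ b → y ≤ b → z ≤ b → s ≤ 3 * b + b
    four≤ e p q r s = ≤-trans (≤-reflexive e) (≤-trans (+-mono-≤ (+-mono-≤ (+-mono-≤ p q) r) s) (≤-reflexive (four-b b)))
    bound : ∀ i → f i ≡ 0 → sum4 f + b ≤ 3 * b + b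
    bound 0F z rewrite z = four≤ (move₀ (f 1F) (f 2F) (f 3F) b) ≤-refl (l 1F) (l 2F) (l 3F)
    bound 1F z rewrite z = four≤ (move₁ (f 0F) (f 2F) (f 3F) b) (l 0F) ≤-refl (l 2F) (l 3F)
    bound 2F z rewrite z = four≤ (move₂ (f 0F) (f 1F) (f 3F) b) (l 0F) (l 1F) ≤-refl (l 3F)
    bound 3F z rewrite z = four≤ (move₃ (f 0F) (f 1F) (f 2F) b) (l 0F) (l 1F) (l 2F) ≤-refl

  ≡-true⇒ : ∀ {b} → b ≡ true → True b
  ≡-true⇒ refl = tt

  -- The state at k = 2, where all floors are 0 by `double<n`. The walk cannot start at k = 1, since
  -- the sum of the floors equals k - 2 only from k = 2 on.
  start : State
  start = ⟪ half , half , half , half ⟫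
    where half = cell 0 0 1 1 2

  module Congruence (n : ℕ) .{{_ : NonZero n}} where

    infix 4 _≋_
    _≋_ : ℕ → ℕ → Set
    a ≋ b = a % n ≡ b % n

    +-cong-≋ : ∀ {a b c d} → a ≋ b → c ≋ d → a + c ≋ b + d
    +-cong-≋ {a} {b} {c} {d} p q = begin
      (a + c) % n          ≡⟨ %-distribˡ-+ a c n ⟩
      (a % n + c % n) % n  ≡⟨ cong₂ (λ x y → (x + y) % n) p q ⟩
      (b % n + d % n) % n  ≡⟨ %-distribˡ-+ b d n ⟨
      (b + d) % n          ∎
      where open ≡-Reasoning

    *-congˡ-≋ : ∀ k {a b} → a ≋ b → k * a ≋ k * b
    *-congˡ-≋ k {a} {b} p = begin
      (k * a) % n              ≡⟨ %-distribˡ-* k a n ⟩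
      ((k % n) * (a % n)) % n  ≡⟨ cong (λ y → ((k % n) * y) % n) p ⟩
      ((k % n) * (b % n)) % n  ≡⟨ %-distribˡ-* k b n ⟨
      (k * b) % n              ∎
      where open ≡-Reasoning

    mod-≋ : ∀ a → a % n ≋ a
    mod-≋ a = m%n%n≡m%n a n

    ≡⇒≋ : ∀ {a b} → a ≡ b → a ≋ b
    ≡⇒≋ = cong (_% n)

    -- Adding (n - 1) e takes the place of subtracting e.
    +-cancelʳ-≋ : ∀ e {a b} → a + e ≋ b + e → a ≋ b
    +-cancelʳ-≋ e {a} {b} p = begin
      a % n                     ≡⟨ absorb a ⟨
      (a + e + pred n * e) % n  ≡⟨ +-cong-≋ {a + e} {b + e} {pred n * e} p refl ⟩
      (b + e + pred n * e) % n  ≡⟨ absorb b ⟩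
      b % n                     ∎
      where
      open ≡-Reasoning
      absorb : ∀ a → (a + e + pred n * e) % n ≡ a % n
      absorb a = trans (≡⇒≋ (trans (+-assoc a e _) (cong (a +_) (trans (cong (_* e) (suc-pred n)) (*-comm n e)))))
                   ([m+kn]%n≡m%n a e n)

    ≋⇒≡ : ∀ {a b} → a < n → b < n → a ≋ b → a ≡ b
    ≋⇒≡ a<n b<n p = trans (sym (m<n⇒m%n≡m a<n)) (trans p (m<n⇒m%n≡m b<n))

    ∣⇒≋0 : ∀ {a} → n ∣ a → a % n ≡ 0
    ∣⇒≋0 {a} d = n∣m⇒m%n≡0 a n d

    ≋0⇒∣ : ∀ {a} → a % n ≡ 0 → n ∣ a
    ≋0⇒∣ {a} e = m%n≡0⇒n∣m a n e

    ∣-sum-% : ∀ (f : Fin 4 → ℕ) → n ∣ sum4 f → n ∣ sum4 (λ i → f i % n)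
    ∣-sum-% f d = ∣m+n∣m⇒∣n (subst (n ∣_) split d) (divides (sum4 (λ i → f i / n)) (sum4-*ʳ n (λ i → f i / n)))
      where
      split : sum4 f ≡ sum4 (λ i → f i / n * n) + sum4 (λ i → f i % n)
      split = trans (sum4-cong (λ i → trans (m≡m%n+[m/n]*n (f i) n) (+-comm (f i % n) _)))
                (sum4-+ (λ i → f i / n * n) (λ i → f i % n))

    zero-or-n : ∀ {a b} → a < n → b < n → n ∣ a + b → 0 < a → a + b ≡ n
    zero-or-n {a} {b} a<n b<n (divides 0 e) 0<a = ⊥-elim (<-irrefl (sym (m+n≡0⇒m≡0 a e)) 0<a)
    zero-or-n a<n b<n (divides 1 e) 0<a = trans e (+-identityʳ n)
    zero-or-n {a} {b} a<n b<n (divides (suc (suc q)) e) 0<a = ⊥-elim (<-irrefl e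
      (<-≤-trans (+-mono-< a<n b<n) (≤-trans (≤-reflexive (cong (n +_) (sym (+-identityʳ n)))) (*-monoˡ-≤ n (m≤m+n 2 q)))))

  module Residues (n : ℕ) .{{_ : NonZero n}} (c : Fin 4 → ℕ) (n∣c : n ∣ sum4 c) (c₃≡1 : c 3F ≡ 1) where
    open Congruence n public

    res : ℕ → Fin 4 → ℕ
    res k i = (k * c i) % n

    S : ℕ → ℕ
    S k = sum4 (res k)

    n∣S : ∀ k → n ∣ S k
    n∣S k = ∣-sum-% (λ i → k * c i) (subst (n ∣_) (sym (sum4-*ˡ k c)) (∣n⇒∣m*n k n∣c))

    res<n : ∀ k i → res k i < n
    res<n k i = m%n<n (k * c i) n

    -- Since the last weight is 1, the last residue recovers the index modulo n.
    res-last : ∀ k → res k 3F ≡ k % n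
    res-last k = cong (_% n) (trans (cong (k *_) c₃≡1) (*-identityʳ k))

    S-bound : ∀ k → S k < 4 * n
    S-bound k = <-≤-trans (sum4-mono-< (res<n k)) (≤-reflexive (lemma n))
      where
      lemma : ∀ n → n + n + n + n ≡ 4 * n
      lemma = solve-∀

    -- S k is a multiple of n below 4n, so every argument about it is a case distinction on four
    -- quotients.
    data Level (k : ℕ) : Set where
      level : ∀ q → q < 4 → S k ≡ q * n → Level k

    level? : ∀ k → Level k
    level? k with n∣S k
    ... | divides q e = level q (*-cancelʳ-< n q 4 (subst (_< 4 * n) e (S-bound k))) e

    res-zero : ∀ k → k % n ≡ 0 → ∀ i → res k i ≡ 0
    res-zero k e i = ∣⇒≋0 (∣m⇒∣m*n (c i) (≋0⇒∣ e))

    S-zero : ∀ k → S k ≡ 0 → k % n ≡ 0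
    S-zero k e = trans (sym (res-last k)) (sum4-zero (res k) e 3F)

    -- A natural number congruent to - k modulo n.
    opposite : ℕ → ℕ
    opposite k = pred n * k

    opposite-∣ : ∀ k i → n ∣ res k i + res (opposite k) i
    opposite-∣ k i = ≋0⇒∣ (trans (+-cong-≋ {res k i} {k * c i} {res (opposite k) i} (mod-≋ _) (mod-≋ _))
        (∣⇒≋0 (divides (k * c i) (begin
          k * c i + pred n * k * c i     ≡⟨ cong (k * c i +_) (*-assoc (pred n) k (c i)) ⟩
          suc (pred n) * (k * c i)       ≡⟨ cong (_* (k * c i)) (suc-pred n) ⟩
          n * (k * c i)                  ≡⟨ *-comm n (k * c i) ⟩
          k * c i * n                    ∎))))
      where open ≡-Reasoning

    opposite-sum : ∀ k i → 0 < res k i → res k i + res (opposite k) i ≡ n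
    opposite-sum k i = zero-or-n (res<n k i) (res<n (opposite k) i) (opposite-∣ k i)

    opposite-zero : ∀ k i → res k i ≡ 0 → res (opposite k) i ≡ 0
    opposite-zero k i e = trans (sym (m<n⇒m%n≡m (res<n (opposite k) i)))
      (∣⇒≋0 (subst (λ t → n ∣ t + res (opposite k) i) e (opposite-∣ k i)))

    opposite-≤ : ∀ k i → res k i + res (opposite k) i ≤ n
    opposite-≤ k i with res k i ≟ 0
    ... | yes e = subst (_≤ n) (sym (cong₂ _+_ e (opposite-zero k i e))) z≤n
    ... | no ne = ≤-reflexive (opposite-sum k i (n≢0⇒n>0 ne))

    opposite-≢0 : ∀ k → k % n ≢ 0 → opposite k % n ≢ 0
    opposite-≢0 k ne e = <-irrefl eq (res<n k 3F)
      where
      eq : res k 3F ≡ n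
      eq = trans (sym (+-identityʳ _)) (trans (cong (res k 3F +_) (sym (trans (res-last (opposite k)) e)))
             (opposite-sum k 3F (subst (0 <_) (sym (res-last k)) (n≢0⇒n>0 ne))))

    module UniqueInterior (z : ℕ) (z<n : z < n) (Sz : S z ≡ n)
      (unique : ∀ k → S k ≡ n → (∀ i → 0 < res k i) × k % n ≡ z) where

      -- A zero coordinate of k c is also zero in the opposite point, so the two values of S add up
      -- to at most 3n. As neither is 0, one of them is n, and `unique` forbids a zero coordinate
      -- there.
      res-positive : ∀ k → k % n ≢ 0 → ∀ i → 0 < res k i
      res-positive k ne i with level? k
      ... | level 0 _ e = ⊥-elim (ne (S-zero k e))
      ... | level 1 _ e = proj₁ (unique k (trans e (+-identityʳ n))) i
      ... | level (suc (suc q)) _ e = n≢0⇒n>0 λ r≡0 → opposite-bad r≡0 (level? (opposite k))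
        where
        sum≤ : res k i ≡ 0 → S k + S (opposite k) ≤ 3 * n
        sum≤ r≡0 = subst (_≤ 3 * n) (sum4-+ (res k) (res (opposite k)))
          (sum4-except (λ j → res k j + res (opposite k) j) (opposite-≤ k) i (cong₂ _+_ r≡0 (opposite-zero k i r≡0)))
        opp≤ : res k i ≡ 0 → S (opposite k) ≤ n
        opp≤ r≡0 = +-cancelˡ-≤ (2 * n) _ _ (≤-trans (+-monoˡ-≤ (S (opposite k)) (≤-trans (*-monoˡ-≤ n (m≤m+n 2 q)) (≤-reflexive (sym e))))
          (≤-trans (sum≤ r≡0) (≤-reflexive (+-comm n (2 * n)))))
        opposite-bad : res k i ≡ 0 → Level (opposite k) → ⊥
        opposite-bad r≡0 (level 0 _ e′) = opposite-≢0 k ne (S-zero (opposite k) e′)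
        opposite-bad r≡0 (level 1 _ e′) =
          <-irrefl (sym (opposite-zero k i r≡0)) (proj₁ (unique (opposite k) (trans e′ (+-identityʳ n))) i)
        opposite-bad r≡0 (level (suc (suc q′)) _ e′) = <-irrefl refl (begin-strict
            n                 <⟨ m<m+n n (>-nonZero⁻¹ n) ⟩
            n + n             ≡⟨ cong (n +_) (sym (+-identityʳ n)) ⟩
            2 * n             ≤⟨ *-monoˡ-≤ n (m≤m+n 2 q′) ⟩
            (2 + q′) * n      ≡⟨ e′ ⟨
            S (opposite k)    ≤⟨ opp≤ r≡0 ⟩
            n                 ∎)
          where open ≤-Reasoning

      -- All coordinates are nonzero, so opposite residues add up to n in each of the four places.
      -- Level 3n at k thus means level n at the opposite index, which must be z.
      S-three : ∀ k → S k ≡ 3 * n → k % n + z ≡ n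
      S-three k e = begin
        k % n + z               ≡⟨ cong₂ _+_ (sym (res-last k)) (sym (trans (res-last (opposite k)) (proj₂ (unique (opposite k) S-opposite)))) ⟩
        res k 3F + res (opposite k) 3F ≡⟨ pair 3F ⟩
        n ∎
        where
        open ≡-Reasoning
        k≢0 : k % n ≢ 0
        k≢0 z′ = <-irrefl (sym (trans (sym e) (trans (sum4-cong (res-zero k z′)) refl))) (*-monoʳ-< 3 (>-nonZero⁻¹ n))
        pair : ∀ i → res k i + res (opposite k) i ≡ n
        pair i = opposite-sum k i (res-positive k k≢0 i)
        S-opposite : S (opposite k) ≡ n
        S-opposite = +-cancelˡ-≡ (3 * n) _ _ (begin
          3 * n + S (opposite k)     ≡⟨ cong (_+ S (opposite k)) e ⟨
          S k + S (opposite k)       ≡⟨ sum4-+ (res k) (res (opposite k)) ⟨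
          sum4 (λ i → res k i + res (opposite k) i) ≡⟨ sum4-cong pair ⟩
          n + n + n + n              ≡⟨ lemma n ⟩
          3 * n + n ∎)
          where
          lemma : ∀ n → n + n + n + n ≡ 3 * n + n
          lemma = solve-∀

      S-two : ∀ k → k % n ≢ 0 → k % n ≢ z → k % n + z ≢ n → S k ≡ 2 * n
      S-two k ≢0 ≢z ≢-z with level? k
      ... | level 0 _ e = ⊥-elim (≢0 (S-zero k e))
      ... | level 1 _ e = ⊥-elim (≢z (proj₂ (unique k (trans e (+-identityʳ n)))))
      ... | level 2 _ e = e
      ... | level 3 _ e = ⊥-elim (≢-z (S-three k e))
      ... | level (suc (suc (suc (suc _)))) (s≤s (s≤s (s≤s (s≤s ())))) _

      ξ : Fin 4 → ℕ
      ξ = res z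

      ξ>0 : ∀ i → 0 < ξ i
      ξ>0 = proj₁ (unique z Sz)

      z≢0 : z % n ≢ 0
      z≢0 e = <-irrefl (sym (trans (res-last z) e)) (ξ>0 3F)

      mult : ∀ k i → (k * ξ i) % n ≡ res (k * z) i
      mult k i = trans (*-congˡ-≋ k {ξ i} {z * c i} (mod-≋ _)) (≡⇒≋ (sym (*-assoc k z (c i))))

      S-mult : ∀ k → sum4 (λ i → (k * ξ i) % n) ≡ S (k * z)
      S-mult k = sum4-cong (mult k)

      vanish : ∀ k → (k * z) % n ≡ 0 → ∀ i → (k * ξ i) % n ≡ 0
      vanish k e i = trans (mult k i) (res-zero (k * z) e i)

      vanish⁻¹ : ∀ k i → (k * ξ i) % n ≡ 0 → (k * z) % n ≡ 0
      vanish⁻¹ k i e with (k * z) % n ≟ 0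
      ... | yes e′ = e′
      ... | no ne = ⊥-elim (<-irrefl (sym (trans (sym (mult k i)) e)) (res-positive (k * z) ne i))

      all-zero : ∀ k i → (k * ξ i) % n ≡ 0 → ∀ j → (k * ξ j) % n ≡ 0
      all-zero k i e = vanish k (vanish⁻¹ k i e)

      one : ∀ k → sum4 (λ i → (suc k * ξ i) % n) ≡ n → ∀ i → (k * ξ i) % n ≡ 0
      one k e = vanish k (trans (+-cancelʳ-≋ z {k * z} {0}
        (trans (≡⇒≋ (+-comm (k * z) z)) (trans (proj₂ (unique (suc k * z) (trans (sym (S-mult (suc k))) e)))
          (sym (m<n⇒m%n≡m z<n))))) (m<n⇒m%n≡m (>-nonZero⁻¹ n)))

      three : ∀ k → sum4 (λ i → (k * ξ i) % n) ≡ 3 * n → ∀ i → (suc k * ξ i) % n ≡ 0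
      three k e = vanish (suc k) (trans (≡⇒≋ (+-comm z (k * z)))
        (trans (+-cong-≋ {k * z} {(k * z) % n} {z} (sym (mod-≋ _)) refl)
          (trans (≡⇒≋ (S-three (k * z) (trans (sym (S-mult k)) e))) (n%n≡0 n))))

      double-sum : sum4 (λ i → 2 * ξ i) ≡ 2 * n
      double-sum = trans (sum4-*ˡ 2 ξ) (cong (2 *_) Sz)

      double-≢0 : ∀ i → (2 * ξ i) % n ≢ 0
      double-≢0 i e = m≢1+m+n 2 {1} (*-cancelʳ-≡ 2 4 n (trans (sym double-sum) (trans (sum4-cong half) (lemma n))))
        where
        half : ∀ j → 2 * ξ j ≡ 1 * n
        half j = between-multiples n 0 (all-zero 2 i e j) (*-monoʳ-< 2 (ξ>0 j)) (*-monoʳ-< 2 (res<n z j))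
        lemma : ∀ n → 1 * n + 1 * n + 1 * n + 1 * n ≡ 4 * n
        lemma = solve-∀

      -- The residues and floors of the 2 ξᵢ share the total 2n. If the floors took one n, the
      -- residues would have sum n and 2 ξ would be ξ. If they took two, 2 ξ would vanish, forcing
      -- each 2 ξᵢ to be n and the total to be 4n.
      double<n : ∀ i → 2 * ξ i < n
      double<n i = subst (_< n) (sym (trans (m≡m%n+[m/n]*n (2 * ξ i) n) (trans (cong (λ q → (2 * ξ i) % n + q * n) (quotients i)) (+-identityʳ _)))) (m%n<n _ n)
        where
        open ≡-Reasoning
        R = sum4 (λ i → (2 * ξ i) % n)
        Q = sum4 (λ i → 2 * ξ i / n)
        balance : R + Q * n ≡ 2 * n
        balance = begin
          R + Q * n                                        ≡⟨ cong (R +_) (sum4-*ʳ n (λ i → 2 * ξ i / n)) ⟨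
          R + sum4 (λ i → 2 * ξ i / n * n)                 ≡⟨ sum4-+ (λ i → (2 * ξ i) % n) (λ i → 2 * ξ i / n * n) ⟨
          sum4 (λ i → (2 * ξ i) % n + 2 * ξ i / n * n)     ≡⟨ sum4-cong (λ i → sym (m≡m%n+[m/n]*n (2 * ξ i) n)) ⟩
          sum4 (λ i → 2 * ξ i)                             ≡⟨ double-sum ⟩
          2 * n ∎
        case : ∀ q → Q ≡ q → Q ≡ 0
        case 0 e = e
        case 1 e = ⊥-elim (z≢0 (trans (≡⇒≋ (sym (+-identityʳ z))) (vanish⁻¹ 1 0F (one 1 (+-cancelʳ-≡ n R n
          (trans (cong (R +_) (sym (trans (cong (_* n) e) (+-identityʳ n)))) (trans balance (cong (n +_) (+-identityʳ n)))))  0F))))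
        case (suc (suc q)) e = ⊥-elim (double-≢0 0F (sum4-zero (λ i → (2 * ξ i) % n) R≡0 0F))
          where
          R≡0 : R ≡ 0
          R≡0 = n≤0⇒n≡0 (+-cancelʳ-≤ (2 * n) R 0 (≤-trans (+-monoʳ-≤ R (*-monoˡ-≤ n (subst (2 ≤_) (sym e) (m≤m+n 2 q)))) (≤-reflexive balance)))
        quotients : ∀ i → 2 * ξ i / n ≡ 0
        quotients = sum4-zero (λ i → 2 * ξ i / n) (case Q refl)

      start-valid : Valid n 2 ξ start
      start-valid = valid cells refl
        where
        half-within : ∀ i → Within n 2 (ξ i) (cell 0 0 1 1 2)
        half-within i = within (*-monoʳ-< 2 (ξ>0 i)) (1* (double<n i)) (subst (0 <_) (sym (*-identityˡ (ξ i))) (ξ>0 i)) (1* (double<n i)) z<s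
          where
          1* : ∀ {a} → a < n → a < 1 * n
          1* = subst (_ <_) (sym (*-identityˡ n))
        cells : ∀ i → Within n 2 (ξ i) (at start i)
        cells 0F = half-within 0F
        cells 1F = half-within 1F
        cells 2F = half-within 2F
        cells 3F = half-within 3F

      open Walk n ξ Sz ξ>0 (res<n z) all-zero one three public using (Proportion; proportion; walk)

      ratios : ∀ good fuel → search good fuel 2 start ≡ true → Proportion good
      ratios good fuel found = walk good fuel 1 start start-valid (≡-true⇒ found)

-- Cosets of ⟨ξ⟩ and their digits in base g.

module Digits where

  open FloorSearch
  open ResidueClasses
  open import Defs using (sum4)
  open import Data.Bool using (Bool) renaming (T to True)
  open import Data.Bool.Properties using (T?)
  open import Data.Empty using (⊥)
  open import Data.Fin using (Fin; suc; toℕ)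
  import Data.Fin.Properties as Fin
  open import Data.Fin.Patterns using (0F; 1F; 2F; 3F)
  open import Data.Bool.ListAction using (all)
  open import Data.List using (List; downFrom; filterᵇ; cartesianProduct; length; lookup)
  open import Data.List.Membership.Propositional using (_∈_)
  open import Data.List.Membership.Propositional.Properties using (∈-filter⁺; ∈-cartesianProduct⁺; ∈-downFrom⁺)
  open import Data.List.Relation.Unary.Any using (index)
  open import Data.List.Relation.Unary.Any.Properties using (lookup-index)
  open import Data.List.Relation.Unary.All using (universal)
  open import Data.List.Relation.Unary.All.Properties using (all⁻)
  open import Data.Nat
  open import Data.Nat.Properties
  open import Data.Nat.DivMod
  open import Data.Nat.Divisibility
  open import Data.Nat.Tactic.RingSolver using (solve-∀)
  open import Data.Product using (∃-syntax; _×_; _,_; proj₂)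
  open import Function using (_∘_)
  open import Relation.Binary.PropositionalEquality
  open import Relation.Nullary using (¬_)

  ∣m+n∣n⇒∣m : ∀ {d m n} → d ∣ m + n → d ∣ n → d ∣ m
  ∣m+n∣n⇒∣m {d} {m} {n} p = ∣m+n∣m⇒∣n (subst (d ∣_) (+-comm m n) p)

  Key : Set
  Key = ℕ × ℕ × ℕ

  -- A key (a , b , t) stands for the digits a, b, 2m - 1 - t - a - b, 0.
  digits : ℕ → Key → Fin 4 → ℕ
  digits m (a , b , t) 0F = a
  digits m (a , b , t) 1F = b
  digits m (a , b , t) 2F = 2 * m ∸ (a + b + suc t)
  digits m (a , b , t) 3F = 0

  module _ (m : ℕ) .{{_ : NonZero m}} (d : Fin 4 → ℕ) where

    -- All points of a coset have S = 2n, so the digit sum does not depend on the point.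
    steady : Key → Bool
    steady key@(_ , _ , t) =
      all (λ j → sum4 (λ i → (digits m key i + j * d i) % m) ≡ᵇ 2 * m ∸ suc t) (downFrom m)

    candidates : List Key
    -- Three values of t suffice by `defect<3`.
    candidates = filterᵇ steady (cartesianProduct (downFrom m) (cartesianProduct (downFrom m) (downFrom 3)))

  module Subgroup (n : ℕ) .{{_ : NonZero n}} (c : Fin 4 → ℕ) (n∣c : n ∣ sum4 c) (c₃≡1 : c 3F ≡ 1)
    (z : ℕ) (z<n : z < n) (Sz : sum4 (λ i → (z * c i) % n) ≡ n)
    (unique : ∀ k → sum4 (λ i → (k * c i) % n) ≡ n → (∀ i → 0 < (k * c i) % n) × k % n ≡ z)
    (m g : ℕ) .{{_ : NonZero m}} .{{_ : NonZero g}} (n≡mg : n ≡ m * g)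
    (d : Fin 4 → ℕ) (ξ≡dg : ∀ i → (z * c i) % n ≡ d i * g)
    where
    open Residues n c n∣c c₃≡1
    open UniqueInterior z z<n Sz unique

    g∣n : g ∣ n
    g∣n = divides m n≡mg

    -- The upper and lower digit of a residue in base g. Adding ξ = d g leaves ρ alone and adds d to
    -- ζ modulo m.
    ζ ρ : ℕ → Fin 4 → ℕ
    ζ r i = res r i / g
    ρ r i = res r i % g

    res-split : ∀ r i → res r i ≡ ρ r i + ζ r i * g
    res-split r i = m≡m%n+[m/n]*n (res r i) g

    -- As n = m g, reduction modulo n acts on the upper digit alone, as reduction modulo m.
    %-mg : ∀ p a → p < g → (p + a * g) % n ≡ p + (a % m) * g
    %-mg p a p<g = trans (≡⇒≋ expand) (trans ([m+kn]%n≡m%n (p + a % m * g) (a / m) n) (m<n⇒m%n≡m small))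
      where
      expand : p + a * g ≡ p + a % m * g + a / m * n
      expand = begin
        p + a * g                        ≡⟨ cong (λ y → p + y * g) (m≡m%n+[m/n]*n a m) ⟩
        p + (a % m + a / m * m) * g      ≡⟨ lemma p (a % m) (a / m) m g ⟩
        p + a % m * g + a / m * (m * g)  ≡⟨ cong (λ y → p + a % m * g + a / m * y) n≡mg ⟨
        p + a % m * g + a / m * n ∎
        where
        open ≡-Reasoning
        lemma : ∀ p s q m g → p + (s + q * m) * g ≡ p + s * g + q * (m * g)
        lemma = solve-∀
      small : p + a % m * g < n
      small = begin-strict
        p + a % m * g     <⟨ +-monoˡ-< (a % m * g) p<g ⟩
        suc (a % m) * g   ≤⟨ *-monoˡ-≤ g (m%n<n a m) ⟩
        m * g             ≡⟨ n≡mg ⟨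
        n ∎
        where open ≤-Reasoning

    z≡x₃ : z ≡ ξ 3F
    z≡x₃ = sym (trans (res-last z) (m<n⇒m%n≡m z<n))

    g∣z : g ∣ z
    g∣z = divides (d 3F) (trans z≡x₃ (ξ≡dg 3F))

    g∣-% : ∀ k → g ∣ k % n → g ∣ k
    g∣-% k = ∣n∣m%n⇒∣m g∣n

    module Position (r : ℕ) (0<r : 0 < r) (r<g : r < g) where

      g∤r : ¬ g ∣ r
      g∤r g∣r = <-irrefl refl (<-≤-trans r<g (∣⇒≤ {{>-nonZero 0<r}} g∣r))

      r<n : r < n
      r<n = <-≤-trans r<g (∣⇒≤ g∣n)

      res-r₃ : res r 3F ≡ r
      res-r₃ = trans (res-last r) (m<n⇒m%n≡m r<n)

      ζ₃≡0 : ζ r 3F ≡ 0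
      ζ₃≡0 = trans (cong (_/ g) res-r₃) (m<n⇒m/n≡0 r<g)

      -- The exceptional indices 0, z and - z are divisible by g, because g divides n and z; r + j z
      -- is not, because 0 < r < g.
      S-coset : ∀ j → S (r + j * z) ≡ 2 * n
      S-coset j = S-two (r + j * z)
          (λ e → g∤k (g∣-% _ (subst (g ∣_) (sym e) (g ∣0))))
          (λ e → g∤k (g∣-% _ (subst (g ∣_) (sym e) g∣z)))
          (λ e → g∤k (g∣-% _ (∣m+n∣n⇒∣m (subst (g ∣_) (sym e) g∣n) g∣z)))
        where
        g∤k : ¬ g ∣ r + j * z
        g∤k g∣k = g∤r (∣m+n∣n⇒∣m g∣k (∣n⇒∣m*n j g∣z))

      res-coset : ∀ j i → res (r + j * z) i ≡ ρ r i + ((ζ r i + j * d i) % m) * g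
      res-coset j i = begin
        ((r + j * z) * c i) % n             ≡⟨ ≡⇒≋ (trans (*-distribʳ-+ (c i) r (j * z)) (cong (r * c i +_) (*-assoc j z (c i)))) ⟩
        (r * c i + j * (z * c i)) % n       ≡⟨ +-cong-≋ {res r i} {r * c i} (mod-≋ _) (*-congˡ-≋ j (mod-≋ _)) ⟨
        (res r i + j * ξ i) % n             ≡⟨ ≡⇒≋ (cong₂ _+_ (res-split r i) (cong (j *_) (ξ≡dg i))) ⟩
        (ρ r i + ζ r i * g + j * (d i * g)) % n ≡⟨ ≡⇒≋ (lemma (ρ r i) (ζ r i) j (d i) g) ⟩
        (ρ r i + (ζ r i + j * d i) * g) % n ≡⟨ %-mg (ρ r i) (ζ r i + j * d i) (m%n<n (res r i) g) ⟩
        ρ r i + ((ζ r i + j * d i) % m) * g ∎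
        where
        open ≡-Reasoning
        lemma : ∀ p q j d g → p + q * g + j * (d * g) ≡ p + (q + j * d) * g
        lemma = solve-∀

      total : ℕ → ℕ
      total j = sum4 (λ i → (ζ r i + j * d i) % m)

      P : ℕ
      P = sum4 (ρ r)

      balance : ∀ j → P + total j * g ≡ 2 * n
      balance j = begin
        P + total j * g                                         ≡⟨ cong (P +_) (sum4-*ʳ g (λ i → (ζ r i + j * d i) % m)) ⟨
        P + sum4 (λ i → (ζ r i + j * d i) % m * g)              ≡⟨ sum4-+ (ρ r) (λ i → (ζ r i + j * d i) % m * g) ⟨
        sum4 (λ i → ρ r i + (ζ r i + j * d i) % m * g)          ≡⟨ sum4-cong (res-coset j) ⟨
        S (r + j * z)                                           ≡⟨ S-coset j ⟩
        2 * n ∎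
        where open ≡-Reasoning

      ζ<m : ∀ i → ζ r i < m
      ζ<m i = m<n*o⇒m/o<n (subst (res r i <_) n≡mg (res<n r i))

      total₀ : total 0 ≡ sum4 (ζ r)
      total₀ = sum4-cong (λ i → trans (cong (_% m) (+-identityʳ (ζ r i))) (m<n⇒m%n≡m (ζ<m i)))

      -- Along the coset both the lower digits and the value 2n of S stay the same, so the sum of
      -- the upper digits does too.
      total-const : ∀ j → total j ≡ sum4 (ζ r)
      total-const j = trans (*-cancelʳ-≡ (total j) (total 0) g (+-cancelˡ-≡ P _ _ (trans (balance j) (sym (balance 0))))) total₀

      balance₀ : P + sum4 (ζ r) * g ≡ 2 * m * g
      balance₀ = trans (cong (λ t → P + t * g) (sym total₀)) (trans (balance 0) (trans (cong (2 *_) n≡mg) (sym (*-assoc 2 m g))))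

      P>0 : 0 < P
      P>0 = <-≤-trans (subst (0 <_) (sym (trans (cong (_% g) res-r₃) (m<n⇒m%n≡m r<g))) 0<r) (term≤sum4 (ρ r) 3F)

      P<4g : P < 4 * g
      P<4g = <-≤-trans (sum4-mono-< (λ i → m%n<n (res r i) g)) (≤-reflexive (lemma g))
        where
        lemma : ∀ g → g + g + g + g ≡ 4 * g
        lemma = solve-∀

      Σζ<2m : sum4 (ζ r) < 2 * m
      Σζ<2m = *-cancelʳ-< g _ _ (subst (sum4 (ζ r) * g <_) balance₀ (m<n+m _ P>0))

      2m<Σζ+4 : 2 * m < sum4 (ζ r) + 4
      2m<Σζ+4 = *-cancelʳ-< g _ _ (begin-strict
        2 * m * g                      ≡⟨ balance₀ ⟨
        P + sum4 (ζ r) * g             <⟨ +-monoˡ-< (sum4 (ζ r) * g) P<4g ⟩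
        4 * g + sum4 (ζ r) * g         ≡⟨ trans (sym (*-distribʳ-+ g 4 (sum4 (ζ r)))) (cong (_* g) (+-comm 4 (sum4 (ζ r)))) ⟩
        (sum4 (ζ r) + 4) * g ∎)
        where open ≤-Reasoning

      -- By `balance₀` the lower digits add up to (defect + 1) g. Four digits below g, the last of
      -- them positive, have a sum strictly between 0 and 4g, which leaves 0, 1 and 2.
      defect : ℕ
      defect = 2 * m ∸ suc (sum4 (ζ r))

      defect-sum : sum4 (ζ r) + suc defect ≡ 2 * m
      defect-sum = trans (+-suc (sum4 (ζ r)) defect) (m+[n∸m]≡n Σζ<2m)

      defect<3 : defect < 3
      defect<3 = ≤-pred (+-cancelˡ-< (sum4 (ζ r)) _ _ (subst (_< sum4 (ζ r) + 4) (sym defect-sum) 2m<Σζ+4))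

      -- Two digits are enough: the last one is 0 because r < g, and the third follows from the
      -- digit sum, which the defect records.
      key : Key
      key = ζ r 0F , ζ r 1F , defect

      digits-key : ∀ i → digits m key i ≡ ζ r i
      digits-key 0F = refl
      digits-key 1F = refl
      digits-key 2F = trans (cong (_∸ (a + b + suc defect)) (sym (trans (lemma a b (ζ r 2F) (suc defect))
          (trans (cong (λ t → a + b + ζ r 2F + t + suc defect) (sym ζ₃≡0)) defect-sum)))) (m+n∸n≡m (ζ r 2F) (a + b + suc defect))
        where
        a = ζ r 0F
        b = ζ r 1F
        lemma : ∀ a b c e → c + (a + b + e) ≡ a + b + c + 0 + e
        lemma = solve-∀
      digits-key 3F = sym ζ₃≡0

      key-steady : True (steady m d key)
      key-steady = all⁻ _ (universal (λ j → ≡⇒≡ᵇ _ _ (begin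
        sum4 (λ i → (digits m key i + j * d i) % m)   ≡⟨ sum4-cong (λ i → cong (λ t → (t + j * d i) % m) (digits-key i)) ⟩
        total j                                       ≡⟨ total-const j ⟩
        sum4 (ζ r)                                    ≡⟨ m+n∸n≡m (sum4 (ζ r)) (suc defect) ⟨
        sum4 (ζ r) + suc defect ∸ suc defect          ≡⟨ cong (_∸ suc defect) defect-sum ⟩
        2 * m ∸ suc defect                            ∎)) (downFrom m))
        where open ≡-Reasoning

      key∈ : key ∈ candidates m d
      key∈ = ∈-filter⁺ (T? ∘ steady m d)
        (∈-cartesianProduct⁺ (∈-downFrom⁺ (ζ<m 0F)) (∈-cartesianProduct⁺ (∈-downFrom⁺ (ζ<m 1F)) (∈-downFrom⁺ defect<3)))
        key-steady

    -- If r and r′ have the same digits, then (r′ - r) c is so close to 0 that adding ξ = z c gives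
    -- a second lattice point in the interior.
    distinct : ∀ {r r′} (0<r : 0 < r) (r<g : r < g) (0<r′ : 0 < r′) (r′<g : r′ < g) → r < r′ →
               Position.key r 0<r r<g ≢ Position.key r′ 0<r′ r′<g
    distinct {r} {r′} 0<r r<g 0<r′ r′<g r<r′ same = <-irrefl (sym t%n≡0) t%n>0
      where
      module A = Position r 0<r r<g
      module B = Position r′ 0<r′ r′<g
      t : ℕ
      t = r′ ∸ r
      t+r : t + r ≡ r′
      t+r = m∸n+n≡m (<⇒≤ r<r′)
      k : ℕ
      k = t + z
      same-ζ : ∀ i → ζ r i ≡ ζ r′ i
      same-ζ i = trans (sym (A.digits-key i)) (trans (cong (λ q → digits m q i) same) (B.digits-key i))
      same-P : A.P ≡ B.P
      same-P = +-cancelʳ-≡ (sum4 (ζ r) * g) _ _ (trans A.balance₀ (sym (trans (cong (λ q → B.P + q * g) (sum4-cong same-ζ)) B.balance₀)))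
      -- Equal upper digits leave ρ r′ i - ρ r i as the coordinate of (r′ - r) c. Its absolute value
      -- is below g, and ξ i = d i * g with 0 < d i < m, so adding ξ i yields a number in [0, n),
      -- which is the residue itself and not merely congruent to it.
      shift : ∀ i → res k i + ρ r i ≡ ξ i + ρ r′ i
      shift i = begin
        res k i + ρ r i                  ≡⟨ cong (_+ ρ r i) (≋⇒≡ (res<n k i) y<n res≋y) ⟩
        ξ i + ρ r′ i ∸ ρ r i + ρ r i     ≡⟨ m∸n+n≡m ρ≤ ⟩
        ξ i + ρ r′ i                     ∎
        where
        open ≡-Reasoning
        di>0 : 0 < d i
        di>0 = n≢0⇒n>0 λ e → <-irrefl (sym (trans (ξ≡dg i) (cong (_* g) e))) (ξ>0 i)
        g≤ξ : g ≤ ξ i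
        g≤ξ = subst (g ≤_) (sym (ξ≡dg i)) (m≤n*m g (d i) {{>-nonZero di>0}})
        ρ≤ : ρ r i ≤ ξ i + ρ r′ i
        ρ≤ = ≤-trans (<⇒≤ (m%n<n (res r i) g)) (≤-trans g≤ξ (m≤m+n _ _))
        di<m : d i < m
        di<m = *-cancelʳ-< g _ _ (subst₂ _<_ (ξ≡dg i) n≡mg (res<n z i))
        ξρ<n : ξ i + ρ r′ i < n
        ξρ<n = subst₂ _<_ (cong (_+ ρ r′ i) (sym (ξ≡dg i))) (sym n≡mg)
          (<-≤-trans (+-monoʳ-< (d i * g) (m%n<n (res r′ i) g)) (≤-trans (≤-reflexive (+-comm (d i * g) g)) (*-monoˡ-≤ g di<m)))
        y<n : ξ i + ρ r′ i ∸ ρ r i < n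
        y<n = ≤-<-trans (m∸n≤m _ (ρ r i)) ξρ<n
        combine : res k i + res r i ≋ ξ i + res r′ i
        combine = trans (+-cong-≋ {res k i} {k * c i} (mod-≋ _) (mod-≋ _)) (trans (≡⇒≋ (begin
            (t + z) * c i + r * c i     ≡⟨ lemma t z r (c i) ⟩
            z * c i + (t + r) * c i     ≡⟨ cong (λ q → z * c i + q * c i) t+r ⟩
            z * c i + r′ * c i          ∎)) (sym (+-cong-≋ {ξ i} {z * c i} (mod-≋ _) (mod-≋ _))))
          where
          lemma : ∀ t z r c → (t + z) * c + r * c ≡ z * c + (t + r) * c
          lemma = solve-∀
        res≋y : res k i ≋ ξ i + ρ r′ i ∸ ρ r i
        res≋y = +-cancelʳ-≋ (res r i) (trans combine (≡⇒≋ (begin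
          ξ i + res r′ i                                       ≡⟨ cong (ξ i +_) (res-split r′ i) ⟩
          ξ i + (ρ r′ i + ζ r′ i * g)                          ≡⟨ +-assoc (ξ i) (ρ r′ i) _ ⟨
          ξ i + ρ r′ i + ζ r′ i * g                            ≡⟨ cong₂ (λ u v → u + v * g) (sym (m∸n+n≡m ρ≤)) (sym (same-ζ i)) ⟩
          ξ i + ρ r′ i ∸ ρ r i + ρ r i + ζ r i * g             ≡⟨ +-assoc (ξ i + ρ r′ i ∸ ρ r i) (ρ r i) _ ⟩
          ξ i + ρ r′ i ∸ ρ r i + (ρ r i + ζ r i * g)           ≡⟨ cong (ξ i + ρ r′ i ∸ ρ r i +_) (sym (res-split r i)) ⟩
          ξ i + ρ r′ i ∸ ρ r i + res r i ∎)))
      Sk≡n : S k ≡ n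
      Sk≡n = +-cancelʳ-≡ A.P _ _ (begin
        S k + A.P                         ≡⟨ sum4-+ (res k) (ρ r) ⟨
        sum4 (λ i → res k i + ρ r i)      ≡⟨ sum4-cong shift ⟩
        sum4 (λ i → ξ i + ρ r′ i)         ≡⟨ sum4-+ ξ (ρ r′) ⟩
        sum4 ξ + B.P                      ≡⟨ cong₂ _+_ Sz (sym same-P) ⟩
        n + A.P ∎)
        where open ≡-Reasoning
      t%n≡0 : t % n ≡ 0
      t%n≡0 = trans (+-cancelʳ-≋ z {t} {0} (trans (proj₂ (unique k Sk≡n)) (sym (m<n⇒m%n≡m z<n)))) (m<n⇒m%n≡m (>-nonZero⁻¹ n))
      t%n>0 : 0 < t % n
      t%n>0 = subst (0 <_) (sym (m<n⇒m%n≡m (≤-<-trans (m∸n≤m r′ r) B.r<n))) (m<n⇒0<n∸m r<r′)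

    -- The g - 1 indices 0 < r < g have distinct keys, all in the list of candidates. `Fin (pred g)`
    -- numbers them from 0, hence the shift to `suc (toℕ i)`.
    index≤ : g ≤ suc (length (candidates m d))
    index≤ = ≮⇒≥ λ l → impossible (Fin.pigeonhole (≤-pred (subst (suc (suc (length (candidates m d))) ≤_) (sym (suc-pred g)) l)) place)
      where
      r>0 : (i : Fin (pred g)) → 0 < suc (toℕ i)
      r>0 i = z<s
      r<g : (i : Fin (pred g)) → suc (toℕ i) < g
      r<g i = subst (suc (toℕ i) <_) (suc-pred g) (s<s (Fin.toℕ<n i))
      in-list : ∀ i → Position.key (suc (toℕ i)) (r>0 i) (r<g i) ∈ candidates m d
      in-list i = Position.key∈ (suc (toℕ i)) (r>0 i) (r<g i)
      place : Fin (pred g) → Fin (length (candidates m d))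
      place i = index (in-list i)
      impossible : ∃[ i ] ∃[ j ] (toℕ i < toℕ j × place i ≡ place j) → ⊥
      impossible (i , j , i<j , e) = distinct (r>0 i) (r<g i) (r>0 j) (r<g j) (s<s i<j)
        (trans (lookup-index (in-list i)) (trans (cong (lookup (candidates m d)) e) (sym (lookup-index (in-list j)))))

-- The finite check of the remaining parameters.

module Enumeration where

  open FloorSearch
  open ResidueClasses
  open Digits
  open import Defs
  open import Data.Bool using (Bool; true; false; _∧_; if_then_else_) renaming (T to True)
  open import Data.Bool.Properties using (T-≡)
  open import Data.Bool.ListAction using (all)
  open import Data.Empty using (⊥-elim)
  open import Data.Fin using (Fin; zero; suc)
  open import Data.Fin.Permutation using (Permutation′; _⟨$⟩ʳ_; transpose; _∘ₚ_)
  import Data.Fin.Properties as Fin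
  open import Data.Fin.Patterns using (0F; 1F; 2F; 3F)
  open import Data.Integer as ℤ using (ℤ; +_)
  import Data.Integer.DivMod as ℤ
  import Data.Integer.Properties as ℤ
  open import Data.List using (List; []; _∷_; downFrom; length; concatMap; map)
  open import Data.List.Membership.Propositional using (_∈_)
  open import Data.List.Membership.Propositional.Properties using (∈-downFrom⁺)
  open import Data.List.Relation.Unary.Any using (here; there)
  open import Data.List.Relation.Unary.All as All using (All; tabulate)
  open import Data.List.Relation.Unary.All.Properties using (all⁻; all⁺)
  open import Data.Maybe as Maybe using (Maybe; just; nothing; _<∣>_; is-just; to-witness-T)
  open import Data.Nat
  open import Data.Nat.Properties
  open import Data.Nat.DivMod
  open import Data.Nat.GCD using (gcd)
  open import Data.Product using (_,_)
  open import Data.Sum using (_⊎_; inj₁; inj₂)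
  open import Data.Unit using (tt)
  open import Function.Bundles using (Equivalence)
  open import Relation.Binary.PropositionalEquality
  open import Relation.Nullary using (Dec; yes; no)
  open import Relation.Nullary.Decidable using (_×-dec_; _⊎-dec_; map′)

  -- The generator (a + b - 1, - a, - b, 1), with n added to the first three entries to stay in ℕ.
  weights : ℕ → ℕ → ℕ → Fin 4 → ℕ
  weights n a b 0F = a + b + pred n
  weights n a b 1F = n ∸ a
  weights n a b 2F = n ∸ b
  weights n a b 3F = 1

  exactlyOne : (ℕ → Bool) → List ℕ → Bool
  exactlyOne hit [] = false
  exactlyOne hit (k ∷ ks) = if hit k then all (λ l → hit l ⇒ᵇ (l ≡ᵇ k)) ks else exactlyOne hit ks

  ⇒ᵇ-intro : ∀ {a b} → (True a → True b) → True (a ⇒ᵇ b)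
  ⇒ᵇ-intro {true} f = f tt
  ⇒ᵇ-intro {false} f = tt

  exactlyOne-intro : ∀ hit {z} ks → z ∈ ks → True (hit z) → (∀ {k} → k ∈ ks → True (hit k) → k ≡ z) → True (exactlyOne hit ks)
  exactlyOne-intro hit {z} (k ∷ ks) z∈ hz uniq with hit k in eq
  ... | true = all⁻ _ (tabulate {P = λ l → True (hit l ⇒ᵇ (l ≡ᵇ k))}
        (λ {l} l∈ → ⇒ᵇ-intro {hit l} λ hl → ≡⇒≡ᵇ l k (trans (uniq (there l∈) hl) (sym (uniq (here refl) (subst True (sym eq) tt))))))
  exactlyOne-intro hit (k ∷ ks) (here refl) hz uniq | false = ⊥-elim (subst True eq hz)
  exactlyOne-intro hit (k ∷ ks) (there z∈) hz uniq | false = exactlyOne-intro hit ks z∈ hz (λ l∈ → uniq (there l∈))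

  module _ (n : ℕ) .{{_ : NonZero n}} (a b : ℕ) where

    level-one : ℕ → Bool
    level-one k = sum4 (λ i → (k * weights n a b i) % n) ≡ᵇ n

    -- A decidable consequence of the one-point property, so that every pair passing the test has to
    -- be classified: a single index has level n, and nonzero indices have no zero coordinate.
    plausible : Bool
    plausible = exactlyOne level-one (downFrom n) ∧
      all (λ k → (0 <ᵇ k) ⇒ᵇ all4 (λ i → 0 <ᵇ (k * weights n a b i) % n)) (downFrom n)

  Classified : Tetra → Set
  Classified v =
      Equivalent v (T (+ 3) (+ 3) (+ 4)) ⊎ (Equivalent v (T (+ 2) (+ 2) (+ 5)) ⊎
      (Equivalent v (T (+ 2) (+ 4) (+ 7)) ⊎ (Equivalent v (T (+ 2) (+ 6) (+ 11)) ⊎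
      (Equivalent v (T (+ 2) (+ 7) (+ 13)) ⊎ (Equivalent v (T (+ 2) (+ 9) (+ 17)) ⊎
      (Equivalent v (T (+ 2) (+ 13) (+ 19)) ⊎ Equivalent v (T (+ 3) (+ 7) (+ 20))))))))

  _≟ᴾ_ : (p q : Point) → Dec (p ≡ q)
  ⟨ a , b , c ⟩ ≟ᴾ ⟨ d , e , f ⟩ =
    map′ (λ { (refl , refl , refl) → refl }) (λ { refl → refl , refl , refl })
      ((a ℤ.≟ d) ×-dec ((b ℤ.≟ e) ×-dec (c ℤ.≟ f)))

  -- Every permutation of four indices is a product of transpositions (0 i), (1 j), (2 k) with i ≥
  -- 0, j ≥ 1, k ≥ 2 in exactly one way.
  permutations : List (Permutation′ 4)
  permutations =
    concatMap (λ i → concatMap (λ j → map (λ k → transpose 0F i ∘ₚ (transpose 1F j ∘ₚ transpose 2F k))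
      (2F ∷ 3F ∷ [])) (1F ∷ 2F ∷ 3F ∷ [])) (0F ∷ 1F ∷ 2F ∷ 3F ∷ [])

  firstJust : ∀ {A B : Set} → (A → Maybe B) → List A → Maybe B
  firstJust f [] = nothing
  firstJust f (x ∷ xs) = f x <∣> firstJust f xs

  equivalence? : ∀ v w → Matrix → Point → Permutation′ 4 → Maybe (Equivalent v w)
  equivalence? v w M u σ
    with (detM M ℤ.≟ + 1 ⊎-dec detM M ℤ.≟ ℤ.- (+ 1)) ×-dec Fin.all? (λ i → (apply M (v i) ⊕ u) ≟ᴾ w (σ ⟨$⟩ʳ i))
  ... | yes p = just (M , u , σ , p)
  ... | no _ = nothing

  module _ (a b n : ℕ) .{{_ : NonZero n}} (w : Tetra) where

    -- Once σ is chosen, the affine map is forced: (1,0,0) and (0,1,0) go to e 1F and e 2F, and n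
    -- times the image of (0,0,1) is e₃ - a e₁ - b e₂. `equivalence?` verifies the result, so a
    -- wrong guess can only be rejected.
    via : Permutation′ 4 → Maybe (Equivalent (T (+ a) (+ b) (+ n)) w)
    via σ = equivalence? (T (+ a) (+ b) (+ n)) w M (w (σ ⟨$⟩ʳ 0F)) σ
      where
      e : Fin 4 → Point
      e i = w (σ ⟨$⟩ʳ i) ⊖ w (σ ⟨$⟩ʳ 0F)
      -- A coordinate of the image of (0,0,1), meaningful only if the division is exact.
      quotient : (Point → ℤ) → ℤ
      quotient π = (π (e 3F) ℤ.- + a ℤ.* π (e 1F) ℤ.- + b ℤ.* π (e 2F)) ℤ./ℕ n
      M : Matrix
      M = mat ⟨ x (e 1F) , x (e 2F) , quotient x ⟩ ⟨ y (e 1F) , y (e 2F) , quotient y ⟩ ⟨ z (e 1F) , z (e 2F) , quotient z ⟩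

    equivalent? : Maybe (Equivalent (T (+ a) (+ b) (+ n)) w)
    equivalent? = firstJust via permutations

  classify : (a b n : ℕ) .{{_ : NonZero n}} → Maybe (Classified (T (+ a) (+ b) (+ n)))
  classify a b n =
    Maybe.map inj₁ (try 3 3 4) <∣> Maybe.map inj₂ (
    Maybe.map inj₁ (try 2 2 5) <∣> Maybe.map inj₂ (
    Maybe.map inj₁ (try 2 4 7) <∣> Maybe.map inj₂ (
    Maybe.map inj₁ (try 2 6 11) <∣> Maybe.map inj₂ (
    Maybe.map inj₁ (try 2 7 13) <∣> Maybe.map inj₂ (
    Maybe.map inj₁ (try 2 9 17) <∣> Maybe.map inj₂ (
    Maybe.map inj₁ (try 2 13 19) <∣> Maybe.map inj₂ (try 3 7 20)))))))
    where
    try : (a′ b′ n′ : ℕ) → Maybe (Equivalent (T (+ a) (+ b) (+ n)) (T (+ a′) (+ b′) (+ n′)))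
    try a′ b′ n′ = if n ≡ᵇ n′ then equivalent? a b n (T (+ a′) (+ b′) (+ n′)) else nothing

  all-lookup : ∀ {A : Set} (p : A → Bool) {xs a} → all p xs ≡ true → a ∈ xs → p a ≡ true
  all-lookup p {xs} h a∈ = T-≡ .Equivalence.to (All.lookup (all⁺ p xs (≡-true⇒ h)) a∈)

  complete : ℕ → Bool
  complete zero = true
  complete n@(suc _) = all (λ a → all (λ b → plausible n a b ⇒ᵇ is-just (classify a b n)) (downFrom n)) (downFrom n)

  -- One more than the number of candidates for every solution (m , d) of the floor search.
  bound : ℕ → ℕ
  bound 4 = 7
  bound 5 = 7
  bound 7 = 5
  bound 11 = 1
  bound 13 = 1
  bound 17 = 1
  bound 19 = 1
  bound _ = 0

  complete-elim : ∀ n .{{_ : NonZero n}} → complete n ≡ true → ∀ a b → a < n → b < n → True (plausible n a b) →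
    Classified (T (+ a) (+ b) (+ n))
  complete-elim n@(suc _) h a b a<n b<n p = to-witness-T (classify a b n) (⇒ᵇ-elim {plausible n a b} (≡-true⇒ checked) p)
    where
    check : ℕ → ℕ → Bool
    check a b = plausible n a b ⇒ᵇ is-just (classify a b n)
    checked : check a b ≡ true
    checked = all-lookup (check a) (all-lookup (λ a → all (check a) (downFrom n)) h (∈-downFrom⁺ a<n)) (∈-downFrom⁺ b<n)

  -- What is demanded of a leaf m, d of the search: m lies in the range of the final check,
  -- coprimality makes m a divisor of n, and the number of candidates bounds g by `bound m`.
  good : ℕ → (Fin 4 → ℕ) → Bool
  good zero d = false
  good m@(suc _) d = (m <ᵇ 20) ∧ ((gcd m (d 3F) ≡ᵇ 1) ∧ (length (candidates m d) <ᵇ bound m))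

  allBelow₂ : (ℕ → ℕ → Bool) → (ℕ → ℕ) → ℕ → Bool
  allBelow₂ p f N = all (λ m → all (p m) (downFrom (f m))) (downFrom N)

  allBelow₂-lookup : ∀ p f N → allBelow₂ p f N ≡ true → ∀ {m k} → m < N → k < f m → p m k ≡ true
  allBelow₂-lookup p f N h {m} m<N k<fm =
    all-lookup (p m) (all-lookup (λ m → all (p m) (downFrom (f m))) h (∈-downFrom⁺ m<N)) (∈-downFrom⁺ k<fm)

  -- Settled by evaluation. The inner index starts at 0, so it stands for g - 1; a value m with
  -- bound 0 contributes no case.
  all-complete : allBelow₂ (λ m g → complete (m * suc g)) bound 20 ≡ true
  all-complete = refl

  complete-multiple : ∀ m g → m < 20 → 0 < g → g ≤ bound m → complete (m * g) ≡ true
  complete-multiple m (suc g) m<20 _ g≤ = allBelow₂-lookup (λ m g → complete (m * suc g)) bound 20 all-complete m<20 g≤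

  -- Settled by evaluation. Fuel 17 covers k from 2 to 18; the largest solution, m = 19, is a leaf
  -- at k = 17.
  search-succeeds : search good 17 2 start ≡ true
  search-succeeds = refl

-- Determinants and composition of equivalences.

module Unimodular where

  open import Defs
  open import Data.Fin.Permutation using (_⟨$⟩ʳ_; _∘ₚ_)
  open import Data.Integer
  open import Data.Integer.Properties
  open import Data.Integer.Solver using (module +-*-Solver)
  open import Data.Product using (_,_)
  open import Data.Sum using (_⊎_; inj₁; inj₂)
  open import Relation.Binary.PropositionalEquality
  open +-*-Solver using (solve; _:=_; _:+_; _:*_; _:-_; :-_; con; Polynomial)

  point-≡ : ∀ {p q} → x p ≡ x q → y p ≡ y q → z p ≡ z q → p ≡ q
  point-≡ refl refl refl = refl

  private
    Poly = Polynomial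

    detᴾ : ∀ {n} (a b c d e f g h i : Poly n) → Poly n
    detᴾ a b c d e f g h i = a :* (e :* i :- f :* h) :- b :* (d :* i :- f :* g) :+ c :* (d :* h :- e :* g)

  det-row₀ : ∀ s p t q u r m n →
    det3 ((s · p) ⊕ ((t · q) ⊕ (u · r))) m n ≡ s * det3 p m n + (t * det3 q m n + u * det3 r m n)
  det-row₀ s ⟨ a , b , c ⟩ t ⟨ d , e , f ⟩ u ⟨ a′ , b′ , c′ ⟩ ⟨ g , h , i ⟩ ⟨ j , k , l ⟩ =
    solve 18 (λ s t u a b c d e f a′ b′ c′ g h i j k l →
      detᴾ (s :* a :+ (t :* d :+ u :* a′)) (s :* b :+ (t :* e :+ u :* b′)) (s :* c :+ (t :* f :+ u :* c′)) g h i j k l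
      := s :* detᴾ a b c g h i j k l :+ (t :* detᴾ d e f g h i j k l :+ u :* detᴾ a′ b′ c′ g h i j k l))
      refl s t u a b c d e f a′ b′ c′ g h i j k l

  det-cycle : ∀ p q r → det3 p q r ≡ det3 q r p
  det-cycle ⟨ a , b , c ⟩ ⟨ d , e , f ⟩ ⟨ g , h , i ⟩ =
    solve 9 (λ a b c d e f g h i → detᴾ a b c d e f g h i := detᴾ d e f g h i a b c) refl a b c d e f g h i

  det-swap : ∀ p q r → det3 q p r ≡ - det3 p q r
  det-swap ⟨ a , b , c ⟩ ⟨ d , e , f ⟩ ⟨ g , h , i ⟩ =
    solve 9 (λ a b c d e f g h i → detᴾ d e f a b c g h i := :- detᴾ a b c d e f g h i) refl a b c d e f g h i

  det-repeat : ∀ p q → det3 p p q ≡ + 0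
  det-repeat ⟨ a , b , c ⟩ ⟨ d , e , f ⟩ =
    solve 6 (λ a b c d e f → detᴾ a b c a b c d e f := con (+ 0)) refl a b c d e f

  _⊙_ : Matrix → Matrix → Matrix
  mat ⟨ a , b , c ⟩ ⟨ d , e , f ⟩ ⟨ g , h , i ⟩ ⊙ mat r₀ r₁ r₂ =
    mat (row a b c) (row d e f) (row g h i)
    where
    row : ℤ → ℤ → ℤ → Point
    row s t u = (s · r₀) ⊕ ((t · r₁) ⊕ (u · r₂))

  -- Linearity in one row, combined with cyclic rotation, expands the product into 27 determinants
  -- of rows of N. Each is 0 or, up to sign, Δ. This avoids normalising one identity of degree six
  -- in 18 variables.
  detM-⊙ : ∀ M N → detM (M ⊙ N) ≡ detM M * detM N
  detM-⊙ (mat ⟨ a , b , c ⟩ ⟨ d , e , f ⟩ ⟨ g , h , i ⟩) (mat r₀ r₁ r₂) = begin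
    det3 (row a b c) (row d e f) (row g h i)
      ≡⟨ det-row₀ a r₀ b r₁ c r₂ (row d e f) (row g h i) ⟩
    a * D r₀ + (b * D r₁ + c * D r₂)
      ≡⟨ cong₂ (λ u v → a * u + v) (step r₀) (cong₂ (λ u v → b * u + c * v) (step r₁) (step r₂)) ⟩
    a * E r₀ + (b * E r₁ + c * E r₂)
      ≡⟨ cong₂ (λ u v → a * u + v) E₀ (cong₂ (λ u v → b * u + c * v) E₁ E₂) ⟩
    a * ((e * i - f * h) * Δ) + (b * ((f * g - d * i) * Δ) + c * ((d * h - e * g) * Δ))
      ≡⟨ solve 10 (λ a b c d e f g h i Δ →
           a :* ((e :* i :- f :* h) :* Δ) :+ (b :* ((f :* g :- d :* i) :* Δ) :+ c :* ((d :* h :- e :* g) :* Δ))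
           := detᴾ a b c d e f g h i :* Δ) refl a b c d e f g h i Δ ⟩
    det3 ⟨ a , b , c ⟩ ⟨ d , e , f ⟩ ⟨ g , h , i ⟩ * Δ ∎
    where
    open ≡-Reasoning
    row : ℤ → ℤ → ℤ → Point
    row s t u = (s · r₀) ⊕ ((t · r₁) ⊕ (u · r₂))
    Δ : ℤ
    Δ = det3 r₀ r₁ r₂
    D : Point → ℤ
    D p = det3 p (row d e f) (row g h i)
    F : Point → Point → ℤ
    F p q = g * det3 r₀ p q + (h * det3 r₁ p q + i * det3 r₂ p q)
    E : Point → ℤ
    E p = d * F p r₀ + (e * F p r₁ + f * F p r₂)
    inner : ∀ p q → det3 q (row g h i) p ≡ F p q
    inner p q = trans (det-cycle q (row g h i) p) (det-row₀ g r₀ h r₁ i r₂ p q)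
    step : ∀ p → D p ≡ E p
    step p = trans (det-cycle p (row d e f) (row g h i)) (trans (det-row₀ d r₀ e r₁ f r₂ (row g h i) p)
      (cong₂ (λ u v → d * u + v) (inner p r₀) (cong₂ (λ u v → e * u + f * v) (inner p r₁) (inner p r₂))))
    repeat₁ : ∀ p q → det3 p q p ≡ + 0
    repeat₁ p q = trans (sym (det-cycle p p q)) (det-repeat p q)
    repeat₂ : ∀ p q → det3 q p p ≡ + 0
    repeat₂ p q = trans (det-cycle q p p) (det-repeat p q)
    d₁₂₀ : det3 r₁ r₂ r₀ ≡ Δ
    d₁₂₀ = sym (det-cycle r₀ r₁ r₂)
    d₂₀₁ : det3 r₂ r₀ r₁ ≡ Δ
    d₂₀₁ = det-cycle r₂ r₀ r₁
    d₁₀₂ : det3 r₁ r₀ r₂ ≡ - Δ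
    d₁₀₂ = det-swap r₀ r₁ r₂
    d₀₂₁ : det3 r₀ r₂ r₁ ≡ - Δ
    d₀₂₁ = trans (sym (det-cycle r₁ r₀ r₂)) d₁₀₂
    d₂₁₀ : det3 r₂ r₁ r₀ ≡ - Δ
    d₂₁₀ = trans (det-cycle r₂ r₁ r₀) d₁₀₂
    F≡ : ∀ p q {u v w} → det3 r₀ p q ≡ u → det3 r₁ p q ≡ v → det3 r₂ p q ≡ w → F p q ≡ g * u + (h * v + i * w)
    F≡ p q refl refl refl = refl
    combine : ∀ p {u v w} → F p r₀ ≡ u → F p r₁ ≡ v → F p r₂ ≡ w → E p ≡ d * u + (e * v + f * w)
    combine p refl refl refl = refl
    E₀ : E r₀ ≡ (e * i - f * h) * Δ
    E₀ = trans (combine r₀ (F≡ r₀ r₀ (det-repeat r₀ r₀) (repeat₂ r₀ r₁) (repeat₂ r₀ r₂))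
                           (F≡ r₀ r₁ (det-repeat r₀ r₁) (repeat₁ r₁ r₀) d₂₀₁)
                           (F≡ r₀ r₂ (det-repeat r₀ r₂) d₁₀₂ (repeat₁ r₂ r₀)))
      (solve 7 (λ d e f g h i Δ → d :* (g :* con (+ 0) :+ (h :* con (+ 0) :+ i :* con (+ 0))) :+
          (e :* (g :* con (+ 0) :+ (h :* con (+ 0) :+ i :* Δ)) :+ f :* (g :* con (+ 0) :+ (h :* (:- Δ) :+ i :* con (+ 0))))
          := (e :* i :- f :* h) :* Δ) refl d e f g h i Δ)
    E₁ : E r₁ ≡ (f * g - d * i) * Δ
    E₁ = trans (combine r₁ (F≡ r₁ r₀ (repeat₁ r₀ r₁) (det-repeat r₁ r₀) d₂₁₀)
                           (F≡ r₁ r₁ (repeat₂ r₁ r₀) (det-repeat r₁ r₁) (repeat₂ r₁ r₂))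
                           (F≡ r₁ r₂ refl (det-repeat r₁ r₂) (repeat₁ r₂ r₁)))
      (solve 7 (λ d e f g h i Δ → d :* (g :* con (+ 0) :+ (h :* con (+ 0) :+ i :* (:- Δ))) :+
          (e :* (g :* con (+ 0) :+ (h :* con (+ 0) :+ i :* con (+ 0))) :+ f :* (g :* Δ :+ (h :* con (+ 0) :+ i :* con (+ 0))))
          := (f :* g :- d :* i) :* Δ) refl d e f g h i Δ)
    E₂ : E r₂ ≡ (d * h - e * g) * Δ
    E₂ = trans (combine r₂ (F≡ r₂ r₀ (repeat₁ r₀ r₂) d₁₂₀ (det-repeat r₂ r₀))
                           (F≡ r₂ r₁ d₀₂₁ (repeat₁ r₁ r₂) (det-repeat r₂ r₁))
                           (F≡ r₂ r₂ (repeat₂ r₂ r₀) (repeat₂ r₂ r₁) (det-repeat r₂ r₂)))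
      (solve 7 (λ d e f g h i Δ → d :* (g :* con (+ 0) :+ (h :* Δ :+ i :* con (+ 0))) :+
          (e :* (g :* (:- Δ) :+ (h :* con (+ 0) :+ i :* con (+ 0))) :+ f :* (g :* con (+ 0) :+ (h :* con (+ 0) :+ i :* con (+ 0))))
          := (d :* h :- e :* g) :* Δ) refl d e f g h i Δ)

  apply-⊙ : ∀ M N p → apply (M ⊙ N) p ≡ apply M (apply N p)
  apply-⊙ (mat r s t) (mat ⟨ a , b , c ⟩ ⟨ d , e , f ⟩ ⟨ g , h , i ⟩) ⟨ u , v , w ⟩ =
    point-≡ (entry r) (entry s) (entry t)
    where
    entry : ∀ r → dot ((x r · ⟨ a , b , c ⟩) ⊕ ((y r · ⟨ d , e , f ⟩) ⊕ (z r · ⟨ g , h , i ⟩))) ⟨ u , v , w ⟩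
          ≡ dot r ⟨ a * u + b * v + c * w , d * u + e * v + f * w , g * u + h * v + i * w ⟩
    entry ⟨ j , k , l ⟩ = solve 15 (λ j k l a b c d e f g h i u v w →
        (j :* a :+ (k :* d :+ l :* g)) :* u :+ (j :* b :+ (k :* e :+ l :* h)) :* v :+ (j :* c :+ (k :* f :+ l :* i)) :* w
        := j :* (a :* u :+ b :* v :+ c :* w) :+ k :* (d :* u :+ e :* v :+ f :* w) :+ l :* (g :* u :+ h :* v :+ i :* w))
      refl j k l a b c d e f g h i u v w

  dot-⊕ : ∀ r p q → dot r (p ⊕ q) ≡ dot r p + dot r q
  dot-⊕ ⟨ a , b , c ⟩ ⟨ d , e , f ⟩ ⟨ g , h , i ⟩ = solve 9 (λ a b c d e f g h i →
    a :* (d :+ g) :+ b :* (e :+ h) :+ c :* (f :+ i) := a :* d :+ b :* e :+ c :* f :+ (a :* g :+ b :* h :+ c :* i))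
    refl a b c d e f g h i

  dot-· : ∀ r k p → dot r (k · p) ≡ k * dot r p
  dot-· ⟨ a , b , c ⟩ k ⟨ d , e , f ⟩ = solve 7 (λ a b c k d e f →
    a :* (k :* d) :+ b :* (k :* e) :+ c :* (k :* f) := k :* (a :* d :+ b :* e :+ c :* f)) refl a b c k d e f

  apply-⊕ : ∀ M p q → apply M (p ⊕ q) ≡ apply M p ⊕ apply M q
  apply-⊕ (mat r s t) p q = point-≡ (dot-⊕ r p q) (dot-⊕ s p q) (dot-⊕ t p q)

  apply-· : ∀ M k p → apply M (k · p) ≡ k · apply M p
  apply-· (mat r s t) k p = point-≡ (dot-· r k p) (dot-· s k p) (dot-· t k p)

  ⊕-assoc : ∀ p q r → (p ⊕ q) ⊕ r ≡ p ⊕ (q ⊕ r)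
  ⊕-assoc p q r = point-≡ (+-assoc (x p) _ _) (+-assoc (y p) _ _) (+-assoc (z p) _ _)

  unit-product : ∀ {a b} → a ≡ + 1 ⊎ a ≡ - (+ 1) → b ≡ + 1 ⊎ b ≡ - (+ 1) → a * b ≡ + 1 ⊎ a * b ≡ - (+ 1)
  unit-product (inj₁ refl) (inj₁ refl) = inj₁ refl
  unit-product (inj₁ refl) (inj₂ refl) = inj₂ refl
  unit-product (inj₂ refl) (inj₁ refl) = inj₂ refl
  unit-product (inj₂ refl) (inj₂ refl) = inj₁ refl

  Equivalent-trans : ∀ {v w t} → Equivalent v w → Equivalent w t → Equivalent v t
  Equivalent-trans {v} {w} {t} (M , p , σ , dM , eM) (N , q , τ , dN , eN) =
    N ⊙ M , apply N p ⊕ q , σ ∘ₚ τ ,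
    subst (λ δ → δ ≡ + 1 ⊎ δ ≡ - (+ 1)) (sym (detM-⊙ N M)) (unit-product dN dM) ,
    λ i → begin
      apply (N ⊙ M) (v i) ⊕ (apply N p ⊕ q)     ≡⟨ cong (_⊕ (apply N p ⊕ q)) (apply-⊙ N M (v i)) ⟩
      apply N (apply M (v i)) ⊕ (apply N p ⊕ q) ≡⟨ ⊕-assoc (apply N (apply M (v i))) _ q ⟨
      (apply N (apply M (v i)) ⊕ apply N p) ⊕ q ≡⟨ cong (_⊕ q) (apply-⊕ N (apply M (v i)) p) ⟨
      apply N (apply M (v i) ⊕ p) ⊕ q           ≡⟨ cong (λ r → apply N r ⊕ q) (eM i) ⟩
      apply N (w (σ ⟨$⟩ʳ i)) ⊕ q                ≡⟨ eN (σ ⟨$⟩ʳ i) ⟩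
      t (τ ⟨$⟩ʳ (σ ⟨$⟩ʳ i))                     ∎
    where open ≡-Reasoning

-- Transport along affine maps, cross products and Bézout identities.

module AffineMaps where

  open import Defs
  open Unimodular
  open import Data.Fin using (Fin; suc)
  open import Data.Fin.Patterns using (0F; 1F; 2F; 3F)
  open import Data.Integer hiding (_⊖_)
  open import Data.Integer.Divisibility.Signed using (_∣_; divides)
  open import Data.Integer.Properties
  open import Data.Integer.Solver using (module +-*-Solver)
  open import Data.Nat as ℕ using (ℕ)
  import Data.Nat.Divisibility
  import Data.Nat.Properties as ℕ
  open import Data.Nat.GCD using (module Bézout; module GCD)
  open import Data.Product using (∃; _×_; _,_; proj₁; proj₂)
  open import Relation.Binary.PropositionalEquality
  open +-*-Solver using (solve; _:=_; _:+_; _:*_; _:-_; :-_; Polynomial)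

  private
    variable
      v w : Tetra

  AffineMap : Matrix → Point → Tetra → Tetra → Set
  AffineMap M u v w = ∀ i → apply M (v i) ⊕ u ≡ w i

  module _ {M : Matrix} {u : Point} {v w : Tetra} (F : AffineMap M u v w) {p : Point} {N : ℕ} {μ : Fin 4 → ℕ} where

    private
      row : ∀ r c → (+ N) · p ≡ combo4 μ v → sum4 μ ≡ N →
            (+ N) * (dot r p + c) ≡ (+ μ 0F) * (dot r (v 0F) + c) + ((+ μ 1F) * (dot r (v 1F) + c) +
                                    ((+ μ 2F) * (dot r (v 2F) + c) + (+ μ 3F) * (dot r (v 3F) + c)))
      row r c e refl = begin
        (+ N′) * (dot r p + c)              ≡⟨ *-distribˡ-+ (+ N′) (dot r p) c ⟩
        (+ N′) * dot r p + (+ N′) * c       ≡⟨ cong (_+ (+ N′) * c) (dot-· r (+ N′) p) ⟨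
        dot r ((+ N′) · p) + (+ N′) * c     ≡⟨ cong (λ q → dot r q + (+ N′) * c) e ⟩
        dot r (combo4 μ v) + (+ N′) * c     ≡⟨ cong (_+ (+ N′) * c) expand ⟩
        _                                   ≡⟨ solve 9 (λ m₀ m₁ m₂ m₃ d₀ d₁ d₂ d₃ c →
            m₀ :* d₀ :+ (m₁ :* d₁ :+ (m₂ :* d₂ :+ m₃ :* d₃)) :+ (m₀ :+ m₁ :+ m₂ :+ m₃) :* c
            := m₀ :* (d₀ :+ c) :+ (m₁ :* (d₁ :+ c) :+ (m₂ :* (d₂ :+ c) :+ m₃ :* (d₃ :+ c)))) refl
            (+ μ 0F) (+ μ 1F) (+ μ 2F) (+ μ 3F) (dot r (v 0F)) (dot r (v 1F)) (dot r (v 2F)) (dot r (v 3F)) c ⟩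
        _ ∎
        where
        open ≡-Reasoning
        N′ = sum4 μ
        expand : dot r (combo4 μ v) ≡ (+ μ 0F) * dot r (v 0F) + ((+ μ 1F) * dot r (v 1F) +
                                      ((+ μ 2F) * dot r (v 2F) + (+ μ 3F) * dot r (v 3F)))
        expand = trans (dot-⊕ r (t 0F) (t 1F ⊕ (t 2F ⊕ t 3F))) (cong₂ _+_ (s 0F) (trans (dot-⊕ r (t 1F) (t 2F ⊕ t 3F)) (cong₂ _+_ (s 1F)
                   (trans (dot-⊕ r (t 2F) (t 3F)) (cong₂ _+_ (s 2F) (s 3F))))))
          where
          t = λ i → (+ μ i) · v i
          s = λ i → dot-· r (+ μ i) (v i)

    combo4-cong : ∀ {v w : Tetra} → (∀ i → v i ≡ w i) → combo4 μ v ≡ combo4 μ w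
    combo4-cong e = cong₂ _⊕_ (term 0F) (cong₂ _⊕_ (term 1F) (cong₂ _⊕_ (term 2F) (term 3F)))
      where
      term = λ i → cong ((+ μ i) ·_) (e i)

    Barycentric-map : Barycentric v p N μ → Barycentric w (apply M p ⊕ u) N μ
    Barycentric-map (N>0 , Σμ , e) = N>0 , Σμ , trans
      (point-≡ (row (row₀ M) (x u) e Σμ) (row (row₁ M) (y u) e Σμ) (row (row₂ M) (z u) e Σμ))
      (combo4-cong {v = λ i → apply M (v i) ⊕ u} {w} F)

  -- Affine maps preserve barycentric weights, so a point of w is pulled back to v with the same
  -- weights, treated there by cleanness or uniqueness, and recovered by applying the first map.
  OnePoint-transfer : ∀ {M u N t} → AffineMap M u v w → AffineMap N t w v →
    (∀ q → apply M (apply N q ⊕ t) ⊕ u ≡ q) → NonDegenerate w → OnePoint v → OnePoint w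
  OnePoint-transfer {v} {w} {M} {u} {N} {t} F G FG nd ((_ , clean) , p , (K , μ , bary , pos) , unique) =
    (nd , λ q → boundary q) ,
    apply M p ⊕ u , (K , μ , Barycentric-map {M} {u} {v} {w} F {μ = μ} bary , pos) ,
    λ { q (K′ , μ′ , bary′ , pos′) → trans (sym (FG q))
          (cong (λ r → apply M r ⊕ u) (unique _ (K′ , μ′ , Barycentric-map {N} {t} {w} {v} G {μ = μ′} bary′ , pos′))) }
    where
    boundary : ∀ q → OnBoundary w q → IsVertex w q
    boundary q (K′ , μ′ , bary′ , face) with clean _ (K′ , μ′ , Barycentric-map {N} {t} {w} {v} G {μ = μ′} bary′ , face)
    ... | i , e = i , trans (sym (FG q)) (trans (cong (λ r → apply M r ⊕ u) e) (F i))

  -- The cross product, an integral normal of the plane spanned by its arguments.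
  _⊗_ : Point → Point → Point
  ⟨ a , b , c ⟩ ⊗ ⟨ d , e , f ⟩ = ⟨ b * f - c * e , c * d - a * f , a * e - b * d ⟩

  private
    detᴾ : ∀ {n} (a b c d e f g h i : Polynomial n) → Polynomial n
    detᴾ a b c d e f g h i = a :* (e :* i :- f :* h) :- b :* (d :* i :- f :* g) :+ c :* (d :* h :- e :* g)

  dot-⊗ : ∀ p q r → dot (p ⊗ q) r ≡ det3 p q r
  dot-⊗ ⟨ a , b , c ⟩ ⟨ d , e , f ⟩ ⟨ g , h , i ⟩ = solve 9 (λ a b c d e f g h i →
    (b :* f :- c :* e) :* g :+ (c :* d :- a :* f) :* h :+ (a :* e :- b :* d) :* i := detᴾ a b c d e f g h i)
    refl a b c d e f g h i

  dot-shear : ∀ p s w q → dot (p ⊖ (s · w)) q ≡ dot p q - s * dot w q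
  dot-shear ⟨ a , b , c ⟩ s ⟨ d , e , f ⟩ ⟨ g , h , i ⟩ = solve 10 (λ a b c s d e f g h i →
    (a :- s :* d) :* g :+ (b :- s :* e) :* h :+ (c :- s :* f) :* i
    := a :* g :+ b :* h :+ c :* i :- s :* (d :* g :+ e :* h :+ f :* i)) refl a b c s d e f g h i

  dot-scale : ∀ k p q → dot (k · p) q ≡ k * dot p q
  dot-scale k ⟨ a , b , c ⟩ ⟨ d , e , f ⟩ = solve 7 (λ k a b c d e f →
    k :* a :* d :+ k :* b :* e :+ k :* c :* f := k :* (a :* d :+ b :* e :+ c :* f)) refl k a b c d e f

  det-shear : ∀ p s q t k w → det3 (p ⊖ (s · w)) (q ⊖ (t · w)) (k · w) ≡ k * det3 p q w
  det-shear ⟨ a , b , c ⟩ s ⟨ d , e , f ⟩ t k ⟨ g , h , i ⟩ = solve 12 (λ a b c d e f g h i s t k →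
    detᴾ (a :- s :* g) (b :- s :* h) (c :- s :* i) (d :- t :* g) (e :- t :* h) (f :- t :* i) (k :* g) (k :* h) (k :* i)
    := k :* detᴾ a b c d e f g h i) refl a b c d e f g h i s t k

  -- For vectors of determinant 1 the three cross products are the dual basis, and this identity
  -- shows that it is unimodular as well.
  det-cofactor : ∀ p q r → det3 (q ⊗ r) (r ⊗ p) (p ⊗ q) ≡ det3 p q r * det3 p q r
  det-cofactor ⟨ a , b , c ⟩ ⟨ d , e , f ⟩ ⟨ g , h , i ⟩ = solve 9 (λ a b c d e f g h i →
    detᴾ (e :* i :- f :* h) (f :* g :- d :* i) (d :* h :- e :* g)
         (h :* c :- i :* b) (i :* a :- g :* c) (g :* b :- h :* a)
         (b :* f :- c :* e) (c :* d :- a :* f) (a :* e :- b :* d)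
    := detᴾ a b c d e f g h i :* detᴾ a b c d e f g h i) refl a b c d e f g h i

  cramer : ∀ p q r t → det3 p q r · t ≡ (dot (q ⊗ r) t · p) ⊕ ((dot (r ⊗ p) t · q) ⊕ (dot (p ⊗ q) t · r))
  cramer ⟨ a , b , c ⟩ ⟨ d , e , f ⟩ ⟨ g , h , i ⟩ ⟨ j , k , l ⟩ = point-≡
    (solve 12 (λ a b c d e f g h i j k l → detᴾ a b c d e f g h i :* j :=
      A a b c d e f g h i j k l :* a :+ (B a b c d e f g h i j k l :* d :+ C a b c d e f g h i j k l :* g)) refl a b c d e f g h i j k l)
    (solve 12 (λ a b c d e f g h i j k l → detᴾ a b c d e f g h i :* k :=
      A a b c d e f g h i j k l :* b :+ (B a b c d e f g h i j k l :* e :+ C a b c d e f g h i j k l :* h)) refl a b c d e f g h i j k l)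
    (solve 12 (λ a b c d e f g h i j k l → detᴾ a b c d e f g h i :* l :=
      A a b c d e f g h i j k l :* c :+ (B a b c d e f g h i j k l :* f :+ C a b c d e f g h i j k l :* i)) refl a b c d e f g h i j k l)
    where
    A B C : ∀ {n} (a b c d e f g h i j k l : Polynomial n) → Polynomial n
    A a b c d e f g h i j k l = (e :* i :- f :* h) :* j :+ (f :* g :- d :* i) :* k :+ (d :* h :- e :* g) :* l
    B a b c d e f g h i j k l = (h :* c :- i :* b) :* j :+ (i :* a :- g :* c) :* k :+ (g :* b :- h :* a) :* l
    C a b c d e f g h i j k l = (b :* f :- c :* e) :* j :+ (c :* d :- a :* f) :* k :+ (a :* e :- b :* d) :* l

  unit-scale : ∀ p → (∃ λ s → p * s ≡ + ∣ p ∣ × p ≡ s * + ∣ p ∣)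
  unit-scale (+ n) = + 1 , *-identityʳ (+ n) , sym (*-identityˡ (+ n))
  unit-scale -[1+ n ] = - (+ 1) , trans (*-comm -[1+ n ] (- (+ 1))) (-1*i≡-i -[1+ n ]) , sym (-1*i≡-i (+ ℕ.suc n))

  signed : ∀ {δ m n} → Bézout.Identity δ m n → ∃ λ X → ∃ λ Y → + m * X + + n * Y ≡ + δ
  signed {δ} {m} {n} (Bézout.+- x y e) = + x , - (+ y) , (begin
      + m * + x + + n * - (+ y)     ≡⟨ cong₂ _+_ (trans (*-comm (+ m) (+ x)) (sym (pos-* x m)))
                                                 (trans (*-comm (+ n) _) (trans (sym (neg-distribˡ-* (+ y) (+ n))) (cong -_ (sym (pos-* y n))))) ⟩
      + (x ℕ.* m) - + (y ℕ.* n)     ≡⟨ cong (λ u → + u - + (y ℕ.* n)) (sym e) ⟩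
      + (δ ℕ.+ y ℕ.* n) - + (y ℕ.* n) ≡⟨ cong (_- + (y ℕ.* n)) (pos-+ δ (y ℕ.* n)) ⟩
      + δ + + (y ℕ.* n) - + (y ℕ.* n) ≡⟨ solve 2 (λ a b → a :+ b :- b := a) refl (+ δ) (+ (y ℕ.* n)) ⟩
      + δ ∎)
    where open ≡-Reasoning
  signed {δ} {m} {n} (Bézout.-+ x y e) = - (+ x) , + y , (begin
      + m * - (+ x) + + n * + y     ≡⟨ cong₂ _+_ (trans (*-comm (+ m) _) (trans (sym (neg-distribˡ-* (+ x) (+ m))) (cong -_ (sym (pos-* x m)))))
                                                 (trans (*-comm (+ n) (+ y)) (sym (pos-* y n))) ⟩
      - + (x ℕ.* m) + + (y ℕ.* n)   ≡⟨ cong (λ u → - + (x ℕ.* m) + + u) (sym e) ⟩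
      - + (x ℕ.* m) + + (δ ℕ.+ x ℕ.* m) ≡⟨ cong (λ u → - + (x ℕ.* m) + u) (pos-+ δ (x ℕ.* m)) ⟩
      - + (x ℕ.* m) + (+ δ + + (x ℕ.* m)) ≡⟨ solve 2 (λ a b → :- b :+ (a :+ b) := a) refl (+ δ) (+ (x ℕ.* m)) ⟩
      + δ ∎)
    where open ≡-Reasoning

  bezout : ∀ p q → ∃ λ δ → ∃ λ f → ∃ λ g → (p * f + q * g ≡ + δ) × (+ δ ∣ p) × (+ δ ∣ q)
  bezout p q with Bézout.lemma ∣ p ∣ ∣ q ∣ | unit-scale p | unit-scale q
  ... | Bézout.result δ gcd identity | s , ps , p≡ | t , qt , q≡ = δ , f , g , eq , div p s p≡ (GCD.gcd∣m gcd) , div q t q≡ (GCD.gcd∣n gcd)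
    where
    div : ∀ r s → r ≡ s * + ∣ r ∣ → δ Data.Nat.Divisibility.∣ ∣ r ∣ → + δ ∣ r
    div r s e (Data.Nat.Divisibility.divides k e′) = divides (s * + k)
      (trans e (trans (cong (λ u → s * + u) e′) (trans (cong (s *_) (pos-* k δ)) (sym (*-assoc s (+ k) (+ δ))))))
    solution = signed identity
    f g : ℤ
    f = s * proj₁ solution
    g = t * proj₁ (proj₂ solution)
    eq : p * f + q * g ≡ + δ
    eq = trans (cong₂ _+_ (trans (sym (*-assoc p s _)) (cong (_* proj₁ solution) ps)) (trans (sym (*-assoc q t _)) (cong (_* proj₁ (proj₂ solution)) qt)))
           (proj₂ (proj₂ solution))

  bezout₃ : ∀ w → ∃ λ δ → ∃ λ f → (dot w f ≡ + δ) × (+ δ ∣ x w) × (+ δ ∣ y w) × (+ δ ∣ z w)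
  bezout₃ ⟨ p , q , r ⟩ with bezout p q
  ... | δ , f , g , e , divides p′ p≡ , divides q′ q≡ with bezout (+ δ) r
  ... | ε , k , l , e′ , divides m δ≡ , r∣ =
    ε , ⟨ f * k , g * k , l ⟩ , trans (solve 6 (λ p q f g k u → p :* (f :* k) :+ q :* (g :* k) :+ u := (p :* f :+ q :* g) :* k :+ u) refl p q f g k (r * l))
        (trans (cong (λ u → u * k + r * l) e) e′) ,
    divides (p′ * m) (trans p≡ (trans (cong (p′ *_) δ≡) (sym (*-assoc p′ m (+ ε))))) ,
    divides (q′ * m) (trans q≡ (trans (cong (q′ *_) δ≡) (sym (*-assoc q′ m (+ ε))))) , r∣

-- The lattice plane of a clean facet.

module PrimitiveFacets where

  open import Defs
  open Unimodular
  open AffineMaps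
  open import Data.Empty using (⊥; ⊥-elim)
  open import Data.Fin using (Fin; zero; suc)
  open import Data.Fin.Patterns using (0F; 1F; 2F; 3F)
  open import Data.Integer hiding (_⊖_)
  open import Data.Integer.DivMod using (_/ℕ_; _%ℕ_; a≡a%ℕn+[a/ℕn]*n; n%ℕd<d)
  open import Data.Integer.Divisibility.Signed using (_∣_; divides)
  open import Data.Integer.Properties
  open import Data.Integer.Solver using (module +-*-Solver)
  open import Data.Nat as ℕ using (ℕ)
  import Data.Nat.Properties as ℕ
  open import Data.Product using (∃; _×_; _,_; proj₁; proj₂)
  open import Relation.Binary.PropositionalEquality
  open import Relation.Nullary using (yes; no)
  open +-*-Solver using (solve; _:=_; _:+_; _:*_; _:-_; :-_; con)

  dot-⊗-left : ∀ p q → dot (p ⊗ q) p ≡ + 0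
  dot-⊗-left p q = trans (dot-⊗ p q p) (trans (sym (det-cycle p p q)) (det-repeat p q))

  dot-⊗-right : ∀ p q → dot (p ⊗ q) q ≡ + 0
  dot-⊗-right p q = trans (dot-⊗ p q q) (trans (det-cycle p q q) (det-repeat q p))

  -- Translating by the lattice vector A′ p + B′ q moves Q into the half-open parallelogram on p and
  -- q, where the coefficients are remainders modulo δ.
  combination-reduce : ∀ {δ α A A′ β B B′} p q Q → A ≡ α + A′ * δ → B ≡ β + B′ * δ →
    δ · Q ≡ (A · p) ⊕ (B · q) → δ · ((Q ⊖ (A′ · p)) ⊖ (B′ · q)) ≡ (α · p) ⊕ (β · q)
  combination-reduce {δ} {α} {_} {A′} {β} {_} {B′} ⟨ a , b , c ⟩ ⟨ d , e , f ⟩ ⟨ g , h , i ⟩ refl refl eq =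
    point-≡ (coordinate a d g (cong x eq)) (coordinate b e h (cong y eq)) (coordinate c f i (cong z eq))
    where
    coordinate : ∀ a b s → δ * s ≡ (α + A′ * δ) * a + (β + B′ * δ) * b → δ * (s - A′ * a - B′ * b) ≡ α * a + β * b
    coordinate a b s h′ = begin
      δ * (s - A′ * a - B′ * b)
        ≡⟨ solve 6 (λ δ s A′ B′ a b → δ :* (s :- A′ :* a :- B′ :* b) := δ :* s :- (A′ :* δ :* a :+ B′ :* δ :* b)) refl δ s A′ B′ a b ⟩
      δ * s - (A′ * δ * a + B′ * δ * b)
        ≡⟨ cong (_- (A′ * δ * a + B′ * δ * b)) h′ ⟩
      (α + A′ * δ) * a + (β + B′ * δ) * b - (A′ * δ * a + B′ * δ * b)
        ≡⟨ solve 6 (λ α A′ β B′ a b → (α :+ A′) :* a :+ (β :+ B′) :* b :- (A′ :* a :+ B′ :* b) := α :* a :+ β :* b) refl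
             α (A′ * δ) β (B′ * δ) a b ⟩
      α * a + β * b ∎
      where open ≡-Reasoning

  -- The half-turn of the parallelogram exchanges its two triangles, so only the one that is a facet
  -- needs to be examined.
  combination-reflect : ∀ {δ α α′ β β′} p q Q → δ ≡ α′ + α → δ ≡ β′ + β →
    δ · Q ≡ (α · p) ⊕ (β · q) → δ · ((p ⊕ q) ⊖ Q) ≡ (α′ · p) ⊕ (β′ · q)
  combination-reflect {δ} {α} {α′} {β} {β′} ⟨ a , b , c ⟩ ⟨ d , e , f ⟩ ⟨ g , h , i ⟩ δ≡ δ≡′ eq =
    point-≡ (coordinate a d g (cong x eq)) (coordinate b e h (cong y eq)) (coordinate c f i (cong z eq))
    where
    coordinate : ∀ a b s → δ * s ≡ α * a + β * b → δ * (a + b - s) ≡ α′ * a + β′ * b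
    coordinate a b s h = begin
      δ * (a + b - s)                          ≡⟨ solve 4 (λ δ a b s → δ :* (a :+ b :- s) := δ :* a :+ δ :* b :- δ :* s) refl δ a b s ⟩
      δ * a + δ * b - δ * s                    ≡⟨ cong (λ t → δ * a + δ * b - t) h ⟩
      δ * a + δ * b - (α * a + β * b)          ≡⟨ cong₂ (λ s t → s * a + t * b - (α * a + β * b)) δ≡ δ≡′ ⟩
      (α′ + α) * a + (β′ + β) * b - (α * a + β * b)
        ≡⟨ solve 6 (λ α′ α β′ β a b → (α′ :+ α) :* a :+ (β′ :+ β) :* b :- (α :* a :+ β :* b) := α′ :* a :+ β′ :* b) refl α′ α β′ β a b ⟩
      α′ * a + β′ * b ∎
      where open ≡-Reasoning

  combination-translate : ∀ {δ γ α β : ℤ} v₀ v₁ v₂ v₃ Q → δ ≡ γ + α + β →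
    δ · Q ≡ (α · (v₁ ⊖ v₀)) ⊕ (β · (v₂ ⊖ v₀)) → δ · (v₀ ⊕ Q) ≡ (γ · v₀) ⊕ ((α · v₁) ⊕ ((β · v₂) ⊕ ((+ 0) · v₃)))
  combination-translate {_} {γ} {α} {β} ⟨ a , b , c ⟩ ⟨ d , e , f ⟩ ⟨ g , h , i ⟩ ⟨ j , k , l ⟩ ⟨ s , t , u ⟩ refl eq =
    point-≡ (coordinate a d g j s (cong x eq)) (coordinate b e h k t (cong y eq)) (coordinate c f i l u (cong z eq))
    where
    coordinate : ∀ a₀ a₁ a₂ a₃ s → (γ + α + β) * s ≡ α * (a₁ - a₀) + β * (a₂ - a₀) →
      (γ + α + β) * (a₀ + s) ≡ γ * a₀ + (α * a₁ + (β * a₂ + + 0 * a₃))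
    coordinate a₀ a₁ a₂ a₃ s h = trans (*-distribˡ-+ (γ + α + β) a₀ s) (trans (cong (λ t → (γ + α + β) * a₀ + t) h)
      (solve 7 (λ γ α β a₀ a₁ a₂ a₃ → (γ :+ α :+ β) :* a₀ :+ (α :* (a₁ :- a₀) :+ β :* (a₂ :- a₀))
        := γ :* a₀ :+ (α :* a₁ :+ (β :* a₂ :+ con (+ 0) :* a₃))) refl γ α β a₀ a₁ a₂ a₃))

  ⊕-⊖-cancel : ∀ p q → q ≡ (p ⊕ q) ⊖ p
  ⊕-⊖-cancel ⟨ a , b , c ⟩ ⟨ d , e , f ⟩ = point-≡ (cancel a d) (cancel b e) (cancel c f)
    where
    cancel : ∀ a s → s ≡ a + s - a
    cancel = solve 2 (λ a s → s := a :+ s :- a) refl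

  neg-∣ : ∀ {δ a} → (+ δ ∣ - a) → (+ δ ∣ a)
  neg-∣ {δ} {a} (divides k h) = divides (- k) (trans (sym (neg-involutive a)) (trans (cong -_ h) (neg-distribˡ-* k (+ δ))))

  -- With p = (a, b, c) and q = (d, e, f), the entries of d p - a q, e p - b q and f p - c q are 0
  -- or, up to sign, entries of the normal, so δ divides all three vectors. Saturation then yields
  -- that δ divides a, b and c, hence p = 1 p + 0 q, and a second use yields that it divides 1.
  unit-divisor : ∀ δ p q → (∀ A B Q → (+ δ) · Q ≡ (A · p) ⊕ (B · q) → (+ δ ∣ A) × (+ δ ∣ B)) →
    (+ δ ∣ x (p ⊗ q)) → (+ δ ∣ y (p ⊗ q)) → (+ δ ∣ z (p ⊗ q)) → (+ δ ∣ + 1)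
  unit-divisor δ p@(⟨ a , b , c ⟩) q@(⟨ d , e , f ⟩) saturated (divides kx wx) (divides ky wy) (divides kz wz) =
    combine px py pz
    where
    swap : ∀ k → + δ * k ≡ k * + δ
    swap k = *-comm (+ δ) k
    null : ∀ a b → + δ * + 0 ≡ b * a + - a * b
    null a b = trans (*-zeroʳ (+ δ)) (solve 2 (λ a b → con (+ 0) := b :* a :+ (:- a) :* b) refl a b)
    plus : ∀ {k s} a b c d → s ≡ k * + δ → s ≡ b * c - a * d → + δ * k ≡ b * c + - a * d
    plus {k} a b c d h h′ = trans (swap k) (trans (sym h) (trans h′ (solve 4 (λ a b c d → b :* c :- a :* d := b :* c :+ (:- a) :* d) refl a b c d)))
    minus : ∀ {k s} a b c d → s ≡ k * + δ → s ≡ a * d - b * c → + δ * (- k) ≡ b * c + - a * d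
    minus {k} a b c d h h′ = trans (trans (*-comm (+ δ) (- k)) (sym (neg-distribˡ-* k (+ δ))))
      (trans (cong -_ (trans (sym h) h′)) (solve 4 (λ a b c d → :- (a :* d :- b :* c) := b :* c :+ (:- a) :* d) refl a b c d))
    tweak₁ : ∀ a b c d → a * b - c * d ≡ b * a - c * d
    tweak₁ = solve 4 (λ a b c d → a :* b :- c :* d := b :* a :- c :* d) refl
    tweak₂ : ∀ a b c d → a * b - c * d ≡ a * b - d * c
    tweak₂ = solve 4 (λ a b c d → a :* b :- c :* d := a :* b :- d :* c) refl
    px : + δ ∣ x p
    px = neg-∣ (proj₂ (saturated d (- a) ⟨ + 0 , - kz , ky ⟩
      (point-≡ (null a d)
        (minus a d b e wz (tweak₂ a e b d))
        (plus a d c f wy (tweak₁ c d a f)))))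
    py : + δ ∣ y p
    py = neg-∣ (proj₂ (saturated e (- b) ⟨ kz , + 0 , - kx ⟩
      (point-≡ (plus b e a d wz (tweak₁ a e b d))
        (null b e)
        (minus b e c f wx (tweak₂ b f c e)))))
    pz : + δ ∣ z p
    pz = neg-∣ (proj₂ (saturated f (- c) ⟨ - ky , kx , + 0 ⟩
      (point-≡ (minus c f a d wy (tweak₂ c d a f))
        (plus c f b e wx (tweak₁ b f c e))
        (null c f))))
    combine : (+ δ ∣ a) → (+ δ ∣ b) → (+ δ ∣ c) → (+ δ ∣ + 1)
    combine (divides k h) (divides l h′) (divides m h″) =
      proj₁ (saturated (+ 1) (+ 0) ⟨ k , l , m ⟩ (point-≡ (coordinate d h) (coordinate e h′) (coordinate f h″)))
      where
      coordinate : ∀ {a k} b → a ≡ k * + δ → + δ * k ≡ + 1 * a + + 0 * b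
      coordinate {a} {k} b h = trans (swap k) (trans (sym h) (solve 2 (λ a b → a := con (+ 1) :* a :+ con (+ 0) :* b) refl a b))

  dot-origin : ∀ r → dot origin r ≡ + 0
  dot-origin ⟨ a , b , c ⟩ = solve 3 (λ a b c → con (+ 0) :* a :+ con (+ 0) :* b :+ con (+ 0) :* c := con (+ 0)) refl a b c

  normal-origin : ∀ p q r → p ⊗ q ≡ origin → det3 p q r ≡ + 0
  normal-origin p q r h = trans (sym (dot-⊗ p q r)) (trans (cong (λ w → dot w r) h) (dot-origin r))

  unit-divides : ∀ δ → (+ δ ∣ + 1) → δ ≡ 1
  unit-divides δ (divides k h) = ℕ.m*n≡1⇒n≡1 ∣ k ∣ δ (trans (sym (abs-* k (+ δ))) (cong ∣_∣ (sym h)))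

  zero-divides : ∀ a → (+ 0 ∣ a) → a ≡ + 0
  zero-divides a (divides k h) = trans h (*-zeroʳ k)

  primitive-dual : ∀ w → w ≢ origin → (∀ δ .{{_ : ℕ.NonZero δ}} → (+ δ ∣ x w) → (+ δ ∣ y w) → (+ δ ∣ z w) → (+ δ ∣ + 1)) →
    ∃ λ f → dot w f ≡ + 1
  primitive-dual w w≢0 unit = conclude (bezout₃ w)
    where
    conclude : (∃ λ δ → ∃ λ f → (dot w f ≡ + δ) × (+ δ ∣ x w) × (+ δ ∣ y w) × (+ δ ∣ z w)) → ∃ λ f → dot w f ≡ + 1
    conclude (ℕ.zero , f , _ , wx , wy , wz) =
      ⊥-elim (w≢0 (point-≡ (zero-divides (x w) wx) (zero-divides (y w) wy) (zero-divides (z w) wz)))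
    conclude (δ@(ℕ.suc _) , f , eq , wx , wy , wz) = f , trans eq (cong +_ (unit-divides δ (unit δ wx wy wz)))

  module CleanFacet (v : Tetra) (nondegenerate : NonDegenerate v) (clean : ∀ P → OnBoundary v P → IsVertex v P) where

    e : Fin 4 → Point
    e i = v i ⊖ v 0F

    p q r : Point
    p = e 1F
    q = e 2F
    r = e 3F

    D : ℤ
    D = det3 p q r

    private
      instance
        D≢0 : NonZero D
        D≢0 = ≢-nonZero nondegenerate

    -- The weights γ, α, β, 0 place `v 0F ⊕ Q` on the facet opposite `v 3F`, where cleanness leaves
    -- only vertices.
    in-triangle : ∀ α β γ Q → (+ (γ ℕ.+ α ℕ.+ β)) · Q ≡ ((+ α) · p) ⊕ ((+ β) · q) → 0 ℕ.< γ ℕ.+ α ℕ.+ β → ∃ λ i → Q ≡ e i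
    in-triangle α β γ Q eq 0<δ with clean (v 0F ⊕ Q) (γ ℕ.+ α ℕ.+ β , μ , (0<δ , sum , bary) , 3F , refl)
      where
      μ : Fin 4 → ℕ
      μ 0F = γ
      μ 1F = α
      μ 2F = β
      μ 3F = 0
      sum : sum4 μ ≡ γ ℕ.+ α ℕ.+ β
      sum = ℕ.+-identityʳ _
      bary : (+ (γ ℕ.+ α ℕ.+ β)) · (v 0F ⊕ Q) ≡ combo4 μ v
      bary = combination-translate {γ = + γ} {+ α} {+ β} (v 0F) (v 1F) (v 2F) (v 3F) Q (trans (pos-+ (γ ℕ.+ α) β) (cong (_+ + β) (pos-+ γ α))) eq
    ... | i , h = i , trans (⊕-⊖-cancel (v 0F) Q) (cong (_⊖ v 0F) h)

    along : ∀ u {δ α β Q} → (+ δ) · Q ≡ ((+ α) · p) ⊕ ((+ β) · q) → + δ * dot u Q ≡ + α * dot u p + + β * dot u q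
    along u {δ} {α} {β} {Q} eq = trans (sym (dot-· u (+ δ) Q)) (trans (cong (dot u) eq)
      (trans (dot-⊕ u ((+ α) · p) ((+ β) · q)) (cong₂ _+_ (dot-· u (+ α) p) (dot-· u (+ β) q))))

    -- Pairing with `q ⊗ r` kills q and takes the nonzero value D at p, which isolates α. The
    -- analogous pairings isolate β and the component off the plane.
    along-p : ∀ {δ α β Q} → (+ δ) · Q ≡ ((+ α) · p) ⊕ ((+ β) · q) → + δ * dot (q ⊗ r) Q ≡ + α * D
    along-p {δ} {α} {β} {Q} eq = trans (along (q ⊗ r) {δ} {α} {β} {Q} eq) (trans (cong₂ (λ s t → + α * s + + β * t)
      (trans (dot-⊗ q r p) (sym (det-cycle p q r))) (dot-⊗-left q r)) (trans (cong (λ t → + α * D + t) (*-zeroʳ (+ β))) (+-identityʳ _)))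

    along-q : ∀ {δ α β Q} → (+ δ) · Q ≡ ((+ α) · p) ⊕ ((+ β) · q) → + δ * dot (r ⊗ p) Q ≡ + β * D
    along-q {δ} {α} {β} {Q} eq = trans (along (r ⊗ p) {δ} {α} {β} {Q} eq) (trans (cong₂ (λ s t → + α * s + + β * t)
      (dot-⊗-right r p) (trans (dot-⊗ r p q) (det-cycle r p q))) (trans (cong (λ t → t + + β * D) (*-zeroʳ (+ α))) (+-identityˡ _)))

    along-r : ∀ {δ α β Q} → (+ δ) · Q ≡ ((+ α) · p) ⊕ ((+ β) · q) → + δ * dot (p ⊗ q) Q ≡ + 0
    along-r {δ} {α} {β} {Q} eq = trans (along (p ⊗ q) {δ} {α} {β} {Q} eq) (trans (cong₂ (λ s t → + α * s + + β * t)
      (dot-⊗-left p q) (dot-⊗-right p q)) (cong₂ _+_ (*-zeroʳ (+ α)) (*-zeroʳ (+ β))))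

    coefficient : ∀ {a b} → + a * D ≡ + b * D → a ≡ b
    coefficient {a} {b} h = +-injective (*-cancelʳ-≡ (+ a) (+ b) D h)

    dot-e₀ : ∀ u → dot u (e 0F) ≡ + 0
    dot-e₀ ⟨ a , b , c ⟩ = trans (cong₂ (λ s t → a * s + b * t + c * (z (v 0F) - z (v 0F))) (+-inverseʳ (x (v 0F))) (+-inverseʳ (y (v 0F))))
      (trans (cong (λ t → a * + 0 + b * + 0 + c * t) (+-inverseʳ (z (v 0F)))) (solve 3 (λ a b c →
        a :* con (+ 0) :+ b :* con (+ 0) :+ c :* con (+ 0) := con (+ 0)) refl a b c))

    -- Such a point of the facet would be a vertex, but the vertices in the plane have coefficients
    -- (0, 0), (δ, 0) and (0, δ), all excluded, and the fourth vertex is not in the plane.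
    no-point-small : ∀ δ α β Q → α ℕ.< δ → β ℕ.< δ → 0 ℕ.< α ℕ.+ β → α ℕ.+ β ℕ.≤ δ → (+ δ) · Q ≡ ((+ α) · p) ⊕ ((+ β) · q) → ⊥
    no-point-small δ α β Q α<δ β<δ 0<α+β α+β≤δ eq = vertex (proj₁ found) (subst (λ Q → (+ δ) · Q ≡ ((+ α) · p) ⊕ ((+ β) · q)) (proj₂ found) eq)
      where
      γ : ℕ
      γ = δ ℕ.∸ (α ℕ.+ β)
      δ≡ : γ ℕ.+ α ℕ.+ β ≡ δ
      δ≡ = trans (ℕ.+-assoc γ α β) (ℕ.m∸n+n≡m α+β≤δ)
      found : ∃ λ i → Q ≡ e i
      found = in-triangle α β γ Q (subst (λ δ → (+ δ) · Q ≡ ((+ α) · p) ⊕ ((+ β) · q)) (sym δ≡) eq)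
        (subst (0 ℕ.<_) (sym δ≡) (ℕ.≤-<-trans ℕ.z≤n α<δ))
      vertex : ∀ i → (+ δ) · e i ≡ ((+ α) · p) ⊕ ((+ β) · q) → ⊥
      vertex 0F h = ℕ.<-irrefl (cong₂ ℕ._+_ α≡0 β≡0) 0<α+β
        where
        zeroed : ∀ u → + δ * dot u (e 0F) ≡ + 0 * D
        zeroed u = trans (cong (λ t → + δ * t) (dot-e₀ u)) (trans (*-zeroʳ (+ δ)) (sym (*-zeroˡ D)))
        α≡0 : 0 ≡ α
        α≡0 = coefficient (trans (sym (zeroed (q ⊗ r))) (along-p {δ} {α} {β} {e 0F} h))
        β≡0 : 0 ≡ β
        β≡0 = coefficient (trans (sym (zeroed (r ⊗ p))) (along-q {δ} {α} {β} {e 0F} h))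
      vertex 1F h = ℕ.<-irrefl (coefficient (trans (sym (along-p {δ} {α} {β} {p} h))
        (cong (λ t → + δ * t) (trans (dot-⊗ q r p) (sym (det-cycle p q r)))))) α<δ
      vertex 2F h = ℕ.<-irrefl (coefficient (trans (sym (along-q {δ} {α} {β} {q} h))
        (cong (λ t → + δ * t) (trans (dot-⊗ r p q) (det-cycle r p q))))) β<δ
      vertex 3F h = ℕ.<-irrefl (sym (coefficient {δ} {0} (trans (cong (λ t → + δ * t) (sym (dot-⊗ p q r))) (trans (along-r {δ} {α} {β} {r} h) (sym (*-zeroˡ D))))))
        (ℕ.≤-<-trans ℕ.z≤n α<δ)

    no-point : ∀ δ α β Q → α ℕ.< δ → β ℕ.< δ → 0 ℕ.< α ℕ.+ β → (+ δ) · Q ≡ ((+ α) · p) ⊕ ((+ β) · q) → ⊥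
    no-point δ α β Q α<δ β<δ 0<α+β eq with α ℕ.+ β ℕ.≤? δ
    ... | yes small = no-point-small δ α β Q α<δ β<δ 0<α+β small eq
    ... | no large = no-point-small δ α′ β′ ((p ⊕ q) ⊖ Q) (ℕ.∸-monoʳ-< 0<α (ℕ.<⇒≤ α<δ)) (ℕ.∸-monoʳ-< 0<β (ℕ.<⇒≤ β<δ))
        (ℕ.<-≤-trans (ℕ.m<n⇒0<n∸m α<δ) (ℕ.m≤m+n α′ β′)) sum≤
        (combination-reflect {+ δ} {+ α} {+ α′} {+ β} {+ β′} p q Q (trans (cong +_ (sym α′+α)) (pos-+ α′ α)) (trans (cong +_ (sym β′+β)) (pos-+ β′ β)) eq)
      where
      α′ β′ : ℕ
      α′ = δ ℕ.∸ α
      β′ = δ ℕ.∸ β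
      δ<α+β : δ ℕ.< α ℕ.+ β
      δ<α+β = ℕ.≰⇒> large
      α′+α : α′ ℕ.+ α ≡ δ
      α′+α = ℕ.m∸n+n≡m (ℕ.<⇒≤ α<δ)
      β′+β : β′ ℕ.+ β ≡ δ
      β′+β = ℕ.m∸n+n≡m (ℕ.<⇒≤ β<δ)
      0<α : 0 ℕ.< α
      0<α = ℕ.+-cancelʳ-< β 0 α (ℕ.<-trans β<δ δ<α+β)
      0<β : 0 ℕ.< β
      0<β = ℕ.+-cancelˡ-< α 0 β (subst (ℕ._< α ℕ.+ β) (sym (ℕ.+-identityʳ α)) (ℕ.<-trans α<δ δ<α+β))
      sum≤ : α′ ℕ.+ β′ ℕ.≤ δ
      sum≤ = ℕ.+-cancelʳ-≤ (α ℕ.+ β) _ _ (ℕ.≤-trans (ℕ.≤-reflexive (trans (interchange α′ β′ α β) (cong₂ ℕ._+_ α′+α β′+β)))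
        (ℕ.+-monoʳ-≤ δ (ℕ.<⇒≤ δ<α+β)))
        where
        open import Data.Nat.Tactic.RingSolver using (solve-∀)
        interchange : ∀ a b c d → a ℕ.+ b ℕ.+ (c ℕ.+ d) ≡ a ℕ.+ c ℕ.+ (b ℕ.+ d)
        interchange = solve-∀

    -- After reduction modulo δ the only lattice point left in the half-open parallelogram is its
    -- corner 0, so both remainders vanish.
    saturated : ∀ δ .{{_ : ℕ.NonZero δ}} A B Q → (+ δ) · Q ≡ (A · p) ⊕ (B · q) → (+ δ ∣ A) × (+ δ ∣ B)
    saturated δ A B Q eq with A %ℕ δ ℕ.+ B %ℕ δ ℕ.≟ 0
    ... | yes h = div A (ℕ.m+n≡0⇒m≡0 (A %ℕ δ) h) , div B (ℕ.m+n≡0⇒n≡0 (A %ℕ δ) h)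
      where
      div : ∀ C → C %ℕ δ ≡ 0 → (+ δ ∣ C)
      div C c≡0 = divides (C /ℕ δ) (trans (a≡a%ℕn+[a/ℕn]*n C δ) (trans (cong (λ t → + t + C /ℕ δ * + δ) c≡0) (+-identityˡ _)))
    ... | no h = ⊥-elim (no-point δ (A %ℕ δ) (B %ℕ δ) ((Q ⊖ ((A /ℕ δ) · p)) ⊖ ((B /ℕ δ) · q)) (n%ℕd<d A δ) (n%ℕd<d B δ) (ℕ.n≢0⇒n>0 h)
        (combination-reduce {+ δ} {+ (A %ℕ δ)} {A} {A /ℕ δ} {+ (B %ℕ δ)} {B} {B /ℕ δ} p q Q (a≡a%ℕn+[a/ℕn]*n A δ) (a≡a%ℕn+[a/ℕn]*n B δ) eq))

    normal≢origin : p ⊗ q ≢ origin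
    normal≢origin h = nondegenerate (normal-origin p q r h)

    primitive-normal : ∃ λ f → dot (p ⊗ q) f ≡ + 1
    primitive-normal = primitive-dual (p ⊗ q) normal≢origin (λ δ → unit-divisor δ p q (saturated δ))

-- Reduction to `T a b n` with 0 ≤ a, b < n.

module NormalForms where

  open import Defs
  open Unimodular
  open AffineMaps
  open PrimitiveFacets
  open import Data.Fin using (suc)
  open import Data.Fin.Patterns using (0F; 1F; 2F; 3F)
  import Data.Fin.Permutation as Perm
  open import Data.Integer hiding (_⊖_)
  open import Data.Integer.DivMod using (_/ℕ_; _%ℕ_; a≡a%ℕn+[a/ℕn]*n; n%ℕd<d)
  open import Data.Integer.Properties
  open import Data.Integer.Solver using (module +-*-Solver)
  open import Data.Nat as ℕ using (ℕ)
  import Data.Nat.Properties as ℕ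
  open import Data.Product using (∃; _×_; _,_)
  open import Data.Sum using (_⊎_; inj₁; inj₂)
  open import Relation.Binary.PropositionalEquality
  open +-*-Solver using (solve; _:=_; _:+_; _:*_; _:-_; :-_; con)

  columns : Point → Point → Point → Matrix
  columns p q r = mat ⟨ x p , x q , x r ⟩ ⟨ y p , y q , y r ⟩ ⟨ z p , z q , z r ⟩

  apply-columns : ∀ p q r t → apply (columns p q r) t ≡ (x t · p) ⊕ ((y t · q) ⊕ (z t · r))
  apply-columns ⟨ a , b , c ⟩ ⟨ d , e , f ⟩ ⟨ g , h , i ⟩ ⟨ j , k , l ⟩ = point-≡ (row a d g) (row b e h) (row c f i)
    where
    row : ∀ a d g → a * j + d * k + g * l ≡ j * a + (k * d + l * g)
    row a d g = solve 6 (λ a d g j k l → a :* j :+ d :* k :+ g :* l := j :* a :+ (k :* d :+ l :* g)) refl a d g j k l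

  scalar-unit : ∀ p → (+ 1) · p ≡ p
  scalar-unit p = point-≡ (*-identityˡ (x p)) (*-identityˡ (y p)) (*-identityˡ (z p))

  scalar-zero : ∀ p → (+ 0) · p ≡ origin
  scalar-zero p = point-≡ (*-zeroˡ (x p)) (*-zeroˡ (y p)) (*-zeroˡ (z p))

  ⊕-identityˡ : ∀ p → origin ⊕ p ≡ p
  ⊕-identityˡ p = point-≡ (+-identityˡ (x p)) (+-identityˡ (y p)) (+-identityˡ (z p))

  ⊕-identityʳ : ∀ p → p ⊕ origin ≡ p
  ⊕-identityʳ p = point-≡ (+-identityʳ (x p)) (+-identityʳ (y p)) (+-identityʳ (z p))

  ⊖-⊕-cancel : ∀ p q → (p ⊖ q) ⊕ q ≡ p
  ⊖-⊕-cancel ⟨ a , b , c ⟩ ⟨ d , e , f ⟩ = point-≡ (cancel a d) (cancel b e) (cancel c f)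
    where
    cancel : ∀ a d → a - d + d ≡ a
    cancel = solve 2 (λ a d → a :- d :+ d := a) refl

  ⊕-opposite : ∀ p q → (p ⊕ q) ⊕ (origin ⊖ q) ≡ p
  ⊕-opposite ⟨ a , b , c ⟩ ⟨ d , e , f ⟩ = point-≡ (cancel a d) (cancel b e) (cancel c f)
    where
    cancel : ∀ a d → a + d + (+ 0 - d) ≡ a
    cancel = solve 2 (λ a d → a :+ d :+ (con (+ 0) :- d) := a) refl

  apply-cancel : ∀ M p q → apply M (p ⊕ q) ⊕ (origin ⊖ apply M q) ≡ apply M p
  apply-cancel M p q = trans (cong (_⊕ (origin ⊖ apply M q)) (apply-⊕ M p q)) (⊕-opposite (apply M p) (apply M q))

  basis-expand : ∀ t → (x t · ⟨ + 1 , + 0 , + 0 ⟩) ⊕ ((y t · ⟨ + 0 , + 1 , + 0 ⟩) ⊕ (z t · ⟨ + 0 , + 0 , + 1 ⟩)) ≡ t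
  basis-expand ⟨ a , b , c ⟩ = point-≡
    (solve 3 (λ a b c → a :* con (+ 1) :+ (b :* con (+ 0) :+ c :* con (+ 0)) := a) refl a b c)
    (solve 3 (λ a b c → a :* con (+ 0) :+ (b :* con (+ 1) :+ c :* con (+ 0)) := b) refl a b c)
    (solve 3 (λ a b c → a :* con (+ 0) :+ (b :* con (+ 0) :+ c :* con (+ 1)) := c) refl a b c)

  -- The rows of M are the basis dual to p, q, f, sheared by multiples of p ⊗ q.
  module Frame (p q f : Point) (pqf : dot (p ⊗ q) f ≡ + 1) (ε s t : ℤ) (ε² : ε * ε ≡ + 1) where

    w : Point
    w = p ⊗ q

    M : Matrix
    M = mat ((q ⊗ f) ⊖ (s · w)) ((f ⊗ p) ⊖ (t · w)) (ε · w)

    -- The shears move the image of f away from the third axis. `g` compensates for them and `h`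
    -- also for the sign, so M sends p, q, h to the standard basis.
    g h : Point
    g = f ⊕ ((s · p) ⊕ (t · q))
    h = ε · g

    N : Matrix
    N = columns p q h

    det≡1 : det3 p q f ≡ + 1
    det≡1 = trans (sym (dot-⊗ p q f)) pqf

    detM-M : detM M ≡ ε
    detM-M = trans (det-shear (q ⊗ f) s (f ⊗ p) t ε w) (trans (cong (ε *_) (trans (det-cofactor p q f) (cong₂ _*_ det≡1 det≡1))) (*-identityʳ ε))

    apply-M : ∀ r {a b c} → dot (q ⊗ f) r ≡ a → dot (f ⊗ p) r ≡ b → dot w r ≡ c →
              apply M r ≡ ⟨ a - s * c , b - t * c , ε * c ⟩
    apply-M r refl refl refl = point-≡ (dot-shear (q ⊗ f) s w r) (dot-shear (f ⊗ p) t w r) (dot-scale ε w r)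

    private
      minus-zero : ∀ a s → a - s * + 0 ≡ a
      minus-zero = solve 2 (λ a s → a :- s :* con (+ 0) := a) refl

    M-p : apply M p ≡ ⟨ + 1 , + 0 , + 0 ⟩
    M-p = trans (apply-M p (trans (dot-⊗ q f p) (trans (sym (det-cycle p q f)) det≡1)) (dot-⊗-right f p) (dot-⊗-left p q))
      (point-≡ (minus-zero (+ 1) s) (minus-zero (+ 0) t) (*-zeroʳ ε))

    M-q : apply M q ≡ ⟨ + 0 , + 1 , + 0 ⟩
    M-q = trans (apply-M q (dot-⊗-left q f) (trans (dot-⊗ f p q) (trans (det-cycle f p q) det≡1)) (dot-⊗-right p q))
      (point-≡ (minus-zero (+ 0) s) (minus-zero (+ 1) t) (*-zeroʳ ε))

    M-f : apply M f ≡ ⟨ - s , - t , ε ⟩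
    M-f = trans (apply-M f (dot-⊗-right q f) (dot-⊗-left f p) pqf) (point-≡ (minus-one s) (minus-one t) (*-identityʳ ε))
      where
      minus-one : ∀ s → + 0 - s * + 1 ≡ - s
      minus-one = solve 1 (λ s → con (+ 0) :- s :* con (+ 1) := :- s) refl

    M-g : apply M g ≡ ⟨ + 0 , + 0 , ε ⟩
    M-g = begin
      apply M g
        ≡⟨ trans (apply-⊕ M f ((s · p) ⊕ (t · q))) (cong (apply M f ⊕_) (apply-⊕ M (s · p) (t · q))) ⟩
      apply M f ⊕ (apply M (s · p) ⊕ apply M (t · q))
        ≡⟨ cong₂ _⊕_ M-f (cong₂ _⊕_ (trans (apply-· M s p) (cong (s ·_) M-p)) (trans (apply-· M t q) (cong (t ·_) M-q))) ⟩
      ⟨ - s , - t , ε ⟩ ⊕ ((s · ⟨ + 1 , + 0 , + 0 ⟩) ⊕ (t · ⟨ + 0 , + 1 , + 0 ⟩))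
        ≡⟨ point-≡ (solve 2 (λ s t → (:- s) :+ (s :* con (+ 1) :+ t :* con (+ 0)) := con (+ 0)) refl s t)
                   (solve 2 (λ s t → (:- t) :+ (s :* con (+ 0) :+ t :* con (+ 1)) := con (+ 0)) refl s t)
                   (solve 3 (λ s t ε → ε :+ (s :* con (+ 0) :+ t :* con (+ 0)) := ε) refl s t ε) ⟩
      ⟨ + 0 , + 0 , ε ⟩ ∎
      where open ≡-Reasoning

    M-h : apply M h ≡ ⟨ + 0 , + 0 , + 1 ⟩
    M-h = trans (apply-· M ε g) (trans (cong (ε ·_) M-g) (point-≡ (*-zeroʳ ε) (*-zeroʳ ε) ε²))

    M-N : ∀ u → apply M (apply N u) ≡ u
    M-N u = begin
      apply M (apply N u)
        ≡⟨ cong (apply M) (apply-columns p q h u) ⟩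
      apply M ((x u · p) ⊕ ((y u · q) ⊕ (z u · h)))
        ≡⟨ trans (apply-⊕ M (x u · p) ((y u · q) ⊕ (z u · h))) (cong (apply M (x u · p) ⊕_) (apply-⊕ M (y u · q) (z u · h))) ⟩
      apply M (x u · p) ⊕ (apply M (y u · q) ⊕ apply M (z u · h))
        ≡⟨ cong₂ _⊕_ (trans (apply-· M (x u) p) (cong (x u ·_) M-p))
             (cong₂ _⊕_ (trans (apply-· M (y u) q) (cong (y u ·_) M-q)) (trans (apply-· M (z u) h) (cong (z u ·_) M-h))) ⟩
      (x u · ⟨ + 1 , + 0 , + 0 ⟩) ⊕ ((y u · ⟨ + 0 , + 1 , + 0 ⟩) ⊕ (z u · ⟨ + 0 , + 0 , + 1 ⟩))
        ≡⟨ basis-expand u ⟩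
      u ∎
      where open ≡-Reasoning

    module _ (r : Point) {a b n : ℤ} (a≡ : dot (q ⊗ f) r ≡ a + s * (ε * n)) (b≡ : dot (f ⊗ p) r ≡ b + t * (ε * n))
      (n≡ : dot w r ≡ ε * n) where

      private
        absorb : ∀ a s c → a + s * c - s * c ≡ a
        absorb = solve 3 (λ a s c → a :+ s :* c :- s :* c := a) refl

        ε²n : ε * (ε * n) ≡ n
        ε²n = trans (sym (*-assoc ε ε n)) (trans (cong (_* n) ε²) (*-identityˡ n))

      M-r : apply M r ≡ ⟨ a , b , n ⟩
      M-r = trans (apply-M r a≡ b≡ n≡) (point-≡ (absorb a s (ε * n)) (absorb b t (ε * n)) ε²n)

      N-abn : apply N ⟨ a , b , n ⟩ ≡ r
      N-abn = begin
        apply N ⟨ a , b , n ⟩                  ≡⟨ apply-columns p q h ⟨ a , b , n ⟩ ⟩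
        (a · p) ⊕ ((b · q) ⊕ (n · h))          ≡⟨ expand p q f ⟩
        ((a + s * (ε * n)) · p) ⊕ (((b + t * (ε * n)) · q) ⊕ ((ε * n) · f))
          ≡⟨ sym (cong₂ (λ α v → (α · p) ⊕ v) a≡ (cong₂ (λ β γ → (β · q) ⊕ (γ · f)) b≡ n≡)) ⟩
        (dot (q ⊗ f) r · p) ⊕ ((dot (f ⊗ p) r · q) ⊕ (dot w r · f)) ≡⟨ cramer p q f r ⟨
        det3 p q f · r                         ≡⟨ cong (_· r) det≡1 ⟩
        (+ 1) · r                              ≡⟨ scalar-unit r ⟩
        r                                      ∎
        where
        open ≡-Reasoning
        row : ∀ p q f → a * p + (b * q + n * (ε * (f + (s * p + t * q)))) ≡ (a + s * (ε * n)) * p + ((b + t * (ε * n)) * q + (ε * n) * f)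
        row p q f = solve 9 (λ a b n s t ε p q f → a :* p :+ (b :* q :+ n :* (ε :* (f :+ (s :* p :+ t :* q))))
          := (a :+ s :* (ε :* n)) :* p :+ ((b :+ t :* (ε :* n)) :* q :+ (ε :* n) :* f)) refl a b n s t ε p q f
        expand : ∀ p q f → (a · p) ⊕ ((b · q) ⊕ (n · (ε · (f ⊕ ((s · p) ⊕ (t · q))))))
                         ≡ ((a + s * (ε * n)) · p) ⊕ (((b + t * (ε * n)) · q) ⊕ ((ε * n) · f))
        expand p q f = point-≡ (row (x p) (x q) (x f)) (row (y p) (y q) (y f)) (row (z p) (z q) (z f))

    N-origin : apply N origin ≡ origin
    N-origin = trans (apply-columns p q h origin) (trans (cong₂ _⊕_ (scalar-zero p) (cong₂ _⊕_ (scalar-zero q) (scalar-zero h))) refl)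

    N-e₁ : apply N ⟨ + 1 , + 0 , + 0 ⟩ ≡ p
    N-e₁ = trans (apply-columns p q h ⟨ + 1 , + 0 , + 0 ⟩) (trans (cong₂ _⊕_ (scalar-unit p) (cong₂ _⊕_ (scalar-zero q) (scalar-zero h))) (⊕-identityʳ p))

    N-e₂ : apply N ⟨ + 0 , + 1 , + 0 ⟩ ≡ q
    N-e₂ = trans (apply-columns p q h ⟨ + 0 , + 1 , + 0 ⟩) (trans (cong₂ _⊕_ (scalar-zero p) (cong₂ _⊕_ (scalar-unit q) (scalar-zero h)))
      (trans (⊕-identityˡ (q ⊕ origin)) (⊕-identityʳ q)))

  record NormalForm (v : Tetra) : Set where
    constructor normal
    field
      n a b : ℕ
      n>0 : 0 ℕ.< n
      a<n : a ℕ.< n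
      b<n : b ℕ.< n
      equivalent : Equivalent v (T (+ a) (+ b) (+ n))
      one-point : OnePoint (T (+ a) (+ b) (+ n))

  unit-square : ∀ {ε} → ε ≡ + 1 ⊎ ε ≡ - (+ 1) → ε * ε ≡ + 1
  unit-square (inj₁ refl) = refl
  unit-square (inj₂ refl) = refl

  sign-abs : ∀ D → ∃ λ ε → (ε ≡ + 1 ⊎ ε ≡ - (+ 1)) × (D ≡ ε * + ∣ D ∣)
  sign-abs (+ n) = + 1 , inj₁ refl , sym (*-identityˡ (+ n))
  sign-abs -[1+ n ] = - (+ 1) , inj₂ refl , sym (-1*i≡-i (+ ℕ.suc n))

  T-nondegenerate : ∀ a b n → n ≢ + 0 → NonDegenerate (T a b n)
  T-nondegenerate a b n n≢0 h = n≢0 (trans (sym (determinant a b n)) h)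
    where
    determinant : ∀ a b n → det3 (⟨ + 1 , + 0 , + 0 ⟩ ⊖ origin) (⟨ + 0 , + 1 , + 0 ⟩ ⊖ origin) (⟨ a , b , n ⟩ ⊖ origin) ≡ n
    determinant = solve 3 (λ a b n → con (+ 1) :* (con (+ 1) :* (n :- con (+ 0)) :- con (+ 0) :* (b :- con (+ 0)))
      :- con (+ 0) :* (con (+ 0) :* (n :- con (+ 0)) :- con (+ 0) :* (a :- con (+ 0)))
      :+ con (+ 0) :* (con (+ 0) :* (b :- con (+ 0)) :- con (+ 1) :* (a :- con (+ 0))) := n) refl

  -- The fourth vertex has height ε n over the facet, so a shear by quotient times ε changes a
  -- coordinate by quotient times n.
  signed-remainder : ∀ {ε} → ε * ε ≡ + 1 → ∀ n .{{_ : ℕ.NonZero n}} A → A ≡ + (A %ℕ n) + (A /ℕ n * ε) * (ε * + n)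
  signed-remainder {ε} ε² n A = trans (a≡a%ℕn+[a/ℕn]*n A n) (cong (λ w → + (A %ℕ n) + w) (sym (begin
    A /ℕ n * ε * (ε * + n)      ≡⟨ rearrange (A /ℕ n) ε (+ n) ⟩
    A /ℕ n * (ε * ε * + n)      ≡⟨ cong (λ u → A /ℕ n * (u * + n)) ε² ⟩
    A /ℕ n * (+ 1 * + n)        ≡⟨ cong (λ w → A /ℕ n * w) (*-identityˡ (+ n)) ⟩
    A /ℕ n * + n                ∎)))
    where
    open ≡-Reasoning
    rearrange : ∀ a ε n → a * ε * (ε * n) ≡ a * (ε * ε * n)
    rearrange = solve 3 (λ a ε n → a :* ε :* (ε :* n) := a :* (ε :* ε :* n)) refl

  normal-form : ∀ v → OnePoint v → NormalForm v
  normal-form v one@((nondegenerate , clean) , _) =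
    build (primitive-normal) (sign-abs (dot (p ⊗ q) r))
    where
    open CleanFacet v nondegenerate clean
    build : (∃ λ f → dot (p ⊗ q) f ≡ + 1) → (∃ λ ε → (ε ≡ + 1 ⊎ ε ≡ - (+ 1)) × (dot (p ⊗ q) r ≡ ε * + ∣ dot (p ⊗ q) r ∣)) → NormalForm v
    build (f , pqf) (ε , unit , n≡) =
      normal n a b n>0 (n%ℕd<d (dot (q ⊗ f) r) n) (n%ℕd<d (dot (f ⊗ p) r) n)
        (M , u , Perm.id , subst (λ δ → δ ≡ + 1 ⊎ δ ≡ - (+ 1)) (sym detM-M) unit , forward)
        (OnePoint-transfer {v} {T (+ a) (+ b) (+ n)} {M} {u} {N} {v 0F} forward backward round-trip
          (T-nondegenerate (+ a) (+ b) (+ n) (λ h → ℕ.<-irrefl (sym (+-injective h)) n>0)) one)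
      where
      n : ℕ
      n = ∣ dot (p ⊗ q) r ∣
      n>0 : 0 ℕ.< n
      n>0 = ℕ.n≢0⇒n>0 λ n≡0 → nondegenerate (trans (sym (dot-⊗ p q r)) (∣i∣≡0⇒i≡0 n≡0))
      instance
        n≢0 : ℕ.NonZero n
        n≢0 = ℕ.>-nonZero n>0
      a b : ℕ
      a = dot (q ⊗ f) r %ℕ n
      b = dot (f ⊗ p) r %ℕ n
      ε² : ε * ε ≡ + 1
      ε² = unit-square unit
      s t : ℤ
      -- These shears leave exactly the remainders a and b as the first two coordinates of the
      -- fourth vertex.
      s = dot (q ⊗ f) r /ℕ n * ε
      t = dot (f ⊗ p) r /ℕ n * ε
      open Frame p q f pqf ε s t ε²
      u : Point
      u = origin ⊖ apply M (v 0F)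
      M-e : ∀ i → apply M (e i) ≡ T (+ a) (+ b) (+ n) i
      M-e 0F = trans (cong (apply M) (⊖-self (v 0F))) (M-origin M)
        where
        ⊖-self : ∀ p → p ⊖ p ≡ origin
        ⊖-self p = point-≡ (+-inverseʳ (x p)) (+-inverseʳ (y p)) (+-inverseʳ (z p))
        M-origin : ∀ M → apply M origin ≡ origin
        M-origin (mat r₀ r₁ r₂) = point-≡ (null r₀) (null r₁) (null r₂)
          where
          null : ∀ r → dot r origin ≡ + 0
          null ⟨ a , b , c ⟩ = solve 3 (λ a b c → a :* con (+ 0) :+ b :* con (+ 0) :+ c :* con (+ 0) := con (+ 0)) refl a b c
      M-e 1F = M-p
      M-e 2F = M-q
      M-e 3F = M-r r (signed-remainder ε² n (dot (q ⊗ f) r)) (signed-remainder ε² n (dot (f ⊗ p) r)) n≡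
      N-T : ∀ i → apply N (T (+ a) (+ b) (+ n) i) ≡ e i
      N-T 0F = trans N-origin (sym (point-≡ (+-inverseʳ (x (v 0F))) (+-inverseʳ (y (v 0F))) (+-inverseʳ (z (v 0F)))))
      N-T 1F = N-e₁
      N-T 2F = N-e₂
      N-T 3F = N-abn r (signed-remainder ε² n (dot (q ⊗ f) r)) (signed-remainder ε² n (dot (f ⊗ p) r)) n≡
      forward : AffineMap M u v (T (+ a) (+ b) (+ n))
      forward i = trans (cong (λ P → apply M P ⊕ u) (sym (⊖-⊕-cancel (v i) (v 0F)))) (trans (apply-cancel M (e i) (v 0F)) (M-e i))
      backward : AffineMap N (v 0F) (T (+ a) (+ b) (+ n)) v
      backward i = trans (cong (_⊕ v 0F) (N-T i)) (⊖-⊕-cancel (v i) (v 0F))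
      round-trip : ∀ P → apply M (apply N P ⊕ v 0F) ⊕ u ≡ P
      round-trip P = trans (apply-cancel M (apply N P) (v 0F)) (M-N P)

-- Lattice points of the tetrahedron as residue vectors.

module InteriorResidue where

  open FloorSearch
  open ResidueClasses
  open Enumeration using (weights)
  open import Defs
  open Unimodular using (point-≡)
  open import Data.Empty using (⊥; ⊥-elim)
  open import Data.Fin using (Fin; suc)
  open import Data.Fin.Patterns using (0F; 1F; 2F; 3F)
  open import Data.Integer as ℤ using (ℤ; +_; -[1+_])
  import Data.Integer.Properties as ℤ
  open import Data.Integer.Solver using (module +-*-Solver)
  open import Data.Nat
  open import Data.Nat.Properties
  open import Data.Nat.DivMod
  open import Data.Nat.Divisibility
  open import Data.Nat.Tactic.RingSolver using (solve-∀)
  open import Data.Product using (∃; _×_; _,_; proj₁; proj₂)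
  open import Relation.Binary.PropositionalEquality
  open +-*-Solver using (solve; _:=_; _:+_; _:*_; _:-_; con)

  part<sum4 : ∀ (f : Fin 4 → ℕ) → (∀ i → 0 < f i) → ∀ i → f i < sum4 f
  part<sum4 f pos 0F = <-≤-trans (m<m+n (f 0F) (pos 1F)) (≤-trans (m≤m+n _ (f 2F)) (m≤m+n _ (f 3F)))
  part<sum4 f pos 1F = <-≤-trans (m<n+m (f 1F) (pos 0F)) (≤-trans (m≤m+n _ (f 2F)) (m≤m+n _ (f 3F)))
  part<sum4 f pos 2F = <-≤-trans (m<n+m (f 2F) (<-≤-trans (pos 0F) (m≤m+n (f 0F) (f 1F)))) (m≤m+n _ (f 3F))
  part<sum4 f pos 3F = m<n+m (f 3F) (<-≤-trans (pos 0F) (≤-trans (m≤m+n (f 0F) (f 1F)) (m≤m+n _ (f 2F))))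

  weights-sum : ∀ n .{{_ : NonZero n}} a b → a < n → b < n → sum4 (weights n a b) ≡ 3 * n
  weights-sum n a b a<n b<n = begin
    a + b + pred n + (n ∸ a) + (n ∸ b) + 1       ≡⟨ rearrange a b (pred n) (n ∸ a) (n ∸ b) ⟩
    (a + (n ∸ a)) + (b + (n ∸ b)) + suc (pred n) ≡⟨ cong₂ _+_ (cong₂ _+_ (m+[n∸m]≡n (<⇒≤ a<n)) (m+[n∸m]≡n (<⇒≤ b<n))) (suc-pred n) ⟩
    n + n + n                                    ≡⟨ triple n ⟩
    3 * n                                        ∎
    where
    open ≡-Reasoning
    rearrange : ∀ a b m c d → a + b + m + c + d + 1 ≡ (a + c) + (b + d) + suc m
    rearrange = solve-∀
    triple : ∀ n → n + n + n ≡ 3 * n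
    triple = solve-∀

  -- An integer equal to n times a weight in [0, 1) is a reduced residue modulo n.
  ratio : ∀ {l K μ n} → 0 < K → μ < K → 0 < n → + K ℤ.* l ≡ + μ ℤ.* + n → ∃ λ L → l ≡ + L × L < n
  ratio {+ L} {K} {μ} {n} 0<K μ<K 0<n eq = L , refl , *-cancelˡ-< K L n (subst (_< K * n) (sym L≡) (*-monoˡ-< n {{>-nonZero 0<n}} μ<K))
    where
    L≡ : K * L ≡ μ * n
    L≡ = ℤ.+-injective (trans (ℤ.pos-* K L) (trans eq (sym (ℤ.pos-* μ n))))
  ratio { -[1+ m ]} {suc K} {μ} {n} 0<K μ<K 0<n eq with trans eq (sym (ℤ.pos-* μ n))
  ... | ()

  remainder-ℤ : ∀ n .{{_ : NonZero n}} w L X → L < n → + w ≡ + L ℤ.+ X ℤ.* + n → w % n ≡ L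
  remainder-ℤ n w L (+ k) L<n eq = trans (cong (_% n) w≡) (trans ([m+kn]%n≡m%n L k n) (m<n⇒m%n≡m L<n))
    where
    w≡ : w ≡ L + k * n
    w≡ = ℤ.+-injective (trans eq (trans (cong (λ t → + L ℤ.+ t) (sym (ℤ.pos-* k n))) (sym (ℤ.pos-+ L (k * n)))))
  remainder-ℤ n w L -[1+ k ] L<n eq = ⊥-elim (<-irrefl refl (<-≤-trans L<n (≤-trans (m≤m+n n (k * n)) (≤-trans (m≤n+m (suc k * n) w) (≤-reflexive w+≡)))))
    where
    w+≡ : w + suc k * n ≡ L
    w+≡ = ℤ.+-injective (trans (ℤ.pos-+ w (suc k * n)) (trans (cong₂ ℤ._+_ eq (ℤ.pos-* (suc k) n))
      (trans (ℤ.+-assoc (+ L) (-[1+ k ] ℤ.* + n) (+ suc k ℤ.* + n)) (trans (cong (λ t → + L ℤ.+ t) (cancel (+ suc k) (+ n))) (ℤ.+-identityʳ (+ L))))))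
      where
      cancel : ∀ k n → ℤ.- k ℤ.* n ℤ.+ k ℤ.* n ≡ + 0
      cancel k n = trans (cong (ℤ._+ k ℤ.* n) (sym (ℤ.neg-distribˡ-* k n))) (ℤ.+-inverseˡ (k ℤ.* n))

  module _ (μ : Fin 4 → ℕ) (a b n : ℕ) where

    combo-T : combo4 μ (T (+ a) (+ b) (+ n)) ≡ ⟨ + (μ 1F + μ 3F * a) , + (μ 2F + μ 3F * b) , + (μ 3F * n) ⟩
    combo-T = point-≡
      (trans (solve 5 (λ m₀ m₁ m₂ m₃ a → m₀ :* con (+ 0) :+ (m₁ :* con (+ 1) :+ (m₂ :* con (+ 0) :+ m₃ :* a)) := m₁ :+ m₃ :* a)
        refl (+ μ 0F) (+ μ 1F) (+ μ 2F) (+ μ 3F) (+ a)) (trans (cong (λ t → + μ 1F ℤ.+ t) (sym (ℤ.pos-* (μ 3F) a))) (sym (ℤ.pos-+ (μ 1F) (μ 3F * a)))))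
      (trans (solve 5 (λ m₀ m₁ m₂ m₃ b → m₀ :* con (+ 0) :+ (m₁ :* con (+ 0) :+ (m₂ :* con (+ 1) :+ m₃ :* b)) := m₂ :+ m₃ :* b)
        refl (+ μ 0F) (+ μ 1F) (+ μ 2F) (+ μ 3F) (+ b)) (trans (cong (λ t → + μ 2F ℤ.+ t) (sym (ℤ.pos-* (μ 3F) b))) (sym (ℤ.pos-+ (μ 2F) (μ 3F * b)))))
      (trans (solve 5 (λ m₀ m₁ m₂ m₃ n → m₀ :* con (+ 0) :+ (m₁ :* con (+ 0) :+ (m₂ :* con (+ 0) :+ m₃ :* n)) := m₃ :* n)
        refl (+ μ 0F) (+ μ 1F) (+ μ 2F) (+ μ 3F) (+ n)) (sym (ℤ.pos-* (μ 3F) n)))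

  module OnePointResidues (n : ℕ) .{{_ : NonZero n}} (a b : ℕ) (a<n : a < n) (b<n : b < n)
    (one : OnePoint (T (+ a) (+ b) (+ n))) where

    c : Fin 4 → ℕ
    c = weights n a b

    n∣c : n ∣ sum4 c
    n∣c = divides 3 (weights-sum n a b a<n b<n)

    open Residues n c n∣c refl

    n>0 : 0 < n
    n>0 = >-nonZero⁻¹ n

    P : Point
    P = proj₁ (proj₂ one)

    -- As `n ∸ a` stands for - a, this makes the first coordinate (μ₁ + μ₃ a) / n of the point with
    -- weights res k i / n an integer; with b in place of a it serves the second coordinate.
    complement-∣ : ∀ k a → a < n → n ∣ (k * (n ∸ a)) % n + (k % n) * a
    complement-∣ k a a<n = ≋0⇒∣ (trans (+-cong-≋ {(k * (n ∸ a)) % n} {k * (n ∸ a)} {(k % n) * a} {k * a} (mod-≋ _)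
        (trans (≡⇒≋ (*-comm (k % n) a)) (trans (*-congˡ-≋ a {k % n} {k} (mod-≋ k)) (≡⇒≋ (*-comm a k)))))
      (∣⇒≋0 (divides k (trans (sym (*-distribˡ-+ k (n ∸ a) a)) (cong (k *_) (m∸n+n≡m (<⇒≤ a<n)))))))

    scaled : ∀ {q e} → e ≡ q * n → + n ℤ.* + q ≡ + e
    scaled {q} {e} h = trans (sym (ℤ.pos-* n q)) (cong +_ (trans (*-comm n q) (sym h)))

    -- The numbers res k i / n are the weights of a lattice point. None of them is 1, so the point
    -- is not a vertex, and cleanness rules out a zero weight. It is thus the interior point, whose
    -- height is the last residue.
    unique : ∀ {Z} → ℤ.+ Z ≡ z P → ∀ k → S k ≡ n → (∀ i → 0 < res k i) × k % n ≡ Z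
    unique {Z} Z≡ k Sk≡n = from (complement-∣ k a a<n) (complement-∣ k b b<n)
      where
      μ : Fin 4 → ℕ
      μ = res k
      μ₃ : μ 3F ≡ k % n
      μ₃ = res-last k
      from : n ∣ (k * (n ∸ a)) % n + (k % n) * a → n ∣ (k * (n ∸ b)) % n + (k % n) * b → (∀ i → 0 < μ i) × k % n ≡ Z
      from (divides s es) (divides t et) = positive , interior
        where
        Q : Point
        Q = ⟨ + s , + t , + μ 3F ⟩
        ex : μ 1F + μ 3F * a ≡ s * n
        ex = trans (cong (λ m → μ 1F + m * a) μ₃) es
        ey : μ 2F + μ 3F * b ≡ t * n
        ey = trans (cong (λ m → μ 2F + m * b) μ₃) et
        bary : Barycentric (T (+ a) (+ b) (+ n)) Q n μ
        bary = n>0 , Sk≡n , trans (point-≡ (scaled ex) (scaled ey) (scaled refl)) (sym (combo-T μ a b n))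
        not-vertex : ∀ j → Q ≡ T (+ a) (+ b) (+ n) j → ⊥
        not-vertex 0F e = <-irrefl (trans (sym (+-identityʳ _)) (trans (sym total) Sk≡n)) (res<n k 0F)
          where
          m₃≡0 : μ 3F ≡ 0
          m₃≡0 = ℤ.+-injective (cong z e)
          m₁≡0 : μ 1F ≡ 0
          m₁≡0 = m+n≡0⇒m≡0 _ (trans ex (cong (_* n) (ℤ.+-injective (cong x e))))
          m₂≡0 : μ 2F ≡ 0
          m₂≡0 = m+n≡0⇒m≡0 _ (trans ey (cong (_* n) (ℤ.+-injective (cong y e))))
          total : sum4 μ ≡ μ 0F + 0
          total = trans (cong₂ (λ s t → μ 0F + s + t + μ 3F) m₁≡0 m₂≡0) (trans (cong (λ u → μ 0F + 0 + 0 + u) m₃≡0) (drop (μ 0F)))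
            where
            drop : ∀ m → m + 0 + 0 + 0 ≡ m + 0
            drop = solve-∀
        not-vertex 1F e = <-irrefl (trans (sym (+-identityʳ _)) (trans (cong (λ u → μ 1F + u * a) (sym (ℤ.+-injective (cong z e))))
          (trans ex (trans (cong (_* n) (ℤ.+-injective (cong x e))) (+-identityʳ n))))) (res<n k 1F)
        not-vertex 2F e = <-irrefl (trans (sym (+-identityʳ _)) (trans (cong (λ u → μ 2F + u * b) (sym (ℤ.+-injective (cong z e))))
          (trans ey (trans (cong (_* n) (ℤ.+-injective (cong y e))) (+-identityʳ n))))) (res<n k 2F)
        not-vertex 3F e = <-irrefl (ℤ.+-injective (cong z e)) (res<n k 3F)
        positive : ∀ i → 0 < μ i
        positive i = n≢0⇒n>0 λ h → let (j , e) = proj₂ (proj₁ one) Q (n , μ , bary , i , h) in not-vertex j e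
        interior : k % n ≡ Z
        interior = ℤ.+-injective (trans (cong +_ (sym μ₃)) (trans (cong z (proj₂ (proj₂ (proj₂ one)) Q (n , μ , bary , positive))) (sym Z≡)))

    -- In the other direction, n times the weights of P are the integers l₀, l₁, l₂ and pz, and they
    -- are the residues of pz times c. The index is the height of P.
    interior-residue : ∃ λ Z → ℤ.+ Z ≡ z P × Z < n × S Z ≡ n
    interior-residue = from (proj₁ (proj₂ (proj₂ one)))
      where
      px py pz : ℤ
      px = x P
      py = y P
      pz = z P
      from : InInterior (T (+ a) (+ b) (+ n)) P → ∃ λ Z → ℤ.+ Z ≡ z P × Z < n × S Z ≡ n
      from (K , μ , (0<K , Σμ , e) , pos) = conclude r₀ r₁ r₂ r₃
        where
        eq : (+ K) · P ≡ ⟨ + (μ 1F + μ 3F * a) , + (μ 2F + μ 3F * b) , + (μ 3F * n) ⟩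
        eq = trans e (combo-T μ a b n)
        ex : + K ℤ.* px ≡ + μ 1F ℤ.+ + μ 3F ℤ.* + a
        ex = trans (cong x eq) (trans (ℤ.pos-+ (μ 1F) (μ 3F * a)) (cong (λ t → + μ 1F ℤ.+ t) (ℤ.pos-* (μ 3F) a)))
        ey : + K ℤ.* py ≡ + μ 2F ℤ.+ + μ 3F ℤ.* + b
        ey = trans (cong y eq) (trans (ℤ.pos-+ (μ 2F) (μ 3F * b)) (cong (λ t → + μ 2F ℤ.+ t) (ℤ.pos-* (μ 3F) b)))
        ez : + K ℤ.* pz ≡ + μ 3F ℤ.* + n
        ez = trans (cong z eq) (ℤ.pos-* (μ 3F) n)
        K≡ : + K ≡ + μ 0F ℤ.+ + μ 1F ℤ.+ + μ 2F ℤ.+ + μ 3F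
        K≡ = trans (cong +_ (sym Σμ)) (trans (ℤ.pos-+ (μ 0F + μ 1F + μ 2F) (μ 3F)) (cong (ℤ._+ + μ 3F)
               (trans (ℤ.pos-+ (μ 0F + μ 1F) (μ 2F)) (cong (ℤ._+ + μ 2F) (ℤ.pos-+ (μ 0F) (μ 1F))))))
        μ<K : ∀ i → μ i < K
        μ<K i = subst (μ i <_) Σμ (part<sum4 μ pos i)
        l₀ l₁ l₂ : ℤ
        l₁ = + n ℤ.* px ℤ.- + a ℤ.* pz
        l₂ = + n ℤ.* py ℤ.- + b ℤ.* pz
        l₀ = + n ℤ.- l₁ ℤ.- l₂ ℤ.- pz
        side : ∀ {π m e} → + K ℤ.* π ≡ + m ℤ.+ + μ 3F ℤ.* + e → + K ℤ.* (+ n ℤ.* π ℤ.- + e ℤ.* pz) ≡ + m ℤ.* + n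
        side {π} {m} {e} h = begin
          + K ℤ.* (+ n ℤ.* π ℤ.- + e ℤ.* pz)
            ≡⟨ solve 5 (λ K n π e p → K :* (n :* π :- e :* p) := n :* (K :* π) :- e :* (K :* p)) refl (+ K) (+ n) π (+ e) pz ⟩
          + n ℤ.* (+ K ℤ.* π) ℤ.- + e ℤ.* (+ K ℤ.* pz)
            ≡⟨ cong₂ (λ u v → + n ℤ.* u ℤ.- + e ℤ.* v) h ez ⟩
          + n ℤ.* (+ m ℤ.+ + μ 3F ℤ.* + e) ℤ.- + e ℤ.* (+ μ 3F ℤ.* + n)
            ≡⟨ solve 4 (λ n m u e → n :* (m :+ u :* e) :- e :* (u :* n) := m :* n) refl (+ n) (+ m) (+ μ 3F) (+ e) ⟩
          + m ℤ.* + n ∎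
          where open ≡-Reasoning
        base : + K ℤ.* l₀ ≡ + μ 0F ℤ.* + n
        base = begin
          + K ℤ.* l₀
            ≡⟨ solve 5 (λ K n u v p → K :* (n :- u :- v :- p) := K :* n :- K :* u :- K :* v :- K :* p) refl (+ K) (+ n) l₁ l₂ pz ⟩
          + K ℤ.* + n ℤ.- + K ℤ.* l₁ ℤ.- + K ℤ.* l₂ ℤ.- + K ℤ.* pz
            ≡⟨ cong₂ (λ u v → u ℤ.* + n ℤ.- v ℤ.- + K ℤ.* l₂ ℤ.- + K ℤ.* pz) K≡ (side {px} {μ 1F} {a} ex) ⟩
          (+ μ 0F ℤ.+ + μ 1F ℤ.+ + μ 2F ℤ.+ + μ 3F) ℤ.* + n ℤ.- + μ 1F ℤ.* + n ℤ.- + K ℤ.* l₂ ℤ.- + K ℤ.* pz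
            ≡⟨ cong₂ (λ u v → (+ μ 0F ℤ.+ + μ 1F ℤ.+ + μ 2F ℤ.+ + μ 3F) ℤ.* + n ℤ.- + μ 1F ℤ.* + n ℤ.- u ℤ.- v) (side {py} {μ 2F} {b} ey) ez ⟩
          (+ μ 0F ℤ.+ + μ 1F ℤ.+ + μ 2F ℤ.+ + μ 3F) ℤ.* + n ℤ.- + μ 1F ℤ.* + n ℤ.- + μ 2F ℤ.* + n ℤ.- + μ 3F ℤ.* + n
            ≡⟨ solve 5 (λ u v w t n → (u :+ v :+ w :+ t) :* n :- v :* n :- w :* n :- t :* n := u :* n) refl (+ μ 0F) (+ μ 1F) (+ μ 2F) (+ μ 3F) (+ n) ⟩
          + μ 0F ℤ.* + n ∎
          where open ≡-Reasoning
        r₀ = ratio {l₀} {K} {μ 0F} {n} 0<K (μ<K 0F) n>0 base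
        r₁ = ratio {l₁} {K} {μ 1F} {n} 0<K (μ<K 1F) n>0 (side {px} {μ 1F} {a} ex)
        r₂ = ratio {l₂} {K} {μ 2F} {n} 0<K (μ<K 2F) n>0 (side {py} {μ 2F} {b} ey)
        r₃ = ratio {pz} {K} {μ 3F} {n} 0<K (μ<K 3F) n>0 ez
        conclude : (∃ λ L → l₀ ≡ + L × L < n) → (∃ λ L → l₁ ≡ + L × L < n) → (∃ λ L → l₂ ≡ + L × L < n) →
                   (∃ λ L → pz ≡ + L × L < n) → ∃ λ Z → ℤ.+ Z ≡ pz × Z < n × S Z ≡ n
        conclude (L₀ , e₀ , L₀<n) (L₁ , e₁ , L₁<n) (L₂ , e₂ , L₂<n) (Z , e₃ , Z<n) = Z , sym e₃ , Z<n ,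
          trans (sum4-cong {g = value} residue) sum
          where
          value : Fin 4 → ℕ
          value 0F = L₀
          value 1F = L₁
          value 2F = L₂
          value 3F = Z
          complement : ∀ {e} → e < n → + (n ∸ e) ℤ.+ + e ≡ + n
          complement {e} e<n = trans (sym (ℤ.pos-+ (n ∸ e) e)) (cong +_ (m∸n+n≡m (<⇒≤ e<n)))
          predecessor : + pred n ℤ.+ + 1 ≡ + n
          predecessor = trans (sym (ℤ.pos-+ (pred n) 1)) (cong +_ (trans (+-comm (pred n) 1) (suc-pred n)))
          side-residue : ∀ {e L π} → e < n → L < n → + n ℤ.* π ℤ.- + e ℤ.* pz ≡ + L → (Z * (n ∸ e)) % n ≡ L
          side-residue {e} {L} {π} e<n L<n h = remainder-ℤ n (Z * (n ∸ e)) L (pz ℤ.- π) L<n (begin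
            + (Z * (n ∸ e))                  ≡⟨ trans (ℤ.pos-* Z (n ∸ e)) (cong (ℤ._* + (n ∸ e)) (sym e₃)) ⟩
            pz ℤ.* + (n ∸ e)
              ≡⟨ solve 4 (λ A e π p → p :* A := (A :+ e) :* π :- e :* p :+ (p :- π) :* (A :+ e)) refl (+ (n ∸ e)) (+ e) π pz ⟩
            (+ (n ∸ e) ℤ.+ + e) ℤ.* π ℤ.- + e ℤ.* pz ℤ.+ (pz ℤ.- π) ℤ.* (+ (n ∸ e) ℤ.+ + e)
              ≡⟨ cong (λ N → N ℤ.* π ℤ.- + e ℤ.* pz ℤ.+ (pz ℤ.- π) ℤ.* N) (complement e<n) ⟩
            + n ℤ.* π ℤ.- + e ℤ.* pz ℤ.+ (pz ℤ.- π) ℤ.* + n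
              ≡⟨ cong (ℤ._+ (pz ℤ.- π) ℤ.* + n) h ⟩
            + L ℤ.+ (pz ℤ.- π) ℤ.* + n ∎)
            where open ≡-Reasoning
          base-residue : (Z * (a + b + pred n)) % n ≡ L₀
          base-residue = remainder-ℤ n (Z * (a + b + pred n)) L₀ (pz ℤ.- + 1 ℤ.+ px ℤ.+ py) L₀<n (begin
            + (Z * (a + b + pred n))
              ≡⟨ trans (ℤ.pos-* Z (a + b + pred n)) (cong₂ ℤ._*_ (sym e₃) (trans (ℤ.pos-+ (a + b) (pred n)) (cong (ℤ._+ + pred n) (ℤ.pos-+ a b)))) ⟩
            pz ℤ.* (+ a ℤ.+ + b ℤ.+ + pred n)
              ≡⟨ solve 6 (λ a b m u v p → p :* (a :+ b :+ m) :=
                   (m :+ con (+ 1)) :- ((m :+ con (+ 1)) :* u :- a :* p) :- ((m :+ con (+ 1)) :* v :- b :* p) :- p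
                   :+ (p :- con (+ 1) :+ u :+ v) :* (m :+ con (+ 1))) refl (+ a) (+ b) (+ pred n) px py pz ⟩
            shape (+ pred n ℤ.+ + 1)       ≡⟨ cong shape predecessor ⟩
            l₀ ℤ.+ (pz ℤ.- + 1 ℤ.+ px ℤ.+ py) ℤ.* + n
              ≡⟨ cong (ℤ._+ (pz ℤ.- + 1 ℤ.+ px ℤ.+ py) ℤ.* + n) e₀ ⟩
            + L₀ ℤ.+ (pz ℤ.- + 1 ℤ.+ px ℤ.+ py) ℤ.* + n ∎)
            where
            open ≡-Reasoning
            shape : ℤ → ℤ
            shape N = N ℤ.- (N ℤ.* px ℤ.- + a ℤ.* pz) ℤ.- (N ℤ.* py ℤ.- + b ℤ.* pz) ℤ.- pz ℤ.+ (pz ℤ.- + 1 ℤ.+ px ℤ.+ py) ℤ.* N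
          residue : ∀ i → res Z i ≡ value i
          residue 0F = base-residue
          residue 1F = side-residue {π = px} a<n L₁<n e₁
          residue 2F = side-residue {π = py} b<n L₂<n e₂
          residue 3F = trans (res-last Z) (m<n⇒m%n≡m Z<n)
          sum : L₀ + L₁ + L₂ + Z ≡ n
          sum = ℤ.+-injective (begin
            + (L₀ + L₁ + L₂ + Z)
              ≡⟨ trans (ℤ.pos-+ (L₀ + L₁ + L₂) Z) (cong (ℤ._+ + Z)
                   (trans (ℤ.pos-+ (L₀ + L₁) L₂) (cong (ℤ._+ + L₂) (ℤ.pos-+ L₀ L₁)))) ⟩
            + L₀ ℤ.+ + L₁ ℤ.+ + L₂ ℤ.+ + Z    ≡⟨ cong₂ ℤ._+_ (cong₂ ℤ._+_ (cong₂ ℤ._+_ (sym e₀) (sym e₁)) (sym e₂)) (sym e₃) ⟩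
            l₀ ℤ.+ l₁ ℤ.+ l₂ ℤ.+ pz           ≡⟨ solve 4 (λ n u v p → n :- u :- v :- p :+ u :+ v :+ p := n) refl (+ n) l₁ l₂ pz ⟩
            + n ∎)
            where open ≡-Reasoning

-- From the residues back to the classification.

open import Defs
open import Data.Integer using (+_)
open import Data.Sum using (_⊎_; map)
open import Data.Bool using (true; _∧_) renaming (T to True)
open import Data.Fin.Patterns using (3F)
open import Data.List using (downFrom; length)
open import Data.List.Membership.Propositional.Properties using (∈-downFrom⁺; ∈-downFrom⁻)
open import Data.List.Relation.Unary.All using (tabulate)
open import Data.List.Relation.Unary.All.Properties using (all⁻)
open import Data.Nat
open import Data.Nat.Properties
open import Data.Nat.Coprimality using (coprime-divisor; gcd≡1⇒coprime)
open import Data.Nat.DivMod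
open import Data.Nat.Divisibility
open import Data.Nat.GCD using (gcd)
open import Data.Product using (_×_; proj₁; proj₂)
open import Relation.Binary.PropositionalEquality
open FloorSearch
open ResidueClasses
open Digits
open Enumeration
open Unimodular
open NormalForms
open InteriorResidue

module _ (n : ℕ) .{{_ : NonZero n}} (a b : ℕ) (a<n : a < n) (b<n : b < n) (one : OnePoint (T (+ a) (+ b) (+ n))) where
  open OnePointResidues n a b a<n b<n one

  private
    Z : ℕ
    Z = proj₁ interior-residue
    Z<n : Z < n
    Z<n = proj₁ (proj₂ (proj₂ interior-residue))
    open Residues n c n∣c refl using (S; res-last)
    SZ : S Z ≡ n
    SZ = proj₂ (proj₂ (proj₂ interior-residue))
    unique-Z : ∀ k → S k ≡ n → (∀ i → 0 < (k * c i) % n) × k % n ≡ Z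
    unique-Z = unique (proj₁ (proj₂ interior-residue))
  open Residues.UniqueInterior n c n∣c refl Z Z<n SZ unique-Z

  is-plausible : True (plausible n a b)
  is-plausible = ∧-intro {exactlyOne (level-one n a b) (downFrom n)}
    (exactlyOne-intro (level-one n a b) (downFrom n) (∈-downFrom⁺ Z<n) (≡⇒≡ᵇ (S Z) n SZ)
      (λ {k} k∈ hit → trans (sym (m<n⇒m%n≡m (∈-downFrom⁻ k∈))) (proj₂ (unique-Z k (≡ᵇ⇒≡ (S k) n hit)))))
    (all⁻ _ (tabulate {P = λ k → True ((0 <ᵇ k) ⇒ᵇ all4 (λ i → 0 <ᵇ (k * c i) % n))} (λ {k} k∈ → ⇒ᵇ-intro {0 <ᵇ k} λ 0<k →
      all4-intro _ (λ i → <⇒<ᵇ (res-positive k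
        (λ h → <-irrefl (sym (trans (sym (m<n⇒m%n≡m (∈-downFrom⁻ k∈))) h)) (<ᵇ⇒< 0 k 0<k)) i)))))

  -- From m ξ₃ = d₃ n and coprimality m divides n. With g = n / m this turns the ratios into ξ = d
  -- g, the form in which the coset argument bounds g.
  is-complete : Proportion good → complete n ≡ true
  is-complete (proportion zero d () _)
  is-complete (proportion m@(suc _) d ok ratio) = from (coprime-divisor {m} {d 3F} {n} (gcd≡1⇒coprime {m} {d 3F} coprime) m∣d₃n)
    where
    m<20 : m < 20
    m<20 = <ᵇ⇒< m 20 (proj₁ (∧-elim {m <ᵇ 20} ok))
    rest : True ((gcd m (d 3F) ≡ᵇ 1) ∧ (length (candidates m d) <ᵇ bound m))
    rest = proj₂ (∧-elim {m <ᵇ 20} ok)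
    coprime : gcd m (d 3F) ≡ 1
    coprime = ≡ᵇ⇒≡ (gcd m (d 3F)) 1 (proj₁ (∧-elim {gcd m (d 3F) ≡ᵇ 1} rest))
    few : length (candidates m d) < bound m
    few = <ᵇ⇒< (length (candidates m d)) (bound m) (proj₂ (∧-elim {gcd m (d 3F) ≡ᵇ 1} rest))
    m∣d₃n : m ∣ d 3F * n
    m∣d₃n = divides (ξ 3F) (trans (sym (ratio 3F)) (*-comm m (ξ 3F)))
    from : m ∣ n → complete n ≡ true
    from (divides g n≡gm) = subst (λ k → complete k ≡ true) (sym n≡mg)
        -- The strictness of `few` absorbs the 1 that `index≤` adds to the number of candidates.
        (complete-multiple m g m<20 g>0 (≤-trans index≤ few))
      where
      n≡mg : n ≡ m * g
      n≡mg = trans n≡gm (*-comm g m)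
      g>0 : 0 < g
      g>0 = n≢0⇒n>0 λ g≡0 → <-irrefl (sym (trans n≡gm (cong (_* m) g≡0))) n>0
      instance
        g≢0 : NonZero g
        g≢0 = >-nonZero g>0
      ξ≡dg : ∀ i → ξ i ≡ d i * g
      ξ≡dg i = *-cancelˡ-≡ (ξ i) (d i * g) m (trans (ratio i) (trans (cong (d i *_) n≡gm)
        (trans (sym (*-assoc (d i) g m)) (*-comm (d i * g) m))))
      open Subgroup n c n∣c refl Z Z<n SZ unique-Z m g n≡mg d ξ≡dg using (index≤)

  classified : Classified (T (+ a) (+ b) (+ n))
  classified = complete-elim n (is-complete (ratios good 17 search-succeeds)) a b a<n b<n is-plausible

theorem7 : (v : Tetra) → OnePoint v →
  Equivalent v (T (+ 3) (+ 3) (+ 4)) ⊎ (Equivalent v (T (+ 2) (+ 2) (+ 5)) ⊎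
  (Equivalent v (T (+ 2) (+ 4) (+ 7)) ⊎ (Equivalent v (T (+ 2) (+ 6) (+ 11)) ⊎
  (Equivalent v (T (+ 2) (+ 7) (+ 13)) ⊎ (Equivalent v (T (+ 2) (+ 9) (+ 17)) ⊎
  (Equivalent v (T (+ 2) (+ 13) (+ 19)) ⊎ Equivalent v (T (+ 3) (+ 7) (+ 20))))))))
theorem7 v one = conclude (normal-form v one)
  where
  conclude : NormalForm v → Classified v
  conclude (normal n a b n>0 a<n b<n eq one′) =
    map (to 3 3 4) (map (to 2 2 5) (map (to 2 4 7) (map (to 2 6 11)
      (map (to 2 7 13) (map (to 2 9 17) (map (to 2 13 19) (to 3 7 20)))))))
      (classified n {{>-nonZero n>0}} a b a<n b<n one′)
    where
    to : ∀ a′ b′ n′ → Equivalent (T (+ a) (+ b) (+ n)) (T (+ a′) (+ b′) (+ n′)) → Equivalent v (T (+ a′) (+ b′) (+ n′))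
    to a′ b′ n′ = Equivalent-trans {v} {T (+ a) (+ b) (+ n)} {T (+ a′) (+ b′) (+ n′)} eq
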